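{- Let $k\ge3$ be odd and let $n,B\in\mathbb{N}$ with $n\ge kB$ and $k\le B$; let $f_j=1/j$ for $j\in[n]$. Let $h_1,\dots,h_k:[n]\to[B]$ and $s_1,\dots,s_k:[n]\to\{ -1,1\}$ be independent, truly (uniformly) random hash functions. For $i\in[n]$ define $$\tilde f_i=\operatorname{median}_{\ell\in[k]}\Big(s_\ell(i)\sum_{j\in[n]}[h_\ell(j)=h_\ell(i)]\,s_\ell(j)\,f_j\Big).$$ Then for every $i\in[n]$, $$\mathbb{E}\big[|\tilde f_i-f_i|\big]=\Omega\!\left(\frac{1}{B\sqrt{k}\log k}\right)\quad\text{and}\quad \mathbb{E}\big[|\tilde f_i-f_i|\big]=O\!\left(\frac{1}{B\sqrt{k}}\right),$$ with absolute implied constants.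
   Context: $[E]$ denotes the indicator of the event $E$; the median of $k$ (odd) reals is the middle value after sorting. This is the Count-Sketch estimate with $k$ rows of $B$ buckets each for Zipfian frequencies $f_j=1/j$. -}

module Defs where

open import Data.Nat as ℕ using (ℕ; zero; suc; _/_)
open import Data.Nat.Logarithm using (⌈log₂_⌉)
open import Data.Fin using (Fin; toℕ)
open import Data.Fin.Properties using () renaming (_≟_ to _≟ᶠ_)
open import Data.Bool using (Bool; true; false; if_then_else_)
open import Data.Product using (_×_; _,_)
open import Data.List using (List; []; _∷_; drop; length; tabulate)
open import Data.Vec.Functional using () renaming (_∷_ to _∷ᶠ_)
open import Data.Integer using (+_; -[1+_])
open import Data.Rational as ℚ using (ℚ; 0ℚ; 1ℚ; _+_; _*_; _-_; ∣_∣)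
import Data.Rational.Properties as ℚP
open import Data.List.Sort.InsertionSort ℚP.≤-decTotalOrder using (sort)
open import Relation.Nullary.Decidable using (does)

Expect : Set → Set
Expect A = (A → ℚ) → ℚ

sumFin : (m : ℕ) → (Fin m → ℚ) → ℚ
sumFin zero    f = 0ℚ
sumFin (suc m) f = f Fin.zero + sumFin m (λ i → f (Fin.suc i))
  where import Data.Fin as Fin

-- Uniform expectation on Fin m (junk value 0 for the empty type m = 0).
EFin : (m : ℕ) → Expect (Fin m)
EFin zero    f = 0ℚ
EFin (suc m) f = sumFin (suc m) f * ((+ 1) ℚ./ suc m)

-- Uniform expectation on a sign {-1,+1}, encoded as Bool (true = +1).
EBool : Expect Bool
EBool f = (f true + f false) * ((+ 1) ℚ./ 2)

-- Uniform expectation over all functions Fin n → A, the values at the n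
-- points being independent and each uniform (product distribution).
EFun : {A : Set} (n : ℕ) → Expect A → Expect (Fin n → A)
EFun zero    EA f = f (λ ())
EFun (suc n) EA f = EA (λ a → EFun n EA (λ g → f (a ∷ᶠ g)))

EPair : {A C : Set} → Expect A → Expect C → Expect (A × C)
EPair EA EC f = EA (λ a → EC (λ c → f (a , c)))

sgn : Bool → ℚ
sgn true  = 1ℚ
sgn false = ℚ.- 1ℚ

iv : {B : ℕ} → Fin B → Fin B → ℚ
iv a b = if does (a ≟ᶠ b) then 1ℚ else 0ℚ

-- Zipfian frequencies f_j = 1/j for j ∈ [n] = {1,..,n}; index j : Fin n stands for j+1.
zipf : {n : ℕ} → Fin n → ℚ
zipf j = (+ 1) ℚ./ suc (toℕ j)

-- Median of a list of odd length: the middle element after sorting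
-- (junk value 0 for the empty list).
headOr : ℚ → List ℚ → ℚ
headOr d []      = d
headOr d (x ∷ _) = x

median : List ℚ → ℚ
median xs = headOr 0ℚ (drop (length xs / 2) (sort xs))

Hashes : ℕ → ℕ → ℕ → Set
Hashes k n B = (Fin k → Fin n → Fin B) × (Fin k → Fin n → Bool)

EHashes : (k n B : ℕ) → Expect (Hashes k n B)
EHashes k n B = EPair (EFun k (EFun n (EFin B))) (EFun k (EFun n EBool))

rowEst : {k n B : ℕ} → Hashes k n B → Fin k → Fin n → ℚ
rowEst {n = n} (h , s) ℓ i =
  sgn (s ℓ i) * sumFin n (λ j → iv (h ℓ j) (h ℓ i) * (sgn (s ℓ j) * zipf j))

estimate : {k n B : ℕ} → Hashes k n B → Fin n → ℚ
estimate {k} H i = median (tabulate {n = k} (λ ℓ → rowEst H ℓ i))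

expErr : (k n B : ℕ) → Fin n → ℚ
expErr k n B i = EHashes k n B (λ H → ∣ estimate H i - zipf i ∣)

fromℕ : ℕ → ℚ
fromℕ m = (+ m) ℚ./ 1

{-# OPTIONS --safe #-}
module Submission where
open import Defs
open import Data.Nat as ℕ using (ℕ; zero; suc; _≤_; _%_; z≤n; s≤s) renaming (_*_ to _*ℕ_)
import Data.Nat.Properties as ℕP
import Data.Rational.Properties as ℚP
open import Data.Nat.DivMod using (m≡m%n+[m/n]*n; m/n<m; m%n<n; m/n*n≤m; /-monoˡ-≤)
open import Data.Nat.Induction using (<-rec)
open import Data.List.Sort.InsertionSort.Base ℚP.≤-decTotalOrder using (sort)
open import Data.List.Sort.InsertionSort.Properties ℚP.≤-decTotalOrder using (sort-↭; sort-↗)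
open import Data.List.Relation.Unary.All using (All; []; _∷_)
open import Data.List.Relation.Unary.AllPairs using (AllPairs; []; _∷_)
open import Data.List.Relation.Unary.Linked.Properties using (Linked⇒AllPairs)
open import Data.List.Relation.Binary.Permutation.Propositional.Properties using (↭-length; filter-↭)
import Data.Vec.Properties as VecP
import Data.List.Properties as ListP
open import Data.Nat.Logarithm using (⌈log₂_⌉; ⌈log₂⌉-mono-≤; ⌈log₂2^n⌉≡n; ⌈log₂⌈n/2⌉⌉≡⌈log₂n⌉∸1)
open import Data.Fin as Fin using (Fin; toℕ)
open import Data.Fin.Properties using () renaming (_≟_ to _≟ᶠ_)
open import Data.Vec as Vec using (Vec; []; _∷_)
open import Data.Vec.Functional using () renaming (_∷_ to _∷ᶠ_)
open import Data.List as List using (List; []; _∷_)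
open import Data.Product using (Σ; _×_; _,_; proj₁; proj₂)
open import Data.Sum using (_⊎_; inj₁; inj₂)
open import Data.Empty using (⊥-elim)
open import Data.Bool using (Bool; true; false; if_then_else_)
open import Data.Rational as ℚ using (ℚ; 0ℚ; 1ℚ; ½; _+_; _*_; _-_; -_; _<_; ∣_∣) renaming (_≤_ to _≤ℚ_)
import Data.Rational.Unnormalised as ℚᵘ
import Data.Rational.Unnormalised.Properties as ℚᵘP
open import Data.Integer as ℤ using ()
import Data.Integer.Properties as ℤP
open import Relation.Nullary using (¬_; Dec; yes; no)
open import Relation.Nullary.Decidable using (does; dec⇒maybe; dec-true; dec-false)
open import Relation.Binary.PropositionalEquality using (_≡_; refl; sym; trans; cong; cong₂; subst; subst₂; module ≡-Reasoning)
open import Tactic.RingSolver using (solve-∀)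
open import Tactic.RingSolver.Core.AlmostCommutativeRing using (AlmostCommutativeRing; fromCommutativeRing)

-- Write X_ℓ for the error of row ℓ.  The X_ℓ are independent copies of a lazy signed sum
-- X = Σ_{j≠i} b_j σ_j / j with P(b_j = 1) = 1/B, and the error of the estimate is their median.
--
-- Upper bound: P(|X| > t) ≤ 3/(Bt) (charge the elements j ≤ 1/t individually, the others by
-- their variance), and P(|X| ≤ t) ≥ c min(1, Bt) by writing X as a difference of two identically
-- distributed sums and counting collisions among bins of width t.  Since the sign of X is
-- symmetric, the median exceeds t only if a count with mean k/2 − Ω(k P(|X| ≤ t)) reaches k/2;
-- Chebyshev and a pair count bound this, and summing over t = 8^m/(B√k) gives O(1/(B√k)).
--
-- Lower bound: among the first 4 B log k elements at least log k collide, except with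
-- probability 1/k, and resampling the position of one of them shows P(|X| ≤ ε) = O(1/√k) with a
-- small constant for ε of order 1/(B √k log k).  Then the difference S of the numbers of rows
-- above ε and below −ε exceeds the number M of remaining rows with constant probability (compare
-- the second and fourth moments of S), which forces |median| > ε.  For bounded k it
-- is enough that all rows exceed 1/(2B) simultaneously with probability bounded below.

-- Rational arithmetic

-- All quantities are rational, so the theorem bounds squares; inside the proof an integer `suc s`
-- with (s+1)² ≤ k ≤ 4(s+1)² stands for √k, and Bernoulli's inequality replaces exponentials.
--
-- Neither count bound suffices alone for the upper bound. Chebyshev gives an error tail of order
-- q/k with q = P(X > t) of order 1/(Bt); past t = 1/B every geometric scale then contributes the
-- same 1/(Bk), and the number of scales is not bounded in terms of k and B. The pair count gives
-- order q², which is summable there but too weak at small t.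
--
-- The logarithm in the lower bound is the price of spacing. To see log k collisions except with
-- probability 1/k, about 4B log k elements are inspected; with h of them, their weights are only
-- 1/h² apart, so about 1 + εh² of them can move the sum into [-ε, ε]. Each enters with odds about
-- 1/B and the total is shared by log k collisions, which leaves P(|X| ≤ ε) of order εB log k plus
-- terms of order 1/k. This needs 4B log k < n, hence 4 log k < k: one reason why bounded k is
-- treated apart.

ring : AlmostCommutativeRing _ _
ring = fromCommutativeRing ℚP.+-*-commutativeRing (λ x → dec⇒maybe (0ℚ ℚP.≟ x))

≥0-sub : ∀ {x y} → x ≤ℚ y → 0ℚ ≤ℚ y - x
≥0-sub {x} {y} x≤y = subst (_≤ℚ y - x) (ℚP.+-inverseʳ x) (ℚP.+-monoˡ-≤ (- x) x≤y)

-- Nearly every nonlinear inequality below is certified this way: the remainder is a sum of products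
-- of nonnegative factors, most of them hypotheses passed through `≥0-sub`, and the identity is left
-- to the ring solver.
≤-byDiff : ∀ {x y r} → 0ℚ ≤ℚ r → y ≡ x + r → x ≤ℚ y
≤-byDiff {x} {r = r} 0≤r refl = subst (_≤ℚ x + r) (ℚP.+-identityʳ x) (ℚP.+-monoʳ-≤ x 0≤r)

≥0-+ : ∀ {x y} → 0ℚ ≤ℚ x → 0ℚ ≤ℚ y → 0ℚ ≤ℚ x + y
≥0-+ = ℚP.+-mono-≤

*-monoʳ : ∀ {z x y} → 0ℚ ≤ℚ z → x ≤ℚ y → z * x ≤ℚ z * y
*-monoʳ {z} z≥0 = ℚP.*-monoˡ-≤-nonNeg z {{ℚ.nonNegative z≥0}}

*-monoˡ : ∀ {z x y} → 0ℚ ≤ℚ z → x ≤ℚ y → x * z ≤ℚ y * z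
*-monoˡ {z} z≥0 = ℚP.*-monoʳ-≤-nonNeg z {{ℚ.nonNegative z≥0}}

*-mono : ∀ {x y z w} → 0ℚ ≤ℚ x → 0ℚ ≤ℚ z → x ≤ℚ y → z ≤ℚ w → x * z ≤ℚ y * w
*-mono x≥0 z≥0 x≤y z≤w = ℚP.≤-trans (*-monoˡ z≥0 x≤y) (*-monoʳ (ℚP.≤-trans x≥0 x≤y) z≤w)

≥0-* : ∀ {x y} → 0ℚ ≤ℚ x → 0ℚ ≤ℚ y → 0ℚ ≤ℚ x * y
≥0-* {x} {y} x≥0 y≥0 = subst (_≤ℚ x * y) (ℚP.*-zeroʳ x) (*-monoʳ x≥0 y≥0)

>0-* : ∀ {x y} → 0ℚ < x → 0ℚ < y → 0ℚ < x * y
>0-* {x} {y} x>0 y>0 = subst (_< x * y) (ℚP.*-zeroʳ x) (ℚP.*-monoʳ-<-pos x {{ℚ.positive x>0}} y>0)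

*-cancel-≤ : ∀ {z x y} → 0ℚ < z → z * x ≤ℚ z * y → x ≤ℚ y
*-cancel-≤ {z} z>0 = ℚP.*-cancelˡ-≤-pos z {{ℚ.positive z>0}}

≥0-neg : ∀ {x} → x ≤ℚ 0ℚ → 0ℚ ≤ℚ - x
≥0-neg = ℚP.neg-antimono-≤

≥0-² : ∀ x → 0ℚ ≤ℚ x * x
≥0-² x with ℚP.≤-total 0ℚ x
... | inj₁ x≥0 = ≥0-* x≥0 x≥0
... | inj₂ x≤0 = subst (0ℚ ≤ℚ_) (h x) (≥0-* (≥0-neg x≤0) (≥0-neg x≤0))
  where
  h : ∀ x → (- x) * (- x) ≡ x * x
  h = solve-∀ ring

abs-lub : ∀ {x y} → x ≤ℚ y → - x ≤ℚ y → ∣ x ∣ ≤ℚ y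
abs-lub {x} {y} x≤y -x≤y with ℚP.∣p∣≡p∨∣p∣≡-p x
... | inj₁ e = subst (_≤ℚ y) (sym e) x≤y
... | inj₂ e = subst (_≤ℚ y) (sym e) -x≤y

x≤∣x∣ : ∀ x → x ≤ℚ ∣ x ∣
x≤∣x∣ x with ℚP.≤-total 0ℚ x
... | inj₁ x≥0 = ℚP.≤-reflexive (sym (ℚP.0≤p⇒∣p∣≡p x≥0))
... | inj₂ x≤0 = ℚP.≤-trans x≤0 (ℚP.0≤∣p∣ x)

-x≤∣x∣ : ∀ x → - x ≤ℚ ∣ x ∣
-x≤∣x∣ x = subst (- x ≤ℚ_) (ℚP.∣-p∣≡∣p∣ x) (x≤∣x∣ (- x))

∣x∣²≡x² : ∀ x → ∣ x ∣ * ∣ x ∣ ≡ x * x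
∣x∣²≡x² x = trans (sym (ℚP.∣p*q∣≡∣p∣*∣q∣ x x)) (ℚP.0≤p⇒∣p∣≡p (≥0-² x))

fromℕ-toℚᵘ : ∀ m → ℚ.toℚᵘ (fromℕ m) ℚᵘ.≃ ℚᵘ.mkℚᵘ (ℤ.+ m) 0
fromℕ-toℚᵘ m = ℚP.toℚᵘ-fromℚᵘ (ℚᵘ.mkℚᵘ (ℤ.+ m) 0)

fromℕ-+ : ∀ m n → fromℕ (m ℕ.+ n) ≡ fromℕ m + fromℕ n
fromℕ-+ m n = ℚP.toℚᵘ-injective (begin
  ℚ.toℚᵘ (fromℕ (m ℕ.+ n))                      ≈⟨ fromℕ-toℚᵘ (m ℕ.+ n) ⟩
  ℚᵘ.mkℚᵘ (ℤ.+ (m ℕ.+ n)) 0                     ≈⟨ ℚᵘ.*≡* (cong (ℤ._* ℤ.+ 1) (sym (cong₂ ℤ._+_ (ℤP.*-identityʳ (ℤ.+ m)) (ℤP.*-identityʳ (ℤ.+ n))))) ⟩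
  ℚᵘ.mkℚᵘ (ℤ.+ m) 0 ℚᵘ.+ ℚᵘ.mkℚᵘ (ℤ.+ n) 0      ≈⟨ ℚᵘP.≃-sym (ℚᵘP.+-cong (fromℕ-toℚᵘ m) (fromℕ-toℚᵘ n)) ⟩
  ℚ.toℚᵘ (fromℕ m) ℚᵘ.+ ℚ.toℚᵘ (fromℕ n)        ≈⟨ ℚᵘP.≃-sym (ℚP.toℚᵘ-homo-+ (fromℕ m) (fromℕ n)) ⟩
  ℚ.toℚᵘ (fromℕ m + fromℕ n)                    ∎)
  where open ℚᵘP.≃-Reasoning

fromℕ-* : ∀ m n → fromℕ (m *ℕ n) ≡ fromℕ m * fromℕ n
fromℕ-* m n = ℚP.toℚᵘ-injective (begin
  ℚ.toℚᵘ (fromℕ (m *ℕ n))                       ≈⟨ fromℕ-toℚᵘ (m *ℕ n) ⟩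
  ℚᵘ.mkℚᵘ (ℤ.+ (m *ℕ n)) 0                      ≈⟨ ℚᵘ.*≡* (cong (ℤ._* ℤ.+ 1) (ℤP.pos-* m n)) ⟩
  ℚᵘ.mkℚᵘ (ℤ.+ m) 0 ℚᵘ.* ℚᵘ.mkℚᵘ (ℤ.+ n) 0      ≈⟨ ℚᵘP.≃-sym (ℚᵘP.*-cong (fromℕ-toℚᵘ m) (fromℕ-toℚᵘ n)) ⟩
  ℚ.toℚᵘ (fromℕ m) ℚᵘ.* ℚ.toℚᵘ (fromℕ n)        ≈⟨ ℚᵘP.≃-sym (ℚP.toℚᵘ-homo-* (fromℕ m) (fromℕ n)) ⟩
  ℚ.toℚᵘ (fromℕ m * fromℕ n)                    ∎)
  where open ℚᵘP.≃-Reasoning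

fromℕ-suc : ∀ m → fromℕ (suc m) ≡ 1ℚ + fromℕ m
fromℕ-suc m = fromℕ-+ 1 m

0≤1 : 0ℚ ≤ℚ 1ℚ
0≤1 = ℚP.<⇒≤ (ℚP.positive⁻¹ 1ℚ)

fromℕ≥0 : ∀ m → 0ℚ ≤ℚ fromℕ m
fromℕ≥0 zero    = ℚP.≤-refl
fromℕ≥0 (suc m) = subst (0ℚ ≤ℚ_) (sym (fromℕ-suc m)) (≥0-+ 0≤1 (fromℕ≥0 m))

fromℕ-mono : ∀ {m n} → m ≤ n → fromℕ m ≤ℚ fromℕ n
fromℕ-mono {m} {n} m≤n = ≤-byDiff (fromℕ≥0 (n ℕ.∸ m)) (trans (cong fromℕ (sym (ℕP.m+[n∸m]≡n m≤n))) (fromℕ-+ m (n ℕ.∸ m)))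

fromℕ-mono-< : ∀ {m n} → m ℕ.< n → fromℕ m < fromℕ n
fromℕ-mono-< {m} m<n = ℚP.<-≤-trans
  (subst₂ _<_ (ℚP.+-identityˡ (fromℕ m)) (sym (fromℕ-suc m)) (ℚP.+-monoˡ-< (fromℕ m) (ℚP.positive⁻¹ 1ℚ)))
  (fromℕ-mono m<n)

fromℕ>0 : ∀ m → 0ℚ < fromℕ (suc m)
fromℕ>0 m = fromℕ-mono-< {0} {suc m} (s≤s z≤n)

suc*recip : ∀ m → fromℕ (suc m) * ((ℤ.+ 1) ℚ./ suc m) ≡ 1ℚ
suc*recip m = ℚP.toℚᵘ-injective (begin
  ℚ.toℚᵘ (fromℕ (suc m) * ((ℤ.+ 1) ℚ./ suc m))                ≈⟨ ℚP.toℚᵘ-homo-* (fromℕ (suc m)) ((ℤ.+ 1) ℚ./ suc m) ⟩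
  ℚ.toℚᵘ (fromℕ (suc m)) ℚᵘ.* ℚ.toℚᵘ ((ℤ.+ 1) ℚ./ suc m)      ≈⟨ ℚᵘP.*-cong (fromℕ-toℚᵘ (suc m)) (ℚP.toℚᵘ-fromℚᵘ (ℚᵘ.mkℚᵘ (ℤ.+ 1) m)) ⟩
  ℚᵘ.mkℚᵘ (ℤ.+ suc m) 0 ℚᵘ.* ℚᵘ.mkℚᵘ (ℤ.+ 1) m                ≈⟨ ℚᵘ.*≡* (trans (ℤP.*-identityʳ _) (trans (ℤP.*-identityʳ (ℤ.+ suc m)) (sym (trans (ℤP.*-identityˡ _) (ℤP.*-identityˡ (ℤ.+ suc m)))))) ⟩
  ℚ.toℚᵘ 1ℚ                                                   ∎)
  where open ℚᵘP.≃-Reasoning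

recip≥0 : ∀ m → 0ℚ ≤ℚ (ℤ.+ 1) ℚ./ suc m
recip≥0 m = *-cancel-≤ (fromℕ>0 m) (subst₂ _≤ℚ_ (sym (ℚP.*-zeroʳ (fromℕ (suc m)))) (sym (suc*recip m)) 0≤1)

-- The threshold comes first. Indicators are rational-valued so that a probability is simply the
-- expectation of one.
gt : ℚ → ℚ → ℚ
gt t x = if does (t ℚP.<? x) then 1ℚ else 0ℚ

gt-yes : ∀ {t x} → t < x → gt t x ≡ 1ℚ
gt-yes {t} {x} t<x rewrite dec-true (t ℚP.<? x) t<x = refl

gt-no : ∀ {t x} → x ≤ℚ t → gt t x ≡ 0ℚ
gt-no {t} {x} x≤t rewrite dec-false (t ℚP.<? x) (λ t<x → ℚP.<-irrefl refl (ℚP.<-≤-trans t<x x≤t)) = refl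

data GtView (t x : ℚ) : Set where
  above : t < x → gt t x ≡ 1ℚ → GtView t x
  below : x ≤ℚ t → gt t x ≡ 0ℚ → GtView t x

gtView : ∀ t x → GtView t x
gtView t x with ℚP.≤-total x t
... | inj₁ x≤t = below x≤t (gt-no x≤t)
... | inj₂ t≤x with t ℚP.<? x
...   | yes t<x = above t<x (gt-yes t<x)
...   | no  t≮x = below (ℚP.≮⇒≥ t≮x) (gt-no (ℚP.≮⇒≥ t≮x))

gt≥0 : ∀ t x → 0ℚ ≤ℚ gt t x
gt≥0 t x with gtView t x
... | above _ e = subst (0ℚ ≤ℚ_) (sym e) 0≤1
... | below _ e = ℚP.≤-reflexive (sym e)

gt≤1 : ∀ t x → gt t x ≤ℚ 1ℚ
gt≤1 t x with gtView t x
... | above _ e = ℚP.≤-reflexive e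
... | below _ e = subst (_≤ℚ 1ℚ) (sym e) 0≤1

gt-idem : ∀ t x → gt t x * gt t x ≡ gt t x
gt-idem t x with gtView t x
... | above _ e = trans (cong₂ _*_ e e) (sym e)
... | below _ e = trans (cong₂ _*_ e e) (sym e)

-- Expectations

-- The moment and tail arguments use an expectation only through these four laws. `ext` follows from
-- `mono` by antisymmetry, which avoids function extensionality.
record IsExpect {A : Set} (E : Expect A) : Set where
  field
    mono  : ∀ {f g} → (∀ a → f a ≤ℚ g a) → E f ≤ℚ E g
    add   : ∀ f g → E (λ a → f a + g a) ≡ E f + E g
    scale : ∀ c f → E (λ a → c * f a) ≡ c * E f
    const : ∀ c → E (λ _ → c) ≡ c

  ext : ∀ {f g} → (∀ a → f a ≡ g a) → E f ≡ E g
  ext f≗g = ℚP.≤-antisym (mono (λ a → ℚP.≤-reflexive (f≗g a))) (mono (λ a → ℚP.≤-reflexive (sym (f≗g a))))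

  nonneg : ∀ {f} → (∀ a → 0ℚ ≤ℚ f a) → 0ℚ ≤ℚ E f
  nonneg {f} f≥0 = subst (_≤ℚ E f) (const 0ℚ) (mono f≥0)

  ≤1 : ∀ {f} → (∀ a → f a ≤ℚ 1ℚ) → E f ≤ℚ 1ℚ
  ≤1 {f} f≤1 = subst (E f ≤ℚ_) (const 1ℚ) (mono f≤1)

  affine : ∀ c d f → E (λ a → c + d * f a) ≡ c + d * E f
  affine c d f = trans (add (λ _ → c) (λ a → d * f a)) (cong₂ _+_ (const c) (scale d f))

open IsExpect

-- A formal linear combination lets one lemma take the expectation of a whole polynomial at once.
-- The empty list is the origin of the trailing `+ 0ℚ` in many ring identities below.
combination : {A : Set} → List (ℚ × (A → ℚ)) → A → ℚ
combination []            a = 0ℚ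
combination ((c , f) ∷ l) a = c * f a + combination l a

combinationᴱ : {A : Set} → Expect A → List (ℚ × (A → ℚ)) → ℚ
combinationᴱ E []            = 0ℚ
combinationᴱ E ((c , f) ∷ l) = c * E f + combinationᴱ E l

module _ {A : Set} {E : Expect A} (isE : IsExpect E) where

  expect-linear : ∀ l → E (combination l) ≡ combinationᴱ E l
  expect-linear []            = const isE 0ℚ
  expect-linear ((c , f) ∷ l) = trans (add isE (λ a → c * f a) (combination l)) (cong₂ _+_ (scale isE c f) (expect-linear l))

  expect-affine : ∀ c l → E (λ a → c + combination l a) ≡ c + combinationᴱ E l
  expect-affine c l = trans (add isE (λ _ → c) (combination l)) (cong₂ _+_ (const isE c) (expect-linear l))

-- Fubini's theorem for `E` against an arbitrary second expectation; it is established for each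
-- concrete finite expectation and lifted to products.
Commutes : {A : Set} → Expect A → Set₁
Commutes {A} E = ∀ {C : Set} {E′ : Expect C} → IsExpect E′ → ∀ (f : A → C → ℚ) →
  E (λ a → E′ (λ c → f a c)) ≡ E′ (λ c → E (λ a → f a c))

sumFin-mono : ∀ m {f g} → (∀ i → f i ≤ℚ g i) → sumFin m f ≤ℚ sumFin m g
sumFin-mono zero    f≤g = ℚP.≤-refl
sumFin-mono (suc m) f≤g = ℚP.+-mono-≤ (f≤g _) (sumFin-mono m (λ i → f≤g _))

sumFin-cong : ∀ m {f g} → (∀ i → f i ≡ g i) → sumFin m f ≡ sumFin m g
sumFin-cong zero    f≗g = refl
sumFin-cong (suc m) f≗g = cong₂ _+_ (f≗g _) (sumFin-cong m (λ i → f≗g _))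

sumFin-+ : ∀ m f g → sumFin m (λ i → f i + g i) ≡ sumFin m f + sumFin m g
sumFin-+ zero    f g = refl
sumFin-+ (suc m) f g = trans (cong (λ z → f Fin.zero + g Fin.zero + z) (sumFin-+ m (λ i → f (Fin.suc i)) (λ i → g (Fin.suc i))))
  (h (f Fin.zero) (g Fin.zero) (sumFin m (λ i → f (Fin.suc i))) (sumFin m (λ i → g (Fin.suc i))))
  where
  h : ∀ a b c d → a + b + (c + d) ≡ a + c + (b + d)
  h = solve-∀ ring

sumFin-* : ∀ m c f → sumFin m (λ i → c * f i) ≡ c * sumFin m f
sumFin-* zero    c f = sym (ℚP.*-zeroʳ c)
sumFin-* (suc m) c f = trans (cong (λ z → c * f Fin.zero + z) (sumFin-* m c (λ i → f (Fin.suc i))))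
  (sym (ℚP.*-distribˡ-+ c (f Fin.zero) (sumFin m (λ i → f (Fin.suc i)))))

sumFin-const : ∀ m c → sumFin m (λ _ → c) ≡ fromℕ m * c
sumFin-const zero    c = sym (ℚP.*-zeroˡ c)
sumFin-const (suc m) c = trans (cong (c +_) (sumFin-const m c)) (trans (h c (fromℕ m)) (cong (_* c) (sym (fromℕ-suc m))))
  where
  h : ∀ c m → c + m * c ≡ (1ℚ + m) * c
  h = solve-∀ ring

isExpect-EFin : ∀ m → IsExpect (EFin (suc m))
isExpect-EFin m .mono f≤g = *-monoˡ (recip≥0 m) (sumFin-mono (suc m) f≤g)
isExpect-EFin m .add f g = trans (cong₂ _*_ (sumFin-+ (suc m) f g) refl) (ℚP.*-distribʳ-+ ((ℤ.+ 1) ℚ./ suc m) (sumFin (suc m) f) (sumFin (suc m) g))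
isExpect-EFin m .scale c f = trans (cong₂ _*_ (sumFin-* (suc m) c f) refl) (ℚP.*-assoc c (sumFin (suc m) f) ((ℤ.+ 1) ℚ./ suc m))
isExpect-EFin m .const c = begin
  sumFin (suc m) (λ _ → c) * r  ≡⟨ cong (_* r) (sumFin-const (suc m) c) ⟩
  fromℕ (suc m) * c * r         ≡⟨ h (fromℕ (suc m)) c r ⟩
  fromℕ (suc m) * r * c         ≡⟨ cong (_* c) (suc*recip m) ⟩
  1ℚ * c                        ≡⟨ ℚP.*-identityˡ c ⟩
  c                             ∎
  where
  open ≡-Reasoning
  r = (ℤ.+ 1) ℚ./ suc m
  h : ∀ a b c → a * b * c ≡ a * c * b
  h = solve-∀ ring

isExpect-EBool : IsExpect EBool
isExpect-EBool .mono f≤g = *-monoˡ (recip≥0 1) (ℚP.+-mono-≤ (f≤g true) (f≤g false))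
isExpect-EBool .add f g = h (f true) (g true) (f false) (g false)
  where
  h : ∀ a b c d → (a + b + (c + d)) * ((ℤ.+ 1) ℚ./ 2) ≡ (a + c) * ((ℤ.+ 1) ℚ./ 2) + (b + d) * ((ℤ.+ 1) ℚ./ 2)
  h = solve-∀ ring
isExpect-EBool .scale c f = h c (f true) (f false)
  where
  h : ∀ c a b → (c * a + c * b) * ((ℤ.+ 1) ℚ./ 2) ≡ c * ((a + b) * ((ℤ.+ 1) ℚ./ 2))
  h = solve-∀ ring
isExpect-EBool .const = h
  where
  h : ∀ c → (c + c) * ((ℤ.+ 1) ℚ./ 2) ≡ c
  h = solve-∀ ring

module _ {A : Set} {E : Expect A} (isE : IsExpect E) where

  isExpect-EFun : ∀ n → IsExpect (EFun n E)
  isExpect-EFun zero    .mono f≤g = f≤g _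
  isExpect-EFun zero    .add f g = refl
  isExpect-EFun zero    .scale c f = refl
  isExpect-EFun zero    .const c = refl
  isExpect-EFun (suc n) .mono f≤g = mono isE (λ a → mono (isExpect-EFun n) (λ g → f≤g _))
  isExpect-EFun (suc n) .add f g = trans (ext isE (λ a → add (isExpect-EFun n) _ _)) (add isE _ _)
  isExpect-EFun (suc n) .scale c f = trans (ext isE (λ a → scale (isExpect-EFun n) c _)) (scale isE c _)
  isExpect-EFun (suc n) .const c = trans (ext isE (λ a → const (isExpect-EFun n) c)) (const isE c)

  commutes-EFun : Commutes E → ∀ n → Commutes (EFun n E)
  commutes-EFun comm zero    isE′ f = refl
  commutes-EFun comm (suc n) isE′ f =
    trans (ext isE (λ a → commutes-EFun comm n isE′ (λ g → f (a ∷ᶠ g)))) (comm isE′ (λ a c → EFun n E (λ g → f (a ∷ᶠ g) c)))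

  isExpect-EPair : {C : Set} {E′ : Expect C} → IsExpect E′ → IsExpect (EPair E E′)
  isExpect-EPair isE′ .mono f≤g = mono isE (λ a → mono isE′ (λ c → f≤g _))
  isExpect-EPair isE′ .add f g = trans (ext isE (λ a → add isE′ _ _)) (add isE _ _)
  isExpect-EPair isE′ .scale c f = trans (ext isE (λ a → scale isE′ c _)) (scale isE c _)
  isExpect-EPair isE′ .const c = trans (ext isE (λ a → const isE′ c)) (const isE c)

commutes-sumFin : ∀ m {C : Set} {E′ : Expect C} → IsExpect E′ → ∀ (f : Fin m → C → ℚ) →
  sumFin m (λ i → E′ (f i)) ≡ E′ (λ c → sumFin m (λ i → f i c))
commutes-sumFin zero    isE′ f = sym (const isE′ 0ℚ)
commutes-sumFin (suc m) {E′ = E′} isE′ f = trans (cong (λ z → E′ (f Fin.zero) + z) (commutes-sumFin m isE′ (λ i → f (Fin.suc i))))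
  (sym (add isE′ (f Fin.zero) (λ c → sumFin m (λ i → f (Fin.suc i) c))))

scaleʳ : ∀ {A : Set} {E : Expect A} → IsExpect E → ∀ c f → E f * c ≡ E (λ a → f a * c)
scaleʳ {E = E} isE c f = trans (ℚP.*-comm (E f) c) (trans (sym (scale isE c f)) (ext isE (λ a → ℚP.*-comm c (f a))))

commutes-EFin : ∀ m → Commutes (EFin (suc m))
commutes-EFin m isE′ f = trans (cong (_* ((ℤ.+ 1) ℚ./ suc m)) (commutes-sumFin (suc m) isE′ f))
  (scaleʳ isE′ ((ℤ.+ 1) ℚ./ suc m) (λ c → sumFin (suc m) (λ i → f i c)))

commutes-EBool : Commutes EBool
commutes-EBool isE′ f = trans (cong (_* ((ℤ.+ 1) ℚ./ 2)) (sym (add isE′ (f true) (f false))))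
  (scaleʳ isE′ ((ℤ.+ 1) ℚ./ 2) (λ c → f true c + f false c))

-- Independent rows

iid : {A : Set} (k : ℕ) → Expect A → Expect (Vec A k)
iid zero    E f = f []
iid (suc k) E f = E (λ a → iid k E (λ as → f (a ∷ as)))

isExpect-iid : ∀ {A : Set} {E : Expect A} → IsExpect E → ∀ k → IsExpect (iid k E)
isExpect-iid isE zero    .mono f≤g = f≤g _
isExpect-iid isE zero    .add f g = refl
isExpect-iid isE zero    .scale c f = refl
isExpect-iid isE zero    .const c = refl
isExpect-iid isE (suc k) .mono f≤g = mono isE (λ a → mono (isExpect-iid isE k) (λ g → f≤g _))
isExpect-iid isE (suc k) .add f g = trans (ext isE (λ a → add (isExpect-iid isE k) _ _)) (add isE _ _)
isExpect-iid isE (suc k) .scale c f = trans (ext isE (λ a → scale (isExpect-iid isE k) c _)) (scale isE c _)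
isExpect-iid isE (suc k) .const c = trans (ext isE (λ a → const (isExpect-iid isE k) c)) (const isE c)

-- `EHashes` draws all bucket functions before all sign functions. Fubini interleaves the two draws
-- row by row, which exhibits the rows as independent copies of a pair.
EFun-pair-iid : ∀ {A C : Set} {EA : Expect A} {EC : Expect C} → IsExpect EA → IsExpect EC → Commutes EA →
  ∀ k (Y : A → C → ℚ) (G : List ℚ → ℚ) →
  EFun k EA (λ h → EFun k EC (λ s → G (List.tabulate (λ ℓ → Y (h ℓ) (s ℓ)))))
    ≡ iid k (EPair EA EC) (λ T → G (Vec.toList (Vec.map (λ p → Y (proj₁ p) (proj₂ p)) T)))
EFun-pair-iid isEA isEC comm zero    Y G = refl
EFun-pair-iid {EC = EC} isEA isEC comm (suc k) Y G = ext isEA λ a →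
  trans (commutes-EFun isEA comm k isEC (λ h c → EFun k EC (λ s → G (Y a c ∷ List.tabulate (λ ℓ → Y (h ℓ) (s ℓ))))))
        (ext isEC (λ c → EFun-pair-iid isEA isEC comm k Y (λ xs → G (Y a c ∷ xs))))

-- The error of one row as a lazy signed sum

-- Conditioning on the head of the list: it is absent with probability 1 - q and enters with either
-- sign with probability q/2. Encoding the law as an expectation operator makes every later argument
-- an induction on the list of weights.
Law : ℚ → List ℚ → Expect ℚ
Law q []       g = g 0ℚ
Law q (c ∷ cs) g = (1ℚ - q) * Law q cs g + q * ½ * (Law q cs (λ x → g (c + x)) + Law q cs (λ x → g (- c + x)))

neg-neg : ∀ x → - (- x) ≡ x
neg-neg = solve-∀ ring

module _ {q : ℚ} (q≥0 : 0ℚ ≤ℚ q) (q≤1 : q ≤ℚ 1ℚ) where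

  private
    q½≥0 : 0ℚ ≤ℚ q * ½
    q½≥0 = ≥0-* q≥0 (recip≥0 1)

  isExpect-Law : ∀ cs → IsExpect (Law q cs)
  isExpect-Law []       .mono f≤g = f≤g 0ℚ
  isExpect-Law []       .add f g = refl
  isExpect-Law []       .scale c f = refl
  isExpect-Law []       .const c = refl
  isExpect-Law (c ∷ cs) .mono f≤g = ℚP.+-mono-≤
    (*-monoʳ (≥0-sub q≤1) (mono ih f≤g))
    (*-monoʳ q½≥0 (ℚP.+-mono-≤ (mono ih (λ x → f≤g (c + x))) (mono ih (λ x → f≤g (- c + x)))))
    where ih = isExpect-Law cs
  isExpect-Law (c ∷ cs) .add f g = trans
    (cong₂ _+_ (cong ((1ℚ - q) *_) (add ih f g))
       (cong (q * ½ *_) (cong₂ _+_ (add ih (λ x → f (c + x)) (λ x → g (c + x))) (add ih (λ x → f (- c + x)) (λ x → g (- c + x))))))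
    (h q (Law q cs f) (Law q cs g) (Law q cs (λ x → f (c + x))) (Law q cs (λ x → g (c + x))) (Law q cs (λ x → f (- c + x))) (Law q cs (λ x → g (- c + x))))
    where
    ih = isExpect-Law cs
    h : ∀ q a b c d e f → (1ℚ - q) * (a + b) + q * ½ * (c + d + (e + f)) ≡ (1ℚ - q) * a + q * ½ * (c + e) + ((1ℚ - q) * b + q * ½ * (d + f))
    h = solve-∀ ring
  isExpect-Law (c ∷ cs) .scale d f = trans
    (cong₂ _+_ (cong ((1ℚ - q) *_) (scale ih d f))
       (cong (q * ½ *_) (cong₂ _+_ (scale ih d (λ x → f (c + x))) (scale ih d (λ x → f (- c + x))))))
    (h q d (Law q cs f) (Law q cs (λ x → f (c + x))) (Law q cs (λ x → f (- c + x))))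
    where
    ih = isExpect-Law cs
    h : ∀ q d a b c → (1ℚ - q) * (d * a) + q * ½ * (d * b + d * c) ≡ d * ((1ℚ - q) * a + q * ½ * (b + c))
    h = solve-∀ ring
  isExpect-Law (c ∷ cs) .const d = trans
    (cong₂ _+_ (cong ((1ℚ - q) *_) (const ih d)) (cong (q * ½ *_) (cong₂ _+_ (const ih d) (const ih d))))
    (h q d)
    where
    ih = isExpect-Law cs
    h : ∀ q d → (1ℚ - q) * d + q * ½ * (d + d) ≡ d
    h = solve-∀ ring

  Law-sym : ∀ cs (g : ℚ → ℚ) → Law q cs (λ x → g (- x)) ≡ Law q cs g
  Law-sym []       g = refl
  Law-sym (c ∷ cs) g = trans
    (cong₂ _+_ (cong ((1ℚ - q) *_) (Law-sym cs g)) (cong (q * ½ *_) (cong₂ _+_ (flip c) (trans (flip (- c)) (ext ih (λ x → cong (λ z → g (z + x)) (neg-neg c)))))))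
    (cong (λ z → (1ℚ - q) * Law q cs g + q * ½ * z) (ℚP.+-comm (Law q cs (λ x → g (- c + x))) (Law q cs (λ x → g (c + x)))))
    where
    ih = isExpect-Law cs
    flip : ∀ d → Law q cs (λ x → g (- (d + x))) ≡ Law q cs (λ x → g (- d + x))
    flip d = trans (ext ih (λ x → cong g (ℚP.neg-distrib-+ d x))) (Law-sym cs (λ x → g (- d + x)))

omit : ∀ {n} → (Fin n → ℚ) → Fin n → List ℚ
omit f Fin.zero    = List.tabulate (λ j → f (Fin.suc j))
omit f (Fin.suc i) = f Fin.zero ∷ omit (λ j → f (Fin.suc j)) i

commutes-EPair : ∀ {A C : Set} {EA : Expect A} {EC : Expect C} → IsExpect EA → Commutes EA → Commutes EC → Commutes (EPair EA EC)
commutes-EPair isEA commA commC isE′ f =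
  trans (ext isEA (λ a → commC isE′ (λ c → f (a , c)))) (commA isE′ (λ a c → _))

sum-iv : ∀ m (a : Fin m) → sumFin m (λ b → iv b a) ≡ 1ℚ
sum-iv (suc m) Fin.zero = trans (cong (1ℚ +_) (trans (sumFin-const m 0ℚ) (ℚP.*-zeroʳ (fromℕ m)))) refl
sum-iv (suc m) (Fin.suc a) = trans (ℚP.+-identityˡ (sumFin m (λ b → iv b a))) (sum-iv m a)

-- Any function of a 0/1 value is affine in it, so averaging over `b` requires only the mean of
-- `iv b a`.
iv-interpolate : ∀ {B} (b a : Fin B) (F : ℚ → ℚ) → F (iv b a) ≡ F 0ℚ + (F 1ℚ - F 0ℚ) * iv b a
iv-interpolate b a F with does (b ≟ᶠ a)
... | true  = h (F 0ℚ) (F 1ℚ)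
  where
  h : ∀ x y → y ≡ x + (y - x) * 1ℚ
  h = solve-∀ ring
... | false = h (F 0ℚ) (F 1ℚ)
  where
  h : ∀ x y → x ≡ x + (y - x) * 0ℚ
  h = solve-∀ ring

iv-refl : ∀ {B} (a : Fin B) → iv a a ≡ 1ℚ
iv-refl a rewrite dec-true (a ≟ᶠ a) refl = refl

sgn² : ∀ σ → sgn σ * sgn σ ≡ 1ℚ
sgn² true  = refl
sgn² false = refl

module _ (m : ℕ) where

  private
    B = suc m
    β = (ℤ.+ 1) ℚ./ suc m
    β≥0 = recip≥0 m
    isB = isExpect-EFin m

  recip≤1 : β ≤ℚ 1ℚ
  recip≤1 = subst₂ _≤ℚ_ (ℚP.*-identityˡ β) (suc*recip m) (*-monoˡ β≥0 (fromℕ-mono {1} {suc m} (s≤s z≤n)))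

  private
    isL = isExpect-Law β≥0 recip≤1

  EFin-iv : ∀ a (F : ℚ → ℚ) → EFin B (λ b → F (iv b a)) ≡ (1ℚ - β) * F 0ℚ + β * F 1ℚ
  EFin-iv a F = begin
    EFin B (λ b → F (iv b a))                             ≡⟨ ext isB (λ b → iv-interpolate b a F) ⟩
    EFin B (λ b → F 0ℚ + (F 1ℚ - F 0ℚ) * iv b a)          ≡⟨ affine isB (F 0ℚ) (F 1ℚ - F 0ℚ) (λ b → iv b a) ⟩
    F 0ℚ + (F 1ℚ - F 0ℚ) * (sumFin B (λ b → iv b a) * β)  ≡⟨ cong (λ z → F 0ℚ + (F 1ℚ - F 0ℚ) * (z * β)) (sum-iv B a) ⟩
    F 0ℚ + (F 1ℚ - F 0ℚ) * (1ℚ * β)                       ≡⟨ h (F 0ℚ) (F 1ℚ) β ⟩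
    (1ℚ - β) * F 0ℚ + β * F 1ℚ                            ∎
    where
    open ≡-Reasoning
    h : ∀ x y b → x + (y - x) * (1ℚ * b) ≡ (1ℚ - b) * x + b * y
    h = solve-∀ ring

  -- The uniform sign of the element absorbs the fixed sign `σ`, so the result depends neither on
  -- `σ` nor on the bucket `a`.
  element-law : ∀ a σ c (F : ℚ → ℚ) → EFin B (λ b → EBool (λ s → F (sgn σ * (iv b a * (sgn s * c)))))
    ≡ (1ℚ - β) * F 0ℚ + β * ½ * (F c + F (- c))
  element-law a σ c F = trans (EFin-iv a (λ v → EBool (λ s → F (sgn σ * (v * (sgn s * c)))))) (lem σ)
    where
    e0 : ∀ s x → s * (0ℚ * (x * c)) ≡ 0ℚ
    e0 s x = h s x c
      where
      h : ∀ s x c → s * (0ℚ * (x * c)) ≡ 0ℚ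
      h = solve-∀ ring
    e₊ : ∀ c → 1ℚ * (1ℚ * (1ℚ * c)) ≡ c
    e₊ = solve-∀ ring
    e₋ : ∀ c → 1ℚ * (1ℚ * (- 1ℚ * c)) ≡ - c
    e₋ = solve-∀ ring
    e₋₊ : ∀ c → - 1ℚ * (1ℚ * (1ℚ * c)) ≡ - c
    e₋₊ = solve-∀ ring
    e₋₋ : ∀ c → - 1ℚ * (1ℚ * (- 1ℚ * c)) ≡ c
    e₋₋ = solve-∀ ring
    avg : ∀ b x y z → (1ℚ - b) * ((x + x) * ((ℤ.+ 1) ℚ./ 2)) + b * ((y + z) * ((ℤ.+ 1) ℚ./ 2)) ≡ (1ℚ - b) * x + b * ½ * (y + z)
    avg = solve-∀ ring
    both : ℚ → ℚ → ℚ
    both x y = (F x + F y) * ((ℤ.+ 1) ℚ./ 2)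
    signs : ℚ → ℚ → ℚ
    signs x y = (1ℚ - β) * x + β * y
    lem : ∀ σ → (1ℚ - β) * EBool (λ s → F (sgn σ * (0ℚ * (sgn s * c)))) + β * EBool (λ s → F (sgn σ * (1ℚ * (sgn s * c))))
      ≡ (1ℚ - β) * F 0ℚ + β * ½ * (F c + F (- c))
    lem true = trans (cong₂ signs (cong₂ both (e0 1ℚ 1ℚ) (e0 1ℚ (- 1ℚ))) (cong₂ both (e₊ c) (e₋ c))) (avg β (F 0ℚ) (F c) (F (- c)))
    lem false = trans (cong₂ signs (cong₂ both (e0 (- 1ℚ) 1ℚ) (e0 (- 1ℚ) (- 1ℚ))) (cong₂ both (e₋₊ c) (e₋₋ c)))
      (trans (avg β (F 0ℚ) (F (- c)) (F c)) (cong (λ z → (1ℚ - β) * F 0ℚ + β * ½ * z) (ℚP.+-comm (F (- c)) (F c))))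

  -- The colliding sum for a fixed bucket and sign of the queried element; `joint-row-law` needs it
  -- for the elements that come after the queried one.
  bucket-law : ∀ n (f : Fin n → ℚ) a σ (g : ℚ → ℚ) →
    EFun n (EFin B) (λ h → EFun n EBool (λ s → g (sgn σ * sumFin n (λ j → iv (h j) a * (sgn (s j) * f j)))))
      ≡ Law β (List.tabulate f) g
  bucket-law zero    f a σ g = cong g (ℚP.*-zeroʳ (sgn σ))
  bucket-law (suc n) f a σ g = begin
    EFin B (λ b → EFun n (EFin B) (λ h → EBool (λ t → EFun n EBool (λ s → g (sgn σ * (v b t + w h s))))))
      ≡⟨ ext isB (λ b → commutes-EFun isB (commutes-EFin m) n isExpect-EBool (λ h t → EFun n EBool (λ s → g (sgn σ * (v b t + w h s))))) ⟩
    EFin B (λ b → EBool (λ t → EFun n (EFin B) (λ h → EFun n EBool (λ s → g (sgn σ * (v b t + w h s))))))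
      ≡⟨ ext isB (λ b → ext isExpect-EBool (λ t → trans
           (ext (isExpect-EFun isB n) (λ h → ext (isExpect-EFun isExpect-EBool n) (λ s → cong g (ℚP.*-distribˡ-+ (sgn σ) (v b t) (w h s)))))
           (bucket-law n f′ a σ (λ x → g (sgn σ * v b t + x))))) ⟩
    EFin B (λ b → EBool (λ t → Law β cs (λ x → g (sgn σ * v b t + x))))
      ≡⟨ element-law a σ (f Fin.zero) (λ y → Law β cs (λ x → g (y + x))) ⟩
    (1ℚ - β) * Law β cs (λ x → g (0ℚ + x)) + β * ½ * (Law β cs (λ x → g (f Fin.zero + x)) + Law β cs (λ x → g (- f Fin.zero + x)))
      ≡⟨ cong₂ _+_ (cong ((1ℚ - β) *_) (ext (isL cs) (λ x → cong g (ℚP.+-identityˡ x)))) refl ⟩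
    Law β (f Fin.zero ∷ cs) g ∎
    where
    open ≡-Reasoning
    f′ = λ j → f (Fin.suc j)
    cs = List.tabulate f′
    v : Fin B → Bool → ℚ
    v b t = iv b a * (sgn t * f Fin.zero)
    w : (Fin n → Fin B) → (Fin n → Bool) → ℚ
    w h s = sumFin n (λ j → iv (h j) a * (sgn (s j) * f′ j))

  -- g may look at the bucket and the sign of i: this is what lets the induction on i go through.
  joint-row-law : ∀ n (f : Fin n → ℚ) i (g : Fin B → Bool → ℚ → ℚ) →
    EFun n (EFin B) (λ h → EFun n EBool (λ s → g (h i) (s i) (sgn (s i) * sumFin n (λ j → iv (h j) (h i) * (sgn (s j) * f j)))))
      ≡ EFin B (λ a → EBool (λ σ → Law β (omit f i) (λ x → g a σ (f i + x))))
  joint-row-law (suc n) f Fin.zero g = ext isB λ a → trans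
    (commutes-EFun isB (commutes-EFin m) n isExpect-EBool (λ h t → EFun n EBool (λ s → g a t (sgn t * (iv a a * (sgn t * f Fin.zero) + w a h s)))))
    (ext isExpect-EBool λ t → trans
      (ext (isExpect-EFun isB n) (λ h → ext (isExpect-EFun isExpect-EBool n) (λ s → cong (g a t) (own a t (w a h s)))))
      (bucket-law n (λ j → f (Fin.suc j)) a t (λ x → g a t (f Fin.zero + x))))
    where
    w : Fin B → (Fin n → Fin B) → (Fin n → Bool) → ℚ
    w a h s = sumFin n (λ j → iv (h j) a * (sgn (s j) * f (Fin.suc j)))
    own : ∀ a t x → sgn t * (iv a a * (sgn t * f Fin.zero) + x) ≡ f Fin.zero + sgn t * x
    own a t x rewrite iv-refl a = trans (r (sgn t) (f Fin.zero) x) (trans (cong (λ z → z * f Fin.zero + sgn t * x) (sgn² t)) (cong (_+ sgn t * x) (ℚP.*-identityˡ (f Fin.zero))))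
      where
      r : ∀ s f x → s * (1ℚ * (s * f) + x) ≡ s * s * f + s * x
      r = solve-∀ ring
  joint-row-law (suc n) f (Fin.suc i) g = begin
    EFin B (λ b → EFun n (EFin B) (λ h → EBool (λ t → EFun n EBool (λ s → g (h i) (s i) (sgn (s i) * (v b t (h i) + w h s))))))
      ≡⟨ ext isB (λ b → commutes-EFun isB (commutes-EFin m) n isExpect-EBool (λ h t → EFun n EBool (λ s → g (h i) (s i) (sgn (s i) * (v b t (h i) + w h s))))) ⟩
    EFin B (λ b → EBool (λ t → EFun n (EFin B) (λ h → EFun n EBool (λ s → g (h i) (s i) (sgn (s i) * (v b t (h i) + w h s))))))
      ≡⟨ ext isB (λ b → ext isExpect-EBool (λ t → trans
           (ext (isExpect-EFun isB n) (λ h → ext (isExpect-EFun isExpect-EBool n) (λ s → cong (g (h i) (s i)) (ℚP.*-distribˡ-+ (sgn (s i)) (v b t (h i)) (w h s)))))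
           (joint-row-law n f′ i (λ a σ x → g a σ (sgn σ * v b t a + x))))) ⟩
    EFin B (λ b → EBool (λ t → EFin B (λ a → EBool (λ σ → Law β cs (λ x → g a σ (sgn σ * v b t a + (f′ i + x)))))))
      -- The head element is drawn before the bucket and sign of the queried one. After the exchange
      -- these are fixed, and `element-law` applies to the head.
      ≡⟨ commutes-EPair {EA = EFin B} {EC = EBool} isB (commutes-EFin m) commutes-EBool (isExpect-EPair isB isExpect-EBool)
           (λ (b , t) (a , σ) → Law β cs (λ x → g a σ (sgn σ * v b t a + (f′ i + x)))) ⟩
    EFin B (λ a → EBool (λ σ → EFin B (λ b → EBool (λ t → Law β cs (λ x → g a σ (sgn σ * v b t a + (f′ i + x)))))))
      ≡⟨ ext isB (λ a → ext isExpect-EBool (λ σ → trans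
           (element-law a σ (f Fin.zero) (λ y → Law β cs (λ x → g a σ (y + (f′ i + x)))))
           (cong₂ _+_ (cong ((1ℚ - β) *_) (ext (isL cs) (λ x → cong (g a σ) (ℚP.+-identityˡ (f′ i + x)))))
             (cong (β * ½ *_) (cong₂ _+_ (ext (isL cs) (λ x → cong (g a σ) (r (f Fin.zero) (f′ i) x)))
                                         (ext (isL cs) (λ x → cong (g a σ) (r (- f Fin.zero) (f′ i) x)))))))) ⟩
    EFin B (λ a → EBool (λ σ → Law β (f Fin.zero ∷ cs) (λ x → g a σ (f′ i + x)))) ∎
    where
    open ≡-Reasoning
    f′ = λ j → f (Fin.suc j)
    cs = omit f′ i
    v : Fin B → Bool → Fin B → ℚ
    v b t a = iv b a * (sgn t * f Fin.zero)
    w : (Fin n → Fin B) → (Fin n → Bool) → ℚ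
    w h s = sumFin n (λ j → iv (h j) (h i) * (sgn (s j) * f′ j))
    r : ∀ x y z → x + (y + z) ≡ y + (x + z)
    r = solve-∀ ring

  ERow : ∀ n → Expect ((Fin n → Fin B) × (Fin n → Bool))
  ERow n = EPair (EFun n (EFin B)) (EFun n EBool)

  isExpect-ERow : ∀ n → IsExpect (ERow n)
  isExpect-ERow n = isExpect-EPair (isExpect-EFun isB n) (isExpect-EFun isExpect-EBool n)

  rowValue : ∀ {n} → Fin n → (Fin n → Fin B) × (Fin n → Bool) → ℚ
  rowValue {n} i (h , s) = sgn (s i) * sumFin n (λ j → iv (h j) (h i) * (sgn (s j) * zipf j))

  -- The queried element always collides with itself and contributes its own frequency exactly,
  -- since its sign is squared. What remains has a law free of its bucket and sign, so the average
  -- over these is trivial.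
  row-law : ∀ n (i : Fin n) (g : ℚ → ℚ) → ERow n (λ a → g (rowValue i a - zipf i)) ≡ Law β (omit zipf i) g
  row-law n i g = begin
    ERow n (λ a → g (rowValue i a - zipf i))
      ≡⟨ joint-row-law n zipf i (λ _ _ y → g (y - zipf i)) ⟩
    EFin B (λ _ → EBool (λ _ → Law β (omit zipf i) (λ x → g (zipf i + x - zipf i))))
      ≡⟨ trans (ext isB {g = λ _ → L} (λ _ → const isExpect-EBool L)) (const isB L) ⟩
    Law β (omit zipf i) (λ x → g (zipf i + x - zipf i))
      ≡⟨ ext (isL (omit zipf i)) (λ x → cong g (r (zipf i) x)) ⟩
    Law β (omit zipf i) g ∎
    where
    open ≡-Reasoning
    L = Law β (omit zipf i) (λ x → g (zipf i + x - zipf i))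
    r : ∀ y x → y + x - y ≡ x
    r = solve-∀ ring

  expErr-iid : ∀ k n (i : Fin n) → expErr k n B i
    ≡ iid k (ERow n) (λ T → ∣ median (Vec.toList (Vec.map (rowValue i) T)) - zipf i ∣)
  expErr-iid k n i = EFun-pair-iid (isExpect-EFun isB n) (isExpect-EFun isExpect-EBool n)
    (commutes-EFun isB (commutes-EFin m) n) k (λ h s → rowValue i (h , s)) (λ xs → ∣ median xs - zipf i ∣)

-- The median as a majority count

-- In a sorted list a downward closed predicate holds exactly on a prefix, whose length is the
-- number of entries satisfying it. That number is invariant under permutation, so the order
-- produced by `sort` never has to be known.
module _ {Q : ℚ → Set} (Q? : ∀ x → Dec (Q x)) (down : ∀ {x y} → x ≤ℚ y → Q y → Q x) where

  private
    count : List ℚ → ℕ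
    count xs = List.length (List.filter Q? xs)

    none : ∀ {y} ys → ¬ Q y → All (y ≤ℚ_) ys → count ys ≡ 0
    none []       ¬Qy _ = refl
    none (z ∷ ys) ¬Qy (y≤z ∷ y≤ys) with Q? z
    ... | yes Qz = ⊥-elim (¬Qy (down y≤z Qz))
    ... | no  _  = none ys ¬Qy y≤ys

    sorted-many : ∀ {ys} d → AllPairs _≤ℚ_ ys → d ℕ.< count ys → Q (headOr 0ℚ (List.drop d ys))
    sorted-many {y ∷ ys} d (y≤ys ∷ ap) d<c with Q? y
    sorted-many {y ∷ ys} zero    (y≤ys ∷ ap) d<c       | yes Qy = Qy
    sorted-many {y ∷ ys} (suc d) (y≤ys ∷ ap) (s≤s d<c) | yes Qy = sorted-many d ap d<c
    ... | no ¬Qy with () ← subst (d ℕ.<_) (none ys ¬Qy y≤ys) d<c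

    sorted-few : ∀ {ys} d → AllPairs _≤ℚ_ ys → count ys ≤ d → d ℕ.< List.length ys → ¬ Q (headOr 0ℚ (List.drop d ys))
    sorted-few {y ∷ ys} d (y≤ys ∷ ap) c≤d d<l with Q? y
    sorted-few {y ∷ ys} (suc d) (y≤ys ∷ ap) (s≤s c≤d) (s≤s d<l) | yes Qy = sorted-few d ap c≤d d<l
    sorted-few {y ∷ ys} zero    (y≤ys ∷ ap) c≤d d<l             | no ¬Qy = ¬Qy
    sorted-few {y ∷ ys} (suc d) (y≤ys ∷ ap) c≤d (s≤s d<l)       | no ¬Qy =
      sorted-few d ap (subst (_≤ d) (sym (none ys ¬Qy y≤ys)) z≤n) d<l

    sort-pairs : ∀ xs → AllPairs _≤ℚ_ (sort xs)
    sort-pairs xs = Linked⇒AllPairs ℚP.≤-trans (sort-↗ xs)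

    count-sort : ∀ xs → count (sort xs) ≡ count xs
    count-sort xs = ↭-length (filter-↭ Q? (sort-↭ xs))

  median-many : ∀ xs → List.length xs ℕ./ 2 ℕ.< count xs → Q (median xs)
  median-many xs h = sorted-many (List.length xs ℕ./ 2) (sort-pairs xs) (subst (List.length xs ℕ./ 2 ℕ.<_) (sym (count-sort xs)) h)

  median-few : ∀ xs → 0 ℕ.< List.length xs → count xs ≤ List.length xs ℕ./ 2 → ¬ Q (median xs)
  median-few xs 0<l h = sorted-few (List.length xs ℕ./ 2) (sort-pairs xs) (subst (_≤ List.length xs ℕ./ 2) (sym (count-sort xs)) h)
    (subst (List.length xs ℕ./ 2 ℕ.<_) (sym (↭-length (sort-↭ xs))) (m/n<m (List.length xs) 2 {{ℕ.>-nonZero 0<l}} (s≤s (s≤s z≤n))))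

sumV : ∀ {A : Set} {k} → (A → ℚ) → Vec A k → ℚ
sumV φ []      = 0ℚ
sumV φ (a ∷ T) = φ a + sumV φ T

module _ {A : Set} (Y : A → ℚ) (f t : ℚ) where

  private
    values : ∀ {k} → Vec A k → List ℚ
    values T = Vec.toList (Vec.map Y T)

    length-values : ∀ {k} (T : Vec A k) → List.length (values T) ≡ k
    length-values T = VecP.length-toList (Vec.map Y T)

    -- Both predicates must be downward closed to decide the median. Rows above f + t are therefore
    -- counted through their complement `low`, whereas rows below f - t are counted directly by
    -- `high`.
    low high : ∀ {k} → Vec A k → ℕ
    low  T = List.length (List.filter (λ x → x ℚP.≤? f + t) (values T))
    high T = List.length (List.filter (λ x → x ℚP.<? f - t) (values T))

    low+ : ∀ {k} (T : Vec A k) → fromℕ k ≡ fromℕ (low T) + sumV (λ a → gt t (Y a - f)) T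
    low+ [] = refl
    low+ {suc k} (a ∷ T) = trans (fromℕ-suc k) (trans (cong (1ℚ +_) (low+ T)) (step (gtView t (Y a - f))))
      where
      L S : ℚ
      L = fromℕ (low T)
      S = sumV (λ a → gt t (Y a - f)) T
      r₁ : ∀ x y → 1ℚ + (x + y) ≡ 1ℚ + x + (0ℚ + y)
      r₁ = solve-∀ ring
      r₂ : ∀ x y → 1ℚ + (x + y) ≡ x + (1ℚ + y)
      r₂ = solve-∀ ring
      e₁ : ∀ y f t → f + t ≡ y + (t - (y - f))
      e₁ = solve-∀ ring
      e₂ : ∀ y f t → y ≡ (y - f) + f
      e₂ = solve-∀ ring
      e₃ : ∀ f t → t + f ≡ f + t
      e₃ = solve-∀ ring
      step : GtView t (Y a - f) → 1ℚ + (L + S) ≡ fromℕ (low (a ∷ T)) + (gt t (Y a - f) + S)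
      step (below p e) = trans (r₁ L S) (sym (cong₂ (λ x y → x + (y + S))
        (trans (cong (λ xs → fromℕ (List.length xs)) (ListP.filter-accept (λ x → x ℚP.≤? f + t) {Y a} {values T} (≤-byDiff (≥0-sub p) (e₁ (Y a) f t)))) (fromℕ-suc (low T))) e))
      step (above p e) = trans (r₂ L S) (sym (cong₂ (λ x y → x + (y + S))
        (cong (λ xs → fromℕ (List.length xs)) (ListP.filter-reject (λ x → x ℚP.≤? f + t) {Y a} {values T}
          (λ q → ℚP.<-irrefl refl (ℚP.<-≤-trans (subst₂ _<_ (e₃ f t) (sym (e₂ (Y a) f t)) (ℚP.+-monoˡ-< f p)) q)))) e))

    high≡ : ∀ {k} (T : Vec A k) → fromℕ (high T) ≡ sumV (λ a → gt t (- (Y a - f))) T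
    high≡ [] = refl
    high≡ (a ∷ T) = step (gtView t (- (Y a - f)))
      where
      S = sumV (λ a → gt t (- (Y a - f))) T
      e₁ : ∀ y f t → t + (y - t) ≡ y
      e₁ = solve-∀ ring
      e₂ : ∀ y f t → - (y - f) + (y - t) ≡ f - t
      e₂ = solve-∀ ring
      e₃ : ∀ y f t → y ≡ f - t + (t - - (y - f))
      e₃ = solve-∀ ring
      step : GtView t (- (Y a - f)) → fromℕ (high (a ∷ T)) ≡ gt t (- (Y a - f)) + S
      step (above p e) = trans
        (trans (cong (λ xs → fromℕ (List.length xs)) (ListP.filter-accept (λ x → x ℚP.<? f - t) {Y a} {values T}
          (subst₂ _<_ (e₁ (Y a) f t) (e₂ (Y a) f t) (ℚP.+-monoˡ-< (Y a - t) p)))) (fromℕ-suc (high T)))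
        (cong₂ _+_ (sym e) (high≡ T))
      step (below p e) = trans
        (trans (cong (λ xs → fromℕ (List.length xs)) (ListP.filter-reject (λ x → x ℚP.<? f - t) {Y a} {values T}
          (λ q → ℚP.<-irrefl refl (ℚP.<-≤-trans q (≤-byDiff (≥0-sub p) (e₃ (Y a) f t)))))) (high≡ T))
        (trans (sym (ℚP.+-identityˡ S)) (cong (_+ S) (sym e)))

    low-down : ∀ {x y} → x ≤ℚ y → y ≤ℚ f + t → x ≤ℚ f + t
    low-down = ℚP.≤-trans
    high-down : ∀ {x y} → x ≤ℚ y → y < f - t → x < f - t
    high-down = ℚP.≤-<-trans

    half-odd : ∀ k → k % 2 ≡ 1 → k ≡ suc (2 *ℕ (k ℕ./ 2))
    half-odd k odd = trans (m≡m%n+[m/n]*n k 2) (cong₂ ℕ._+_ odd (ℕP.*-comm (k ℕ./ 2) 2))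

  module _ {k} (odd : k % 2 ≡ 1) (T : Vec A k) where

    private
      r = k ℕ./ 2
      k≡ : k ≡ suc (2 *ℕ r)
      k≡ = half-odd k odd
      N₊ = sumV (λ a → gt t (Y a - f)) T
      N₋ = sumV (λ a → gt t (- (Y a - f))) T
      Z = median (values T) - f
      l≡ : List.length (values T) ℕ./ 2 ≡ r
      l≡ = cong (ℕ._/ 2) (length-values T)
      0<l : 0 ℕ.< List.length (values T)
      0<l = subst (0 ℕ.<_) (sym (trans (length-values T) k≡)) (s≤s z≤n)

      K R : ℚ
      K = fromℕ k
      R = fromℕ r
      K≡ : K ≡ 1ℚ + fromℕ 2 * R
      K≡ = trans (cong fromℕ k≡) (trans (fromℕ-suc (2 *ℕ r)) (cong (1ℚ +_) (fromℕ-* 2 r)))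

      <-double : ∀ K R N → K ≡ 1ℚ + fromℕ 2 * R → 1ℚ + R ≤ℚ N → K < fromℕ 2 * N
      <-double _ R N refl h = ℚP.<-≤-trans {j = fromℕ 2 + fromℕ 2 * R}
        (ℚP.+-monoˡ-< (fromℕ 2 * R) (fromℕ-mono-< {1} {2} (s≤s (s≤s z≤n))))
        (≤-byDiff (≥0-* (fromℕ≥0 2) (≥0-sub h)) (e R N))
        where
        e : ∀ R N → fromℕ 2 * N ≡ fromℕ 2 + fromℕ 2 * R + fromℕ 2 * (N - (1ℚ + R))
        e = solve-∀ ring

      ≮-double : ∀ K R N → K ≡ 1ℚ + fromℕ 2 * R → N ≤ℚ R → ¬ (K < fromℕ 2 * N)
      ≮-double _ R N refl h K<2N = ℚP.<-irrefl refl (ℚP.<-≤-trans K<2N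
        (≤-byDiff (≥0-+ 0≤1 (≥0-* (fromℕ≥0 2) (≥0-sub h))) (e R N)))
        where
        e : ∀ R N → 1ℚ + fromℕ 2 * R ≡ fromℕ 2 * N + (1ℚ + fromℕ 2 * (R - N))
        e = solve-∀ ring

      complement : ∀ K R l N → K ≡ 1ℚ + fromℕ 2 * R → K ≡ l + N → N - (1ℚ + R) ≡ R - l
      complement _ R l N refl eq = trans (e l N R) (trans (cong (λ z → z - l - (1ℚ + R)) (sym eq)) (e′ R l))
        where
        e : ∀ l N R → N - (1ℚ + R) ≡ l + N - l - (1ℚ + R)
        e = solve-∀ ring
        e′ : ∀ R l → 1ℚ + fromℕ 2 * R - l - (1ℚ + R) ≡ R - l
        e′ = solve-∀ ring

      cancel : ∀ {N M} → 0ℚ ≤ℚ N - M → M ≤ℚ N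
      cancel {N} {M} h = ≤-byDiff h (e N M)
        where
        e : ∀ N M → N ≡ M + (N - M)
        e = solve-∀ ring

      med : ℚ
      med = median (values T)

    -- With k = 2r + 1 the median stands at index r, counted from 0. It exceeds f + t exactly when
    -- at most r values are ≤ f + t, hence when at least r + 1 lie above, which over the rationals
    -- reads K < 2 N₊.
    median-above⇒ : t < Z → K < fromℕ 2 * N₊
    median-above⇒ t<Z = <-double K R N₊ K≡ (cancel {N₊} {1ℚ + R} (subst (0ℚ ≤ℚ_) (sym (complement K R (fromℕ (low T)) N₊ K≡ (low+ T)))
      (≥0-sub (fromℕ-mono (ℕP.≮⇒≥ λ r<l → contra (median-many (λ x → x ℚP.≤? f + t) low-down (values T) (subst (ℕ._< low T) (sym l≡) r<l)))))))
      where
      e : ∀ f t → f + t - f ≡ t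
      e = solve-∀ ring
      contra : ¬ (med ≤ℚ f + t)
      contra h = ℚP.<-irrefl refl (ℚP.<-≤-trans t<Z (subst (Z ≤ℚ_) (e f t) (ℚP.+-monoˡ-≤ (- f) h)))

    ⇒median-above : K < fromℕ 2 * N₊ → t < Z
    ⇒median-above K<2N = subst (_< Z) (e f t) (ℚP.+-monoˡ-< (- f) (ℚP.≰⇒> (median-few (λ x → x ℚP.≤? f + t) low-down (values T) 0<l
      (subst (low T ≤_) (sym l≡) (ℕP.≮⇒≥ λ r<l → ≮-double K R N₊ K≡ (small r<l) K<2N)))))
      where
      e : ∀ f t → f + t - f ≡ t
      e = solve-∀ ring
      e″ : ∀ R l N → R ≡ N + ((l - (1ℚ + R)) + (R - l - (N - (1ℚ + R))))
      e″ = solve-∀ ring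
      small : r ℕ.< low T → N₊ ≤ℚ R
      small r<l = ≤-byDiff (≥0-+ (≥0-sub (subst (_≤ℚ fromℕ (low T)) (fromℕ-suc r) (fromℕ-mono r<l)))
        (≥0-sub (ℚP.≤-reflexive (complement K R (fromℕ (low T)) N₊ K≡ (low+ T))))) (e″ R (fromℕ (low T)) N₊)

    median-below⇒ : t < - Z → K < fromℕ 2 * N₋
    median-below⇒ t<-Z = <-double K R N₋ K≡ (subst₂ _≤ℚ_ (fromℕ-suc r) (high≡ T) (fromℕ-mono
      (ℕP.≰⇒> λ h≤r → median-few (λ x → x ℚP.<? f - t) high-down (values T) 0<l (subst (high T ≤_) (sym l≡) h≤r) low-med)))
      where
      e : ∀ m f t → t + (m - t) ≡ m
      e = solve-∀ ring
      e′ : ∀ m f t → - (m - f) + (m - t) ≡ f - t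
      e′ = solve-∀ ring
      low-med : med < f - t
      low-med = subst₂ _<_ (e med f t) (e′ med f t) (ℚP.+-monoˡ-< (med - t) t<-Z)

    ⇒median-below : K < fromℕ 2 * N₋ → t < - Z
    ⇒median-below K<2N = subst₂ _<_ (e med f t) (e′ med f t) (ℚP.+-monoˡ-< (t - med)
      (median-many (λ x → x ℚP.<? f - t) high-down (values T) (subst (ℕ._< high T) (sym l≡)
        (ℕP.≰⇒> λ h≤r → ≮-double K R N₋ K≡ (subst (_≤ℚ R) (high≡ T) (fromℕ-mono h≤r)) K<2N))))
      where
      e : ∀ m f t → m + (t - m) ≡ t
      e = solve-∀ ring
      e′ : ∀ m f t → f - t + (t - m) ≡ - (m - f)
      e′ = solve-∀ ring

-- Moments of sums over independent rows

pow : ℚ → ℕ → ℚ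
pow x zero    = 1ℚ
pow x (suc n) = x * pow x n

prodV : ∀ {A : Set} {k} → (A → ℚ) → Vec A k → ℚ
prodV φ []      = 1ℚ
prodV φ (a ∷ T) = φ a * prodV φ T

module _ {A : Set} {E : Expect A} (isE : IsExpect E) where

  iid-sum : ∀ k φ → iid k E (sumV φ) ≡ fromℕ k * E φ
  iid-sum zero    φ = sym (ℚP.*-zeroˡ (E φ))
  iid-sum (suc k) φ = begin
    E (λ a → iid k E (λ T → φ a + sumV φ T))
      ≡⟨ ext isE (λ a → trans (add (isExpect-iid isE k) (λ _ → φ a) (sumV φ)) (cong₂ _+_ (const (isExpect-iid isE k) (φ a)) (iid-sum k φ))) ⟩
    E (λ a → φ a + fromℕ k * E φ)
      ≡⟨ trans (add isE φ (λ _ → fromℕ k * E φ)) (cong (E φ +_) (const isE (fromℕ k * E φ))) ⟩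
    E φ + fromℕ k * E φ
      ≡⟨ h (E φ) (fromℕ k) ⟩
    (1ℚ + fromℕ k) * E φ
      ≡⟨ cong (_* E φ) (sym (fromℕ-suc k)) ⟩
    fromℕ (suc k) * E φ ∎
    where
    open ≡-Reasoning
    h : ∀ e k → e + k * e ≡ (1ℚ + k) * e
    h = solve-∀ ring

  iid-sum² : ∀ k φ → iid k E (λ T → sumV φ T * sumV φ T)
    ≡ fromℕ k * E (λ a → φ a * φ a) + fromℕ k * (fromℕ k - 1ℚ) * (E φ * E φ)
  iid-sum² zero    φ = h (E (λ a → φ a * φ a)) (E φ)
    where
    h : ∀ x y → 0ℚ ≡ 0ℚ * x + 0ℚ * (0ℚ - 1ℚ) * (y * y)
    h = solve-∀ ring
  iid-sum² (suc k) φ = begin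
    E (λ a → iid k E (λ T → (φ a + sumV φ T) * (φ a + sumV φ T)))
      ≡⟨ ext isE (λ a → trans (ext isI (λ T → expand (φ a) (sumV φ T)))
           (expect-affine isI (φ a * φ a) ((fromℕ 2 * φ a , sumV φ) ∷ (1ℚ , (λ T → sumV φ T * sumV φ T)) ∷ []))) ⟩
    E (λ a → φ a * φ a + (fromℕ 2 * φ a * m₁ + (1ℚ * m₂ + 0ℚ)))
      ≡⟨ trans (ext isE (λ a → regroup (φ a) m₁ m₂))
           (expect-affine isE m₂ ((1ℚ , (λ a → φ a * φ a)) ∷ (fromℕ 2 * m₁ , φ) ∷ [])) ⟩
    m₂ + (1ℚ * ν + (fromℕ 2 * m₁ * μ + 0ℚ))
      ≡⟨ cong₂ (λ x y → x + (1ℚ * ν + (fromℕ 2 * y * μ + 0ℚ))) (iid-sum² k φ) (iid-sum k φ) ⟩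
    K * ν + K * (K - 1ℚ) * (μ * μ) + (1ℚ * ν + (fromℕ 2 * (K * μ) * μ + 0ℚ))
      ≡⟨ collect K ν μ ⟩
    (1ℚ + K) * ν + (1ℚ + K) * (1ℚ + K - 1ℚ) * (μ * μ)
      ≡⟨ cong (λ z → z * ν + z * (z - 1ℚ) * (μ * μ)) (sym (fromℕ-suc k)) ⟩
    fromℕ (suc k) * ν + fromℕ (suc k) * (fromℕ (suc k) - 1ℚ) * (μ * μ) ∎
    where
    open ≡-Reasoning
    isI = isExpect-iid isE k
    K μ ν m₁ m₂ : ℚ
    K = fromℕ k
    μ = E φ
    ν = E (λ a → φ a * φ a)
    m₁ = iid k E (sumV φ)
    m₂ = iid k E (λ T → sumV φ T * sumV φ T)
    expand : ∀ x s → (x + s) * (x + s) ≡ x * x + (fromℕ 2 * x * s + (1ℚ * (s * s) + 0ℚ))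
    expand = solve-∀ ring
    regroup : ∀ x m n → x * x + (fromℕ 2 * x * m + (1ℚ * n + 0ℚ)) ≡ n + (1ℚ * (x * x) + (fromℕ 2 * m * x + 0ℚ))
    regroup = solve-∀ ring
    collect : ∀ k v m → k * v + k * (k - 1ℚ) * (m * m) + (1ℚ * v + (fromℕ 2 * (k * m) * m + 0ℚ))
      ≡ (1ℚ + k) * v + (1ℚ + k) * (1ℚ + k - 1ℚ) * (m * m)
    collect = solve-∀ ring

  iid-sum²-centred : ∀ k φ → E φ ≡ 0ℚ → iid k E (λ T → sumV φ T * sumV φ T) ≡ fromℕ k * E (λ a → φ a * φ a)
  iid-sum²-centred k φ Eφ≡0 = trans (iid-sum² k φ)
    (trans (cong (λ z → fromℕ k * E (λ a → φ a * φ a) + fromℕ k * (fromℕ k - 1ℚ) * (z * z)) Eφ≡0) (h (fromℕ k) (E (λ a → φ a * φ a))))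
    where
    h : ∀ k v → k * v + k * (k - 1ℚ) * (0ℚ * 0ℚ) ≡ k * v
    h = solve-∀ ring

  -- Centring kills the terms with a lone factor, so one more row adds at most 1 + 6k to the fourth
  -- moment, whereas 3(k+1)² - 3k² = 6k + 3.
  iid-sum⁴ : ∀ k φ → E φ ≡ 0ℚ → (∀ a → φ a * φ a ≤ℚ 1ℚ) →
    iid k E (λ T → sumV φ T * sumV φ T * (sumV φ T * sumV φ T)) ≤ℚ fromℕ 3 * (fromℕ k * fromℕ k)
  iid-sum⁴ zero    φ Eφ≡0 φ²≤1 = ℚP.≤-refl
  iid-sum⁴ (suc k) φ Eφ≡0 φ²≤1 = subst₂ _≤ℚ_ (sym moment) (sym (cong (λ z → fromℕ 3 * (z * z)) (fromℕ-suc k)))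
    (≤-byDiff (≥0-+ (≥0-+ (≥0-+ (≥0-sub (iid-sum⁴ k φ Eφ≡0 φ²≤1)) (≥0-sub κ≤1)) (≥0-* (≥0-* (fromℕ≥0 6) (fromℕ≥0 k)) (≥0-sub (*-mono ν≥0 ν≥0 ν≤1 ν≤1)))) (fromℕ≥0 2))
      (cert K κ (ν * ν) m₄))
    where
    open ≡-Reasoning
    isI = isExpect-iid isE k
    S : Vec A k → ℚ
    S = sumV φ
    K κ ν m₁ m₂ m₃ m₄ c₃ : ℚ
    K = fromℕ k
    ν = E (λ a → φ a * φ a)
    κ = E (λ a → φ a * φ a * (φ a * φ a))
    c₃ = E (λ a → φ a * φ a * φ a)
    m₁ = iid k E S
    m₂ = iid k E (λ T → S T * S T)
    m₃ = iid k E (λ T → S T * S T * S T)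
    m₄ = iid k E (λ T → S T * S T * (S T * S T))
    ν≤1 : ν ≤ℚ 1ℚ
    ν≤1 = ≤1 isE φ²≤1
    ν≥0 : 0ℚ ≤ℚ ν
    ν≥0 = nonneg isE (λ a → ≥0-² (φ a))
    κ≤1 : κ ≤ℚ 1ℚ
    κ≤1 = ≤1 isE (λ a → *-mono (≥0-² (φ a)) (≥0-² (φ a)) (φ²≤1 a) (φ²≤1 a))
    m₁≡0 : m₁ ≡ 0ℚ
    m₁≡0 = trans (iid-sum k φ) (trans (cong (K *_) Eφ≡0) (ℚP.*-zeroʳ K))
    expand : ∀ x s → (x + s) * (x + s) * ((x + s) * (x + s))
      ≡ x * x * (x * x) + (fromℕ 4 * (x * x * x) * s + (fromℕ 6 * (x * x) * (s * s) + (fromℕ 4 * x * (s * s * s) + (1ℚ * (s * s * (s * s)) + 0ℚ))))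
    expand = solve-∀ ring
    regroup : ∀ x m₁ m₂ m₃ m₄ → x * x * (x * x) + (fromℕ 4 * (x * x * x) * m₁ + (fromℕ 6 * (x * x) * m₂ + (fromℕ 4 * x * m₃ + (1ℚ * m₄ + 0ℚ))))
      ≡ m₄ + (1ℚ * (x * x * (x * x)) + (fromℕ 4 * m₁ * (x * x * x) + (fromℕ 6 * m₂ * (x * x) + (fromℕ 4 * m₃ * x + 0ℚ))))
    regroup = solve-∀ ring
    simplify : ∀ κ c₃ k v m₃ m₄ → m₄ + (1ℚ * κ + (fromℕ 4 * 0ℚ * c₃ + (fromℕ 6 * (k * v) * v + (fromℕ 4 * m₃ * 0ℚ + 0ℚ))))
      ≡ m₄ + κ + fromℕ 6 * k * (v * v)
    simplify = solve-∀ ring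
    cert : ∀ k κ v m₄ → fromℕ 3 * ((1ℚ + k) * (1ℚ + k)) ≡ m₄ + κ + fromℕ 6 * k * v + (fromℕ 3 * (k * k) - m₄ + (1ℚ - κ) + fromℕ 6 * k * (1ℚ * 1ℚ - v) + fromℕ 2)
    cert = solve-∀ ring
    moment : iid (suc k) E (λ T → sumV φ T * sumV φ T * (sumV φ T * sumV φ T)) ≡ m₄ + κ + fromℕ 6 * K * (ν * ν)
    moment = begin
      E (λ a → iid k E (λ T → (φ a + S T) * (φ a + S T) * ((φ a + S T) * (φ a + S T))))
        ≡⟨ ext isE (λ a → trans (ext isI (λ T → expand (φ a) (S T))) (expect-affine isI (φ a * φ a * (φ a * φ a))
             ((fromℕ 4 * (φ a * φ a * φ a) , S) ∷ (fromℕ 6 * (φ a * φ a) , (λ T → S T * S T)) ∷ (fromℕ 4 * φ a , (λ T → S T * S T * S T)) ∷ (1ℚ , (λ T → S T * S T * (S T * S T))) ∷ []))) ⟩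
      E (λ a → φ a * φ a * (φ a * φ a) + (fromℕ 4 * (φ a * φ a * φ a) * m₁ + (fromℕ 6 * (φ a * φ a) * m₂ + (fromℕ 4 * φ a * m₃ + (1ℚ * m₄ + 0ℚ)))))
        ≡⟨ trans (ext isE (λ a → regroup (φ a) m₁ m₂ m₃ m₄)) (expect-affine isE m₄
             ((1ℚ , (λ a → φ a * φ a * (φ a * φ a))) ∷ (fromℕ 4 * m₁ , (λ a → φ a * φ a * φ a)) ∷ (fromℕ 6 * m₂ , (λ a → φ a * φ a)) ∷ (fromℕ 4 * m₃ , φ) ∷ [])) ⟩
      m₄ + (1ℚ * κ + (fromℕ 4 * m₁ * c₃ + (fromℕ 6 * m₂ * ν + (fromℕ 4 * m₃ * E φ + 0ℚ))))
        ≡⟨ cong₂ (λ x y → m₄ + (1ℚ * κ + (fromℕ 4 * x * c₃ + (fromℕ 6 * y * ν + (fromℕ 4 * m₃ * E φ + 0ℚ))))) m₁≡0 (iid-sum²-centred k φ Eφ≡0) ⟩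
      m₄ + (1ℚ * κ + (fromℕ 4 * 0ℚ * c₃ + (fromℕ 6 * (K * ν) * ν + (fromℕ 4 * m₃ * E φ + 0ℚ))))
        ≡⟨ cong (λ x → m₄ + (1ℚ * κ + (fromℕ 4 * 0ℚ * c₃ + (fromℕ 6 * (K * ν) * ν + (fromℕ 4 * m₃ * x + 0ℚ))))) Eφ≡0 ⟩
      m₄ + (1ℚ * κ + (fromℕ 4 * 0ℚ * c₃ + (fromℕ 6 * (K * ν) * ν + (fromℕ 4 * m₃ * 0ℚ + 0ℚ))))
        ≡⟨ simplify κ c₃ K ν m₃ m₄ ⟩
      m₄ + κ + fromℕ 6 * K * (ν * ν) ∎

  iid-prod : ∀ k φ → iid k E (prodV φ) ≡ pow (E φ) k
  iid-prod zero    φ = refl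
  iid-prod (suc k) φ = trans (ext isE (λ a → trans (scale (isExpect-iid isE k) (φ a) (prodV φ)) (cong (φ a *_) (iid-prod k φ))))
    (sym (scaleʳ isE (pow (E φ) k) φ))

module _ {A : Set} {E : Expect A} (isE : IsExpect E) (φ : A → ℚ) (φ≥0 : ∀ a → 0ℚ ≤ℚ φ a) (φ-idem : ∀ a → φ a * φ a ≡ φ a) where

  private
    q : ℚ
    q = E φ
    q≥0 : 0ℚ ≤ℚ q
    q≥0 = nonneg isE φ≥0

  iid-count² : ∀ k → iid k E (λ T → sumV φ T * sumV φ T) ≡ fromℕ k * q + fromℕ k * (fromℕ k - 1ℚ) * (q * q)
  iid-count² k = trans (iid-sum² isE k φ) (cong (λ z → fromℕ k * z + fromℕ k * (fromℕ k - 1ℚ) * (q * q)) (ext isE φ-idem))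

  count≥0 : ∀ {k} (T : Vec A k) → 0ℚ ≤ℚ sumV φ T
  count≥0 []      = ℚP.≤-refl
  count≥0 (a ∷ T) = ≥0-+ (φ≥0 a) (count≥0 T)

  -- A count is an integer, so N ≤ N². Integrality is visible here only as idempotence of each
  -- summand, hence the induction.
  count≤count² : ∀ {k} (T : Vec A k) → 0ℚ ≤ℚ sumV φ T * sumV φ T - sumV φ T
  count≤count² []      = ℚP.≤-refl
  count≤count² (a ∷ T) = subst (0ℚ ≤ℚ_) (trans (h (φ a) (sumV φ T)) (trans (cong (λ z → (z + fromℕ 2 * φ a * sumV φ T + sumV φ T * sumV φ T) - (φ a + sumV φ T)) (sym (φ-idem a))) (h′ (φ a) (sumV φ T))))
    (≥0-+ (≥0-* (≥0-* (fromℕ≥0 2) (φ≥0 a)) (count≥0 T)) (count≤count² T))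
    where
    h : ∀ x s → fromℕ 2 * x * s + (s * s - s) ≡ x + fromℕ 2 * x * s + s * s - (x + s)
    h = solve-∀ ring
    h′ : ∀ x s → x * x + fromℕ 2 * x * s + s * s - (x + s) ≡ (x + s) * (x + s) - (x + s)
    h′ = solve-∀ ring

  -- A majority forces the count to deviate from its mean kq by at least k(1/2 - q), while its
  -- variance is kq(1 - q) ≤ kq. Keeping q on the right instead of a constant matters at large
  -- thresholds, where q is small.
  majority-chebyshev : ∀ k → 0ℚ < fromℕ k → 0ℚ ≤ℚ ½ - q →
    fromℕ k * ((½ - q) * (½ - q)) * iid k E (λ T → gt (fromℕ k) (fromℕ 2 * sumV φ T)) ≤ℚ q
  majority-chebyshev k K>0 δ≥0 = *-cancel-≤ K>0 (≤-trans
    (subst₂ _≤ℚ_ (trans (scale isI (K * δ * (K * δ)) (λ T → gt K (fromℕ 2 * S T))) (e₁ K δ P)) variance (mono isI pointwise))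
    (≤-byDiff (≥0-* (fromℕ≥0 k) (≥0-* q≥0 q≥0)) (e₂ K q)))
    where
    open ℚP using (≤-trans)
    isI = isExpect-iid isE k
    S : Vec A k → ℚ
    S = sumV φ
    K δ P : ℚ
    K = fromℕ k
    δ = ½ - q
    P = iid k E (λ T → gt K (fromℕ 2 * S T))
    e₁ : ∀ k d p → k * d * (k * d) * p ≡ k * (k * (d * d) * p)
    e₁ = solve-∀ ring
    e₂ : ∀ k q → k * q ≡ k * q - k * (q * q) + k * (q * q)
    e₂ = solve-∀ ring
    e₃ : ∀ k q s → (s - k * q) * (s - k * q) ≡ k * q * (k * q) + (1ℚ * (s * s) + (- (fromℕ 2 * (k * q)) * s + 0ℚ))
    e₃ = solve-∀ ring
    e₄ : ∀ k q → k * q * (k * q) + (1ℚ * (k * q + k * (k - 1ℚ) * (q * q)) + (- (fromℕ 2 * (k * q)) * (k * q) + 0ℚ)) ≡ k * q - k * (q * q)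
    e₄ = solve-∀ ring
    variance : iid k E (λ T → (S T - K * q) * (S T - K * q)) ≡ K * q - K * (q * q)
    variance = trans (ext isI (λ T → e₃ K q (S T))) (trans
      (expect-affine isI (K * q * (K * q)) ((1ℚ , (λ T → S T * S T)) ∷ (- (fromℕ 2 * (K * q)) , S) ∷ []))
      (trans (cong₂ (λ x y → K * q * (K * q) + (1ℚ * x + (- (fromℕ 2 * (K * q)) * y + 0ℚ))) (iid-count² k) (iid-sum isE k φ)) (e₄ K q)))
    e₅ : ∀ k q s → s - k * q ≡ k * (½ - q) + ½ * (fromℕ 2 * s - k)
    e₅ = solve-∀ ring
    pointwise : ∀ T → K * δ * (K * δ) * gt K (fromℕ 2 * S T) ≤ℚ (S T - K * q) * (S T - K * q)
    pointwise T = case (gtView K (fromℕ 2 * S T))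
      where
      Kδ≥0 : 0ℚ ≤ℚ K * δ
      Kδ≥0 = ≥0-* (fromℕ≥0 k) δ≥0
      exceeds : K < fromℕ 2 * S T → K * δ ≤ℚ S T - K * q
      exceeds p = ≤-byDiff (≥0-* (recip≥0 1) (≥0-sub (ℚP.<⇒≤ p))) (e₅ K q (S T))
      case : GtView K (fromℕ 2 * S T) → K * δ * (K * δ) * gt K (fromℕ 2 * S T) ≤ℚ (S T - K * q) * (S T - K * q)
      case (above p e) = subst (_≤ℚ (S T - K * q) * (S T - K * q)) (sym (trans (cong (K * δ * (K * δ) *_) e) (ℚP.*-identityʳ (K * δ * (K * δ)))))
        (*-mono Kδ≥0 Kδ≥0 (exceeds p) (exceeds p))
      case (below p e) = subst (_≤ℚ (S T - K * q) * (S T - K * q)) (sym (trans (cong (K * δ * (K * δ) *_) e) (ℚP.*-zeroʳ (K * δ * (K * δ)))))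
        (≥0-² (S T - K * q))

  -- Markov's inequality for the number N(N-1) of ordered pairs, whose mean is k(k-1)q². When 2N >
  -- k, 4N(N-1) is at least k(k-2), and 4(k-1)/(k-2) ≤ 8 because k ≥ 3.
  majority-pairs : ∀ k → 3 ≤ k → iid k E (λ T → gt (fromℕ k) (fromℕ 2 * sumV φ T)) ≤ℚ fromℕ 8 * (q * q)
  majority-pairs k 3≤k = *-cancel-≤ {K * (K - fromℕ 2)} (>0-* K>0 K-2>0) (≤-trans
    (subst₂ _≤ℚ_ (scale isI (K * (K - fromℕ 2)) (λ T → gt K (fromℕ 2 * S T))) pairs (mono isI pointwise))
    (≤-byDiff (≥0-* (≥0-* (fromℕ≥0 4) (fromℕ≥0 k)) (≥0-* (≥0-* q≥0 q≥0) (≥0-sub (fromℕ-mono 3≤k)))) (e₂ K q)))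
    where
    open ℚP using (≤-trans)
    isI = isExpect-iid isE k
    S : Vec A k → ℚ
    S = sumV φ
    K : ℚ
    K = fromℕ k
    K>0 : 0ℚ < K
    K>0 = ℚP.<-≤-trans (fromℕ>0 2) (fromℕ-mono 3≤k)
    K-2>0 : 0ℚ < K - fromℕ 2
    K-2>0 = ℚP.<-≤-trans (fromℕ>0 0) (ℚP.+-monoˡ-≤ (- fromℕ 2) (fromℕ-mono 3≤k))
    e₂ : ∀ k q → k * (k - fromℕ 2) * (fromℕ 8 * (q * q)) ≡ fromℕ 4 * (k * (k - 1ℚ) * (q * q)) + fromℕ 4 * k * (q * q * (k - fromℕ 3))
    e₂ = solve-∀ ring
    e₃ : ∀ k q → fromℕ 4 * (k * q + k * (k - 1ℚ) * (q * q)) + (- fromℕ 4 * (k * q) + 0ℚ) ≡ fromℕ 4 * (k * (k - 1ℚ) * (q * q))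
    e₃ = solve-∀ ring
    pairs : iid k E (combination ((fromℕ 4 , (λ T → S T * S T)) ∷ (- fromℕ 4 , S) ∷ [])) ≡ fromℕ 4 * (K * (K - 1ℚ) * (q * q))
    pairs = trans (expect-linear isI ((fromℕ 4 , (λ T → S T * S T)) ∷ (- fromℕ 4 , S) ∷ []))
      (trans (cong₂ (λ x y → fromℕ 4 * x + (- fromℕ 4 * y + 0ℚ)) (iid-count² k) (iid-sum isE k φ)) (e₃ K q))
    e₄ : ∀ k s → fromℕ 4 * (s * s) + (- fromℕ 4 * s + 0ℚ) ≡ k * (k - fromℕ 2) * 1ℚ + (fromℕ 2 * s - k) * (fromℕ 2 * s - k + fromℕ 2 * (k - 1ℚ))
    e₄ = solve-∀ ring
    e₅ : ∀ k s → fromℕ 4 * (s * s) + (- fromℕ 4 * s + 0ℚ) ≡ k * (k - fromℕ 2) * 0ℚ + fromℕ 4 * (s * s - s)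
    e₅ = solve-∀ ring
    pointwise : ∀ T → K * (K - fromℕ 2) * gt K (fromℕ 2 * S T) ≤ℚ combination ((fromℕ 4 , (λ T → S T * S T)) ∷ (- fromℕ 4 , S) ∷ []) T
    pointwise T = case (gtView K (fromℕ 2 * S T))
      where
      case : GtView K (fromℕ 2 * S T) → K * (K - fromℕ 2) * gt K (fromℕ 2 * S T) ≤ℚ fromℕ 4 * (S T * S T) + (- fromℕ 4 * S T + 0ℚ)
      case (above p e) = subst (λ z → K * (K - fromℕ 2) * z ≤ℚ fromℕ 4 * (S T * S T) + (- fromℕ 4 * S T + 0ℚ)) (sym e)
          (≤-byDiff (≥0-* (≥0-sub (ℚP.<⇒≤ p)) (≥0-+ (≥0-sub (ℚP.<⇒≤ p)) (≥0-* (fromℕ≥0 2) (≥0-sub (fromℕ-mono {1} (ℕP.≤-trans (s≤s z≤n) 3≤k)))))) (e₄ K (S T)))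
      case (below p e) = subst (λ z → K * (K - fromℕ 2) * z ≤ℚ fromℕ 4 * (S T * S T) + (- fromℕ 4 * S T + 0ℚ)) (sym e)
          (≤-byDiff (≥0-* (fromℕ≥0 4) (count≤count² T)) (e₅ K (S T)))

-- From tails of the rows to the mean error of the median

layers : (ℕ → ℚ) → ℕ → (ℕ → ℚ) → ℚ
layers t zero    p = t 0
layers t (suc M) p = layers t M p + t (suc M) * p M

module _ (t : ℕ → ℚ) (t≥0 : ∀ m → 0ℚ ≤ℚ t m) where

  layers≥0 : ∀ M (p : ℕ → ℚ) → (∀ m → 0ℚ ≤ℚ p m) → 0ℚ ≤ℚ layers t M p
  layers≥0 zero    p p≥0 = t≥0 0
  layers≥0 (suc M) p p≥0 = ≥0-+ (layers≥0 M p p≥0) (≥0-* (t≥0 (suc M)) (p≥0 M))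

  -- A staircase majorant: if `t M` is the first threshold not exceeded by `z`, the term for the
  -- last exceeded one already contributes `t M`. Taking expectations turns it into a discrete
  -- layer-cake bound.
  ≤-layers : ∀ M z → z ≤ℚ t M → z ≤ℚ layers t M (λ m → gt (t m) z)
  ≤-layers zero    z z≤t = z≤t
  ≤-layers (suc M) z z≤t = case (gtView (t M) z)
    where
    l : ℚ
    l = layers t M (λ m → gt (t m) z)
    h₁ : ∀ l t → l + t * 1ℚ ≡ t + l
    h₁ = solve-∀ ring
    h₂ : ∀ l t → l ≡ l + t * 0ℚ
    h₂ = solve-∀ ring
    case : GtView (t M) z → z ≤ℚ l + t (suc M) * gt (t M) z
    case (above p e) = ℚP.≤-trans z≤t (≤-byDiff (layers≥0 M (λ m → gt (t m) z) (λ m → gt≥0 (t m) z))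
      (trans (cong (λ g → l + t (suc M) * g) e) (h₁ l (t (suc M)))))
    case (below p e) = subst (z ≤ℚ_) (trans (h₂ l (t (suc M))) (cong (λ g → l + t (suc M) * g) (sym e))) (≤-layers M z p)

  expect-layers : ∀ {A : Set} {E : Expect A} → IsExpect E → ∀ M (p : A → ℕ → ℚ) →
    E (λ a → layers t M (p a)) ≡ layers t M (λ m → E (λ a → p a m))
  expect-layers isE zero    p = const isE (t 0)
  expect-layers isE (suc M) p = trans (add isE (λ a → layers t M (p a)) (λ a → t (suc M) * p a M))
    (cong₂ _+_ (expect-layers isE M p) (scale isE (t (suc M)) (λ a → p a M)))

module Rows {A : Set} {E : Expect A} (isE : IsExpect E) (Y : A → ℚ) (f : ℚ)
  (symmetric : ∀ (g : ℚ → ℚ) → E (λ a → g (- (Y a - f))) ≡ E (λ a → g (Y a - f)))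
  {k : ℕ} (odd : k % 2 ≡ 1) (3≤k : 3 ≤ k) where

  private
    isI = isExpect-iid isE k
    K : ℚ
    K = fromℕ k
    K>0 : 0ℚ < K
    K>0 = ℚP.<-≤-trans (fromℕ>0 2) (fromℕ-mono 3≤k)

  Z : Vec A k → ℚ
  Z T = median (Vec.toList (Vec.map Y T)) - f

  tail : ℚ → ℚ
  tail t = E (λ a → gt t (Y a - f))

  private
    above₊ below₋ : ℚ → A → ℚ
    above₊ t a = gt t (Y a - f)
    below₋ t a = gt t (- (Y a - f))

  error-split : ∀ t T → gt t ∣ Z T ∣ ≤ℚ gt K (fromℕ 2 * sumV (above₊ t) T) + gt K (fromℕ 2 * sumV (below₋ t) T)
  error-split t T = case (gtView t ∣ Z T ∣) (ℚP.∣p∣≡p∨∣p∣≡-p (Z T))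
    where
    G₊ G₋ : ℚ
    G₊ = gt K (fromℕ 2 * sumV (above₊ t) T)
    G₋ = gt K (fromℕ 2 * sumV (below₋ t) T)
    G₊≥0 : 0ℚ ≤ℚ G₊
    G₊≥0 = gt≥0 K (fromℕ 2 * sumV (above₊ t) T)
    G₋≥0 : 0ℚ ≤ℚ G₋
    G₋≥0 = gt≥0 K (fromℕ 2 * sumV (below₋ t) T)
    case : GtView t ∣ Z T ∣ → ∣ Z T ∣ ≡ Z T ⊎ ∣ Z T ∣ ≡ - Z T → gt t ∣ Z T ∣ ≤ℚ G₊ + G₋
    case (below _ e) _         = subst (_≤ℚ G₊ + G₋) (sym e) (≥0-+ G₊≥0 G₋≥0)
    case (above p e) (inj₁ Z≡) = subst₂ _≤ℚ_ (sym e) (cong (_+ G₋) (sym (gt-yes (median-above⇒ Y f t odd T (subst (t <_) Z≡ p)))))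
      (≤-byDiff G₋≥0 refl)
    case (above p e) (inj₂ Z≡) = subst₂ _≤ℚ_ (sym e) (cong (G₊ +_) (sym (gt-yes (median-below⇒ Y f t odd T (subst (t <_) Z≡ p)))))
      (≤-byDiff G₊≥0 (ℚP.+-comm G₊ 1ℚ))

  errorTail : ℚ → ℚ
  errorTail t = iid k E (λ T → gt t ∣ Z T ∣)

  private
    error-two : ∀ t → errorTail t ≤ℚ iid k E (λ T → gt K (fromℕ 2 * sumV (above₊ t) T)) + iid k E (λ T → gt K (fromℕ 2 * sumV (below₋ t) T))
    error-two t = subst (errorTail t ≤ℚ_) (add isI (λ T → gt K (fromℕ 2 * sumV (above₊ t) T)) (λ T → gt K (fromℕ 2 * sumV (below₋ t) T))) (mono isI (error-split t))

  errorTail-chebyshev : ∀ t → 0ℚ ≤ℚ ½ - tail t → K * ((½ - tail t) * (½ - tail t)) * errorTail t ≤ℚ fromℕ 2 * tail t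
  errorTail-chebyshev t δ≥0 = ℚP.≤-trans (*-monoʳ (≥0-* (fromℕ≥0 k) (≥0-² (½ - tail t))) (error-two t))
    (subst₂ _≤ℚ_ (sym (ℚP.*-distribˡ-+ (K * (δ * δ)) P₊ P₋)) (h q)
      (ℚP.+-mono-≤ (majority-chebyshev isE (above₊ t) (λ a → gt≥0 t (Y a - f)) (λ a → gt-idem t (Y a - f)) k K>0 δ≥0)
                   (subst (λ z → K * ((½ - z) * (½ - z)) * P₋ ≤ℚ z) (symmetric (gt t))
                     (majority-chebyshev isE (below₋ t) (λ a → gt≥0 t (- (Y a - f))) (λ a → gt-idem t (- (Y a - f))) k K>0 (subst (λ z → 0ℚ ≤ℚ ½ - z) (sym (symmetric (gt t))) δ≥0)))))
    where
    q δ P₊ P₋ : ℚ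
    q = tail t
    δ = ½ - q
    P₊ = iid k E (λ T → gt K (fromℕ 2 * sumV (above₊ t) T))
    P₋ = iid k E (λ T → gt K (fromℕ 2 * sumV (below₋ t) T))
    h : ∀ q → q + q ≡ fromℕ 2 * q
    h = solve-∀ ring

  errorTail-pairs : ∀ t → errorTail t ≤ℚ fromℕ 16 * (tail t * tail t)
  errorTail-pairs t = ℚP.≤-trans (error-two t) (subst (P₊ + P₋ ≤ℚ_) (h q)
      (ℚP.+-mono-≤ (majority-pairs isE (above₊ t) (λ a → gt≥0 t (Y a - f)) (λ a → gt-idem t (Y a - f)) k 3≤k)
                   (subst (λ z → P₋ ≤ℚ fromℕ 8 * (z * z)) (symmetric (gt t))
                     (majority-pairs isE (below₋ t) (λ a → gt≥0 t (- (Y a - f))) (λ a → gt-idem t (- (Y a - f))) k 3≤k))))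
    where
    q P₊ P₋ : ℚ
    q = tail t
    P₊ = iid k E (λ T → gt K (fromℕ 2 * sumV (above₊ t) T))
    P₋ = iid k E (λ T → gt K (fromℕ 2 * sumV (below₋ t) T))
    h : ∀ q → fromℕ 8 * (q * q) + fromℕ 8 * (q * q) ≡ fromℕ 16 * (q * q)
    h = solve-∀ ring

  meanError : ℚ
  meanError = iid k E (λ T → ∣ Z T ∣)

  meanError-layers : ∀ t → (∀ m → 0ℚ ≤ℚ t m) → ∀ M → (∀ T → ∣ Z T ∣ ≤ℚ t M) → meanError ≤ℚ layers t M (λ m → errorTail (t m))
  meanError-layers t t≥0 M bound = subst (meanError ≤ℚ_) (expect-layers t t≥0 isI M (λ T m → gt (t m) ∣ Z T ∣))
    (mono isI (λ T → ≤-layers t t≥0 M ∣ Z T ∣ (bound T)))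

  meanError-markov : ∀ ε → 0ℚ ≤ℚ ε → ε * errorTail ε ≤ℚ meanError
  meanError-markov ε ε≥0 = subst (_≤ℚ meanError) (scale isI ε (λ T → gt ε ∣ Z T ∣)) (mono isI pointwise)
    where
    pointwise : ∀ T → ε * gt ε ∣ Z T ∣ ≤ℚ ∣ Z T ∣
    pointwise T = case (gtView ε ∣ Z T ∣)
      where
      case : GtView ε ∣ Z T ∣ → ε * gt ε ∣ Z T ∣ ≤ℚ ∣ Z T ∣
      case (above p e) = subst (_≤ℚ ∣ Z T ∣) (sym (trans (cong (ε *_) e) (ℚP.*-identityʳ ε))) (ℚP.<⇒≤ p)
      case (below p e) = subst (_≤ℚ ∣ Z T ∣) (sym (trans (cong (ε *_) e) (ℚP.*-zeroʳ ε))) (ℚP.0≤∣p∣ (Z T))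

-- Lower bounds on the tail of the median error

sumV-combine : ∀ {A : Set} (φ ψ μ : A → ℚ) → (∀ a → fromℕ 2 * φ a ≡ 1ℚ + ψ a - μ a) →
  ∀ {k} (T : Vec A k) → fromℕ 2 * sumV φ T ≡ fromℕ k + sumV ψ T - sumV μ T
sumV-combine φ ψ μ h []              = refl
sumV-combine φ ψ μ h {suc k} (a ∷ T) = begin
  fromℕ 2 * (φ a + sumV φ T)                                          ≡⟨ ℚP.*-distribˡ-+ (fromℕ 2) (φ a) (sumV φ T) ⟩
  fromℕ 2 * φ a + fromℕ 2 * sumV φ T                                  ≡⟨ cong₂ _+_ (h a) (sumV-combine φ ψ μ h T) ⟩
  1ℚ + ψ a - μ a + (fromℕ k + sumV ψ T - sumV μ T)                    ≡⟨ r (ψ a) (μ a) (fromℕ k) (sumV ψ T) (sumV μ T) ⟩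
  1ℚ + fromℕ k + (ψ a + sumV ψ T) - (μ a + sumV μ T)                  ≡⟨ cong (λ z → z + (ψ a + sumV ψ T) - (μ a + sumV μ T)) (sym (fromℕ-suc k)) ⟩
  fromℕ (suc k) + (ψ a + sumV ψ T) - (μ a + sumV μ T)                 ∎
  where
  open ≡-Reasoning
  r : ∀ x y k s m → 1ℚ + x - y + (k + s - m) ≡ 1ℚ + k + (x + s) - (y + m)
  r = solve-∀ ring

gt-disjoint : ∀ ε x → 0ℚ ≤ℚ ε → gt ε x * gt ε (- x) ≡ 0ℚ
gt-disjoint ε x ε≥0 = case (gtView ε x) (gtView ε (- x))
  where
  case : GtView ε x → GtView ε (- x) → gt ε x * gt ε (- x) ≡ 0ℚ
  case (below _ e) _           = trans (cong (_* gt ε (- x)) e) (ℚP.*-zeroˡ (gt ε (- x)))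
  case (above _ _) (below _ e) = trans (cong (gt ε x *_) e) (ℚP.*-zeroʳ (gt ε x))
  case (above p _) (above q _) = ⊥-elim (ℚP.<-irrefl refl (ℚP.<-≤-trans (ℚP.+-mono-< (ℚP.≤-<-trans ε≥0 p) (ℚP.≤-<-trans ε≥0 q)) (ℚP.≤-reflexive (ℚP.+-inverseʳ x))))

abs≤⇒²≤² : ∀ s m → s ≤ℚ m → - s ≤ℚ m → s * s ≤ℚ m * m
abs≤⇒²≤² s m s≤m -s≤m = ≤-byDiff (≥0-* (≥0-sub s≤m) (≥0-sub -s≤m)) (h s m)
  where
  h : ∀ s m → m * m ≡ s * s + (m - s) * (m - - s)
  h = solve-∀ ring

module _ {A : Set} {E : Expect A} (isE : IsExpect E) (Y : A → ℚ) (f : ℚ)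
  (symmetric : ∀ (g : ℚ → ℚ) → E (λ a → g (- (Y a - f))) ≡ E (λ a → g (Y a - f)))
  {k : ℕ} (odd : k % 2 ≡ 1) (3≤k : 3 ≤ k) (ε : ℚ) (ε≥0 : 0ℚ ≤ℚ ε) where

  open Rows isE Y f symmetric odd 3≤k

  private
    isI = isExpect-iid isE k
    K q : ℚ
    K = fromℕ k
    q = tail ε
    K>0 : 0ℚ < K
    K>0 = ℚP.<-≤-trans (fromℕ>0 2) (fromℕ-mono 3≤k)
    above₊ below₋ ψ μ : A → ℚ
    above₊ a = gt ε (Y a - f)
    below₋ a = gt ε (- (Y a - f))
    ψ a = above₊ a - below₋ a
    μ a = 1ℚ - above₊ a - below₋ a
    E-below : E below₋ ≡ q
    E-below = symmetric (gt ε)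

    idem₊ : ∀ a → above₊ a * above₊ a ≡ above₊ a
    idem₊ a = gt-idem ε (Y a - f)
    idem₋ : ∀ a → below₋ a * below₋ a ≡ below₋ a
    idem₋ a = gt-idem ε (- (Y a - f))
    disjoint : ∀ a → above₊ a * below₋ a ≡ 0ℚ
    disjoint a = gt-disjoint ε (Y a - f) ε≥0

    ψ² : ∀ a → ψ a * ψ a ≡ above₊ a + below₋ a
    ψ² a = trans (h (above₊ a) (below₋ a)) (trans (cong₂ (λ x y → x + y - fromℕ 2 * (above₊ a * below₋ a)) (idem₊ a) (idem₋ a))
      (trans (cong (λ z → above₊ a + below₋ a - fromℕ 2 * z) (disjoint a)) (h′ (above₊ a + below₋ a))))
      where
      h : ∀ x y → (x - y) * (x - y) ≡ x * x + y * y - fromℕ 2 * (x * y)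
      h = solve-∀ ring
      h′ : ∀ x → x - fromℕ 2 * 0ℚ ≡ x
      h′ = solve-∀ ring

    μ² : ∀ a → μ a * μ a ≡ μ a
    μ² a = trans (h (above₊ a) (below₋ a)) (trans (cong₂ (λ x y → 1ℚ - fromℕ 2 * above₊ a - fromℕ 2 * below₋ a + x + y + fromℕ 2 * (above₊ a * below₋ a)) (idem₊ a) (idem₋ a))
      (trans (cong (λ z → 1ℚ - fromℕ 2 * above₊ a - fromℕ 2 * below₋ a + above₊ a + below₋ a + fromℕ 2 * z) (disjoint a)) (h′ (above₊ a) (below₋ a))))
      where
      h : ∀ x y → (1ℚ - x - y) * (1ℚ - x - y) ≡ 1ℚ - fromℕ 2 * x - fromℕ 2 * y + x * x + y * y + fromℕ 2 * (x * y)
      h = solve-∀ ring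
      h′ : ∀ x y → 1ℚ - fromℕ 2 * x - fromℕ 2 * y + x + y + fromℕ 2 * 0ℚ ≡ 1ℚ - x - y
      h′ = solve-∀ ring

    μ≥0 : ∀ a → 0ℚ ≤ℚ μ a
    μ≥0 a = subst (0ℚ ≤ℚ_) (μ² a) (≥0-² (μ a))

    ψ²≤1 : ∀ a → ψ a * ψ a ≤ℚ 1ℚ
    ψ²≤1 a = ≤-byDiff (μ≥0 a) (trans (h (above₊ a) (below₋ a)) (cong (_+ μ a) (sym (ψ² a))))
      where
      h : ∀ x y → 1ℚ ≡ x + y + (1ℚ - x - y)
      h = solve-∀ ring

    Eψ : E ψ ≡ 0ℚ
    Eψ = trans (ext isE (λ a → h (above₊ a) (below₋ a))) (trans (expect-linear isE ((1ℚ , above₊) ∷ (- 1ℚ , below₋) ∷ []))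
      (trans (cong (λ z → 1ℚ * q + (- 1ℚ * z + 0ℚ)) E-below) (h′ q)))
      where
      h : ∀ x y → x - y ≡ 1ℚ * x + (- 1ℚ * y + 0ℚ)
      h = solve-∀ ring
      h′ : ∀ q → 1ℚ * q + (- 1ℚ * q + 0ℚ) ≡ 0ℚ
      h′ = solve-∀ ring

    Eψ² : E (λ a → ψ a * ψ a) ≡ fromℕ 2 * q
    Eψ² = trans (ext isE ψ²) (trans (add isE above₊ below₋) (trans (cong (q +_) E-below) (h q)))
      where
      h : ∀ q → q + q ≡ fromℕ 2 * q
      h = solve-∀ ring

    Eμ : E μ ≡ 1ℚ - fromℕ 2 * q
    Eμ = trans (ext isE (λ a → h (above₊ a) (below₋ a))) (trans (expect-affine isE 1ℚ ((- 1ℚ , above₊) ∷ (- 1ℚ , below₋) ∷ []))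
      (trans (cong (λ z → 1ℚ + (- 1ℚ * q + (- 1ℚ * z + 0ℚ))) E-below) (h′ q)))
      where
      h : ∀ x y → 1ℚ - x - y ≡ 1ℚ + (- 1ℚ * x + (- 1ℚ * y + 0ℚ))
      h = solve-∀ ring
      h′ : ∀ q → 1ℚ + (- 1ℚ * q + (- 1ℚ * q + 0ℚ)) ≡ 1ℚ - fromℕ 2 * q
      h′ = solve-∀ ring

    S M : Vec A k → ℚ
    S = sumV ψ
    M = sumV μ

    -- Twice the number of rows above ε is K + S - M, and twice the number below -ε is K - S - M. If
    -- neither side has a majority, both S and -S are at most M.
    small⇒S²≤M² : ∀ T → ∣ Z T ∣ ≤ℚ ε → S T * S T ≤ℚ M T * M T
    small⇒S²≤M² T Z≤ε = abs≤⇒²≤² (S T) (M T) (bal (S T) (sumV-combine above₊ ψ μ (λ a → h (above₊ a) (below₋ a)) T) up)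
      (bal (- S T) (trans (sumV-combine below₋ ψ′ μ (λ a → h′ (above₊ a) (below₋ a)) T) (cong (λ z → K + z - M T) (neg-sum T))) down)
      where
      ψ′ : A → ℚ
      ψ′ a = - ψ a
      h : ∀ x y → fromℕ 2 * x ≡ 1ℚ + (x - y) - (1ℚ - x - y)
      h = solve-∀ ring
      h′ : ∀ x y → fromℕ 2 * y ≡ 1ℚ + - (x - y) - (1ℚ - x - y)
      h′ = solve-∀ ring
      neg-sum : ∀ {k} (T : Vec A k) → sumV ψ′ T ≡ - sumV ψ T
      neg-sum []      = refl
      neg-sum (a ∷ T) = trans (cong (- ψ a +_) (neg-sum T)) (sym (ℚP.neg-distrib-+ (ψ a) (sumV ψ T)))
      bal : ∀ s {N} → N ≡ K + s - M T → N ≤ℚ K → s ≤ℚ M T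
      bal s refl N≤K = ≤-byDiff (≥0-sub N≤K) (r K s (M T))
        where
        r : ∀ k s m → m ≡ s + (k - (k + s - m))
        r = solve-∀ ring
      up : fromℕ 2 * sumV above₊ T ≤ℚ K
      up = ℚP.≮⇒≥ λ h → ℚP.<-irrefl refl (ℚP.<-≤-trans (⇒median-above Y f ε odd T h) (ℚP.≤-trans (x≤∣x∣ (Z T)) Z≤ε))
      down : fromℕ 2 * sumV below₋ T ≤ℚ K
      down = ℚP.≮⇒≥ λ h → ℚP.<-irrefl refl (ℚP.<-≤-trans (⇒median-below Y f ε odd T h) (ℚP.≤-trans (-x≤∣x∣ (Z T)) Z≤ε))

    test : List (ℚ × (Vec A k → ℚ))
    test = (fromℕ 6 * K , (λ T → S T * S T)) ∷ (- 1ℚ , (λ T → S T * S T * (S T * S T))) ∷ (- (fromℕ 6 * K) , (λ T → M T * M T)) ∷ []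

    -- The quadratic (S² − 3K)² ≥ 0 bounds the test polynomial when |Z| > ε; otherwise S² ≤ M² makes it nonpositive.
    pointwise : ∀ T → combination test T ≤ℚ fromℕ 9 * (K * K) * gt ε ∣ Z T ∣
    pointwise T = case (gtView ε ∣ Z T ∣)
      where
      c₁ : ∀ k s m → fromℕ 9 * (k * k) * 1ℚ ≡ fromℕ 6 * k * s + (- 1ℚ * (s * s) + (- (fromℕ 6 * k) * m + 0ℚ)) + ((s - fromℕ 3 * k) * (s - fromℕ 3 * k) + fromℕ 6 * k * m)
      c₁ = solve-∀ ring
      c₂ : ∀ k s m → fromℕ 9 * (k * k) * 0ℚ ≡ fromℕ 6 * k * s + (- 1ℚ * (s * s) + (- (fromℕ 6 * k) * m + 0ℚ)) + (s * s + fromℕ 6 * k * (m - s))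
      c₂ = solve-∀ ring
      6K≥0 : 0ℚ ≤ℚ fromℕ 6 * K
      6K≥0 = ≥0-* (fromℕ≥0 6) (fromℕ≥0 k)
      case : GtView ε ∣ Z T ∣ → combination test T ≤ℚ fromℕ 9 * (K * K) * gt ε ∣ Z T ∣
      case (above p e) = subst (λ z → combination test T ≤ℚ fromℕ 9 * (K * K) * z) (sym e)
        (≤-byDiff (≥0-+ (≥0-² (S T * S T - fromℕ 3 * K)) (≥0-* 6K≥0 (≥0-² (M T)))) (c₁ K (S T * S T) (M T * M T)))
      case (below p e) = subst (λ z → combination test T ≤ℚ fromℕ 9 * (K * K) * z) (sym e)
        (≤-byDiff (≥0-+ (≥0-² (S T * S T)) (≥0-* 6K≥0 (≥0-sub (small⇒S²≤M² T p)))) (c₂ K (S T * S T) (M T * M T)))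

  -- Take expectations in `pointwise`, with p = 1 - 2q. Since 6K E[S²] = 6K²(1-p), E[S⁴] ≤ 3K² and
  -- 6K E[M²] ≤ 6K²(p + Kp²), the left side is at least 3K² - 6K²(2p + Kp²). The hypothesis makes
  -- this at least 3K²/2, a sixth of 9K².
  errorTail-lower : fromℕ 2 * (1ℚ - fromℕ 2 * q) + K * ((1ℚ - fromℕ 2 * q) * (1ℚ - fromℕ 2 * q)) ≤ℚ (ℤ.+ 1) ℚ./ 4 →
    1ℚ ≤ℚ fromℕ 6 * errorTail ε
  errorTail-lower h = *-cancel-≤ {K * K} (>0-* K>0 K>0) (subst (_≤ℚ K * K * (fromℕ 6 * P)) (sym (ℚP.*-identityʳ (K * K))) total)
    where
    p : ℚ
    p = 1ℚ - fromℕ 2 * q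
    ES² : iid k E (λ T → S T * S T) ≡ K * (fromℕ 2 * q)
    ES² = trans (iid-sum²-centred isE k ψ Eψ) (cong (K *_) Eψ²)
    EM² : iid k E (λ T → M T * M T) ≡ K * p + K * (K - 1ℚ) * (p * p)
    EM² = trans (iid-count² isE μ μ≥0 μ² k) (cong (λ z → K * z + K * (K - 1ℚ) * (z * z)) Eμ)
    m₂ m₄ mM P : ℚ
    m₂ = iid k E (λ T → S T * S T)
    m₄ = iid k E (λ T → S T * S T * (S T * S T))
    mM = iid k E (λ T → M T * M T)
    P = errorTail ε
    raw : fromℕ 6 * K * m₂ + (- 1ℚ * m₄ + (- (fromℕ 6 * K) * mM + 0ℚ)) ≤ℚ fromℕ 9 * (K * K) * P
    raw = subst₂ _≤ℚ_ (expect-linear isI test) (scale isI (fromℕ 9 * (K * K)) (λ T → gt ε ∣ Z T ∣)) (mono isI pointwise)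
    raw′ : fromℕ 6 * K * (K * (fromℕ 2 * q)) + (- 1ℚ * m₄ + (- (fromℕ 6 * K) * (K * p + K * (K - 1ℚ) * (p * p)) + 0ℚ)) ≤ℚ fromℕ 9 * (K * K) * P
    raw′ = subst₂ (λ x y → fromℕ 6 * K * x + (- 1ℚ * m₄ + (- (fromℕ 6 * K) * y + 0ℚ)) ≤ℚ fromℕ 9 * (K * K) * P) ES² EM² raw
    total : K * K ≤ℚ K * K * (fromℕ 6 * P)
    total = ≤-byDiff (≥0-* (≥0-* (fromℕ≥0 2) (recip≥0 2)) (≥0-+ (≥0-sub raw′) (≥0-+ (≥0-+ (≥0-* (≥0-* (fromℕ≥0 6) (≥0-² K)) (≥0-² p))
      (≥0-sub (iid-sum⁴ isE k ψ Eψ ψ²≤1))) (≥0-* (≥0-* (fromℕ≥0 6) (≥0-² K)) (≥0-sub h))))) (cert K q m₄ P)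
      where
      cert : ∀ k q m₄ P → k * k * (fromℕ 6 * P) ≡ k * k + fromℕ 2 * ((ℤ.+ 1) ℚ./ 3) *
        ((fromℕ 9 * (k * k) * P - (fromℕ 6 * k * (k * (fromℕ 2 * q)) + (- 1ℚ * m₄ + (- (fromℕ 6 * k) * (k * (1ℚ - fromℕ 2 * q) + k * (k - 1ℚ) * ((1ℚ - fromℕ 2 * q) * (1ℚ - fromℕ 2 * q))) + 0ℚ))))
        + (fromℕ 6 * (k * k) * ((1ℚ - fromℕ 2 * q) * (1ℚ - fromℕ 2 * q)) + (fromℕ 3 * (k * k) - m₄)
          + fromℕ 6 * (k * k) * ((ℤ.+ 1) ℚ./ 4 - (fromℕ 2 * (1ℚ - fromℕ 2 * q) + k * ((1ℚ - fromℕ 2 * q) * (1ℚ - fromℕ 2 * q))))))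
      cert = solve-∀ ring

  private
    all-above : ∀ {k} (T : Vec A k) → (prodV above₊ T ≡ 0ℚ) ⊎ (prodV above₊ T ≡ 1ℚ × sumV above₊ T ≡ fromℕ k)
    all-above []      = inj₂ (refl , refl)
    all-above {suc k} (a ∷ T) = step (gtView ε (Y a - f)) (all-above T)
      where
      step : GtView ε (Y a - f) → (prodV above₊ T ≡ 0ℚ) ⊎ (prodV above₊ T ≡ 1ℚ × sumV above₊ T ≡ fromℕ k) →
        (above₊ a * prodV above₊ T ≡ 0ℚ) ⊎ (above₊ a * prodV above₊ T ≡ 1ℚ × above₊ a + sumV above₊ T ≡ fromℕ (suc k))
      step (below _ e) _               = inj₁ (trans (cong (_* prodV above₊ T) e) (ℚP.*-zeroˡ (prodV above₊ T)))
      step (above _ e) (inj₁ e′)       = inj₁ (trans (cong (above₊ a *_) e′) (ℚP.*-zeroʳ (above₊ a)))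
      step (above _ e) (inj₂ (e′ , s)) = inj₂ (trans (cong₂ _*_ e e′) refl , trans (cong₂ _+_ e s) (sym (fromℕ-suc k)))

    prod≤error : ∀ T → prodV above₊ T ≤ℚ gt ε ∣ Z T ∣
    prod≤error T = case (all-above T)
      where
      h : ∀ k → k + k ≡ fromℕ 2 * k
      h = solve-∀ ring
      K<2K : K < fromℕ 2 * K
      K<2K = subst₂ _<_ (ℚP.+-identityˡ K) (h K) (ℚP.+-monoˡ-< K K>0)
      case : (prodV above₊ T ≡ 0ℚ) ⊎ (prodV above₊ T ≡ 1ℚ × sumV above₊ T ≡ fromℕ k) → prodV above₊ T ≤ℚ gt ε ∣ Z T ∣
      case (inj₁ e)       = subst (_≤ℚ gt ε ∣ Z T ∣) (sym e) (gt≥0 ε ∣ Z T ∣)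
      case (inj₂ (e , s)) = subst₂ _≤ℚ_ (sym e) (sym (gt-yes (ℚP.<-≤-trans
        (⇒median-above Y f ε odd T (subst (λ z → K < fromℕ 2 * z) (sym s) K<2K)) (x≤∣x∣ (Z T))))) ℚP.≤-refl

  -- If all rows err by more than ε on the same side, so does the median. The bound is exponentially
  -- small and serves only for bounded k.
  errorTail-product : pow q k ≤ℚ errorTail ε
  errorTail-product = subst (_≤ℚ errorTail ε) (iid-prod isE k above₊) (mono isI prod≤error)

-- Tail and concentration of lazy signed sums

sumSq : List ℚ → ℚ
sumSq []       = 0ℚ
sumSq (c ∷ cs) = c * c + sumSq cs

-- The entry at position j of the list has absolute value at most 1/(a+1+j).
data Dominated : ℕ → List ℚ → Set where
  []  : ∀ {a} → Dominated a []
  _∷_ : ∀ {a c cs} → fromℕ (suc a) * fromℕ (suc a) * (c * c) ≤ℚ 1ℚ → Dominated (suc a) cs → Dominated a (c ∷ cs)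

-- The tail of the series of inverse squares, by backward comparison: 1/A² + 2/(A+1) ≤ 2/A for A ≥
-- 1.
sumSq-dominated : ∀ {a cs} → Dominated a cs → fromℕ (suc a) * sumSq cs ≤ℚ fromℕ 2
sumSq-dominated {a} [] = subst (_≤ℚ fromℕ 2) (sym (ℚP.*-zeroʳ (fromℕ (suc a)))) (fromℕ≥0 2)
sumSq-dominated {a} (_∷_ {c = c} {cs} h dom) = *-cancel-≤ {A * (1ℚ + A)} (>0-* A>0 A+1>0)
  (≤-byDiff (≥0-+ (≥0-+ (≥0-* (ℚP.<⇒≤ A+1>0) (≥0-sub h)) (≥0-* (≥0-² A) (≥0-sub ih))) (≥0-sub A≥1)) (cert A (c * c) (sumSq cs)))
  where
  A : ℚ
  A = fromℕ (suc a)
  A>0 : 0ℚ < A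
  A>0 = fromℕ>0 a
  A+1>0 : 0ℚ < 1ℚ + A
  A+1>0 = subst (0ℚ <_) (fromℕ-suc (suc a)) (fromℕ>0 (suc a))
  A≥1 : 1ℚ ≤ℚ A
  A≥1 = fromℕ-mono {1} {suc a} (s≤s z≤n)
  ih : (1ℚ + A) * sumSq cs ≤ℚ fromℕ 2
  ih = subst (λ z → z * sumSq cs ≤ℚ fromℕ 2) (fromℕ-suc (suc a)) (sumSq-dominated dom)
  cert : ∀ A x s → A * (1ℚ + A) * fromℕ 2 ≡ A * (1ℚ + A) * (A * (x + s)) + ((1ℚ + A) * (1ℚ - A * A * x) + A * A * (fromℕ 2 - (1ℚ + A) * s) + (A - 1ℚ))
  cert = solve-∀ ring

gt-abs : ∀ t x → 0ℚ ≤ℚ t → gt t ∣ x ∣ ≡ gt t x + gt t (- x)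
gt-abs t x t≥0 with ℚP.≤-total 0ℚ x
... | inj₁ x≥0 = trans (cong (gt t) (ℚP.0≤p⇒∣p∣≡p x≥0)) (sym (trans (cong (gt t x +_) (gt-no (ℚP.≤-trans (ℚP.neg-antimono-≤ x≥0) t≥0))) (ℚP.+-identityʳ (gt t x))))
... | inj₂ x≤0 = trans (cong (gt t) (trans (sym (ℚP.∣-p∣≡∣p∣ x)) (ℚP.0≤p⇒∣p∣≡p (≥0-neg x≤0)))) (sym (trans (cong (_+ gt t (- x)) (gt-no (ℚP.≤-trans x≤0 t≥0))) (ℚP.+-identityˡ (gt t (- x)))))

halve : List ℚ → List ℚ
halve = List.map (½ *_)

dominated-halve : ∀ {a cs} → Dominated a cs → Dominated a (halve cs)
dominated-halve []        = []
dominated-halve {a} (_∷_ {c = c} h dom) = ℚP.≤-trans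
  (≤-byDiff (≥0-* (≥0-* (fromℕ≥0 3) (recip≥0 3)) (≥0-* (≥0-² (fromℕ (suc a))) (≥0-² c))) (e (fromℕ (suc a)) c)) h ∷ dominated-halve dom
  where
  e : ∀ A c → A * A * (c * c) ≡ A * A * (½ * c * (½ * c)) + fromℕ 3 * ((ℤ.+ 1) ℚ./ 4) * (A * A * (c * c))
  e = solve-∀ ring

-- Indexed by naturals and extended at the last index, unlike `sumFin`, so that sums over bins
-- telescope.
sumTo : ℕ → (ℕ → ℚ) → ℚ
sumTo zero    g = 0ℚ
sumTo (suc N) g = sumTo N g + g N

sumTo-mono : ∀ N {f g} → (∀ u → f u ≤ℚ g u) → sumTo N f ≤ℚ sumTo N g
sumTo-mono zero    h = ℚP.≤-refl
sumTo-mono (suc N) h = ℚP.+-mono-≤ (sumTo-mono N h) (h N)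

sumTo-cong : ∀ N {f g} → (∀ u → f u ≡ g u) → sumTo N f ≡ sumTo N g
sumTo-cong zero    h = refl
sumTo-cong (suc N) h = cong₂ _+_ (sumTo-cong N h) (h N)

sumTo-lin : ∀ N c f d g → sumTo N (λ u → c * f u + d * g u) ≡ c * sumTo N f + d * sumTo N g
sumTo-lin zero    c f d g = h c d
  where
  h : ∀ c d → 0ℚ ≡ c * 0ℚ + d * 0ℚ
  h = solve-∀ ring
sumTo-lin (suc N) c f d g = trans (cong (_+ (c * f N + d * g N)) (sumTo-lin N c f d g)) (h c d (sumTo N f) (sumTo N g) (f N) (g N))
  where
  h : ∀ c d a b x y → c * a + d * b + (c * x + d * y) ≡ c * (a + x) + d * (b + y)
  h = solve-∀ ring

sumTo-const : ∀ N c → sumTo N (λ _ → c) ≡ fromℕ N * c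
sumTo-const zero    c = sym (ℚP.*-zeroˡ c)
sumTo-const (suc N) c = trans (cong (_+ c) (sumTo-const N c)) (trans (h (fromℕ N) c) (cong (_* c) (sym (fromℕ-suc N))))
  where
  h : ∀ n c → n * c + c ≡ (1ℚ + n) * c
  h = solve-∀ ring

expect-sumTo : ∀ {A : Set} {E : Expect A} → IsExpect E → ∀ N (G : ℕ → A → ℚ) → E (λ a → sumTo N (λ u → G u a)) ≡ sumTo N (λ u → E (G u))
expect-sumTo isE zero    G = const isE 0ℚ
expect-sumTo isE (suc N) G = trans (add isE (λ a → sumTo N (λ u → G u a)) (G N)) (cong₂ _+_ (expect-sumTo isE N G) refl)

module _ {q : ℚ} (q≥0 : 0ℚ ≤ℚ q) (q≤1 : q ≤ℚ 1ℚ) where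

  private
    isL = isExpect-Law q≥0 q≤1

  Law-square : ∀ cs → Law q cs (λ x → x * x) ≡ q * sumSq cs
  Law-square []       = trans (ℚP.*-zeroˡ 0ℚ) (sym (ℚP.*-zeroʳ q))
  Law-square (c ∷ cs) = begin
    (1ℚ - q) * m + q * ½ * (L (λ x → (c + x) * (c + x)) + L (λ x → (- c + x) * (- c + x)))
      ≡⟨ cong (λ z → (1ℚ - q) * m + q * ½ * z) (trans (sym (add (isL cs) (λ x → (c + x) * (c + x)) (λ x → (- c + x) * (- c + x))))
           (trans (ext (isL cs) (λ x → e₁ c x)) (expect-affine (isL cs) (fromℕ 2 * (c * c)) ((fromℕ 2 , (λ x → x * x)) ∷ [])))) ⟩
    (1ℚ - q) * m + q * ½ * (fromℕ 2 * (c * c) + (fromℕ 2 * m + 0ℚ))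
      ≡⟨ e₂ q m (c * c) ⟩
    m + q * (c * c)
      ≡⟨ cong (_+ q * (c * c)) (Law-square cs) ⟩
    q * sumSq cs + q * (c * c)
      ≡⟨ e₃ q (sumSq cs) (c * c) ⟩
    q * (c * c + sumSq cs) ∎
    where
    open ≡-Reasoning
    L = Law q cs
    m : ℚ
    m = L (λ x → x * x)
    e₁ : ∀ c x → (c + x) * (c + x) + (- c + x) * (- c + x) ≡ fromℕ 2 * (c * c) + (fromℕ 2 * (x * x) + 0ℚ)
    e₁ = solve-∀ ring
    e₂ : ∀ q m c → (1ℚ - q) * m + q * ½ * (fromℕ 2 * c + (fromℕ 2 * m + 0ℚ)) ≡ m + q * c
    e₂ = solve-∀ ring
    e₃ : ∀ q s c → q * s + q * c ≡ q * (c + s)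
    e₃ = solve-∀ ring

  -- The J leading elements are charged their collision probability q each, the rest their variance.
  Law-tail-split : ∀ t → 0ℚ ≤ℚ t → ∀ J {a cs} → Dominated a cs →
    fromℕ (suc (J ℕ.+ a)) * (t * t * Law q cs (λ x → gt t ∣ x ∣)) ≤ℚ q * (fromℕ (suc (J ℕ.+ a)) * (fromℕ J * (t * t)) + fromℕ 2)
  Law-tail-split t t≥0 zero {a} {cs} dom = ℚP.≤-trans
    (*-monoʳ (fromℕ≥0 (suc a)) (subst₂ _≤ℚ_ (scale (isL cs) (t * t) (λ x → gt t ∣ x ∣)) (Law-square cs) (mono (isL cs) markov)))
    (≤-byDiff (≥0-* q≥0 (≥0-sub (sumSq-dominated dom))) (e (fromℕ (suc a)) q (sumSq cs) (t * t)))
    where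
    e : ∀ A q s t → q * (A * (0ℚ * t) + fromℕ 2) ≡ A * (q * s) + q * (fromℕ 2 - A * s)
    e = solve-∀ ring
    markov : ∀ x → t * t * gt t ∣ x ∣ ≤ℚ x * x
    markov x = case (gtView t ∣ x ∣)
      where
      case : GtView t ∣ x ∣ → t * t * gt t ∣ x ∣ ≤ℚ x * x
      case (above p e) = subst₂ _≤ℚ_ (sym (trans (cong (t * t *_) e) (ℚP.*-identityʳ (t * t)))) (∣x∣²≡x² x) (*-mono t≥0 t≥0 (ℚP.<⇒≤ p) (ℚP.<⇒≤ p))
      case (below p e) = subst (_≤ℚ x * x) (sym (trans (cong (t * t *_) e) (ℚP.*-zeroʳ (t * t)))) (≥0-² x)
  Law-tail-split t t≥0 (suc J) {a} [] = ≤-byDiff (≥0-* q≥0 (≥0-+ (≥0-* (fromℕ≥0 (suc (suc J ℕ.+ a))) (≥0-* (fromℕ≥0 (suc J)) (≥0-² t))) (fromℕ≥0 2)))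
    (trans (sym (ℚP.+-identityˡ rhs)) (cong (_+ rhs) (trans (sym (ℚP.*-zeroʳ (fromℕ (suc (suc J ℕ.+ a))))) (cong (fromℕ (suc (suc J ℕ.+ a)) *_) (trans (sym (ℚP.*-zeroʳ (t * t))) (cong (t * t *_) (sym (gt-no t≥0))))))))
    where
    rhs : ℚ
    rhs = q * (fromℕ (suc (suc J ℕ.+ a)) * (fromℕ (suc J) * (t * t)) + fromℕ 2)
  Law-tail-split t t≥0 (suc J) {a} (_∷_ {c = c} {cs} _ dom) = subst₂ _≤ℚ_ refl (cong₂ (λ D j → q * (fromℕ (suc D) * (j * (t * t)) + fromℕ 2)) (ℕP.+-suc J a) (sym (fromℕ-suc J)))
    (subst (λ D → fromℕ (suc D) * (t * t * P) ≤ℚ q * (fromℕ (suc (J ℕ.+ suc a)) * ((1ℚ + fromℕ J) * (t * t)) + fromℕ 2)) (ℕP.+-suc J a)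
      (≤-byDiff (≥0-+ (≥0-sub (Law-tail-split t t≥0 J dom)) (≥0-* (≥0-* (fromℕ≥0 (suc (J ℕ.+ suc a))) (≥0-² t)) (≥0-sub step)))
        (cert (fromℕ (suc (J ℕ.+ suc a))) (t * t) P P′ q (fromℕ J))))
    where
    P P′ : ℚ
    P = Law q (c ∷ cs) (λ x → gt t ∣ x ∣)
    P′ = Law q cs (λ x → gt t ∣ x ∣)
    cert : ∀ D t P P′ q J → q * (D * ((1ℚ + J) * t) + fromℕ 2) ≡ D * (t * P) + (q * (D * (J * t) + fromℕ 2) - D * (t * P′) + D * t * (P′ + q - P))
    cert = solve-∀ ring
    step : P ≤ℚ P′ + q
    step = ≤-byDiff (≥0-* q≥0 (≥0-+ (nonneg (isL cs) (λ x → gt≥0 t ∣ x ∣))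
        (≥0-* (recip≥0 1) (≥0-+ (≥0-sub (≤1 (isL cs) (λ x → gt≤1 t ∣ c + x ∣))) (≥0-sub (≤1 (isL cs) (λ x → gt≤1 t ∣ - c + x ∣)))))))
      (e q P′ (Law q cs (λ x → gt t ∣ c + x ∣)) (Law q cs (λ x → gt t ∣ - c + x ∣)))
      where
      e : ∀ q p x y → p + q ≡ (1ℚ - q) * p + q * ½ * (x + y) + q * (p + ½ * (1ℚ - x + (1ℚ - y)))
      e = solve-∀ ring

  -- The hypotheses place J at the integer part of 1/t. The J charged elements cost Jq ≤ q/t, and
  -- the variance of the others costs 2q/((J+1)t²) ≤ 2q/t.
  Law-tail : ∀ t → 0ℚ < t → ∀ J {cs} → Dominated 0 cs → fromℕ J * t ≤ℚ 1ℚ → 1ℚ ≤ℚ fromℕ (suc J) * t →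
    t * Law q cs (λ x → gt t ∣ x ∣) ≤ℚ fromℕ 3 * q
  Law-tail t t>0 J {cs} dom Jt≤1 1≤Jt = *-cancel-≤ {D * t} (>0-* (fromℕ>0 J) t>0)
    (≤-byDiff (≥0-+ (≥0-sub raw) (≥0-* q≥0 (≥0-+ (≥0-* (≥0-* (fromℕ≥0 (suc J)) (ℚP.<⇒≤ t>0)) (≥0-sub Jt≤1)) (≥0-* (fromℕ≥0 2) (≥0-sub 1≤Jt)))))
      (cert D t P q (fromℕ J)))
    where
    D P : ℚ
    D = fromℕ (suc J)
    P = Law q cs (λ x → gt t ∣ x ∣)
    raw : D * (t * t * P) ≤ℚ q * (D * (fromℕ J * (t * t)) + fromℕ 2)
    raw = subst (λ z → fromℕ (suc z) * (t * t * P) ≤ℚ q * (fromℕ (suc z) * (fromℕ J * (t * t)) + fromℕ 2)) (ℕP.+-identityʳ J) (Law-tail-split t (ℚP.<⇒≤ t>0) J dom)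
    cert : ∀ D t P q J → D * t * (fromℕ 3 * q) ≡ D * t * (t * P) + (q * (D * (J * (t * t)) + fromℕ 2) - D * (t * t * P) + q * (D * t * (1ℚ - J * t) + fromℕ 2 * (D * t - 1ℚ)))
    cert = solve-∀ ring

  two-sided : ∀ t → 0ℚ ≤ℚ t → ∀ cs → Law q cs (λ x → gt t ∣ x ∣) ≡ fromℕ 2 * Law q cs (gt t)
  two-sided t t≥0 cs = trans (ext (isL cs) (λ x → gt-abs t x t≥0)) (trans (add (isL cs) (gt t) (λ x → gt t (- x)))
    (trans (cong (Law q cs (gt t) +_) (Law-sym q≥0 q≤1 cs (gt t))) (h (Law q cs (gt t)))))
    where
    h : ∀ x → x + x ≡ fromℕ 2 * x
    h = solve-∀ ring

-- A lazy sign with probability q is, with probability 2q, the difference of two independent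
-- signs ±½.  Hence X = Y − Y′ with Y, Y′ identically distributed and conditionally independent,
-- and P(X near 0) is at least the collision probability of Y; λ linearises the squares z² ≥ 2λz − λ².
module _ {q : ℚ} (q≥0 : 0ℚ ≤ℚ q) (2q≤1 : fromℕ 2 * q ≤ℚ 1ℚ) where

  private
    2q≥0 : 0ℚ ≤ℚ fromℕ 2 * q
    2q≥0 = ≥0-* (fromℕ≥0 2) q≥0
    q≤1 : q ≤ℚ 1ℚ
    q≤1 = ℚP.≤-trans (≤-byDiff q≥0 (h q)) 2q≤1
      where
      h : ∀ q → fromℕ 2 * q ≡ q + q
      h = solve-∀ ring
    isL = isExpect-Law q≥0 q≤1
    isL₂ = isExpect-Law 2q≥0 2q≤1

  -- The test functions G play the role of bins. Each head either has no half-signs, or, with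
  -- probability 2q, shifts y and y′ by independent ±c/2: then every G u is replaced by its average
  -- `Ḡ` over the shift, g by the mixture `g̃`, and the hypothesis survives. The squares of the bin
  -- masses would have to be taken before averaging over which elements are active; the linearised
  -- form with a fixed l commutes with that average.
  decoupling : ∀ cs N (G : ℕ → ℚ → ℚ) (g : ℚ → ℚ) l → (∀ y y′ → sumTo N (λ u → G u y * G u y′) ≤ℚ g (y - y′)) →
    sumTo N (λ u → fromℕ 2 * l * Law (fromℕ 2 * q) (halve cs) (G u) - l * l) ≤ℚ Law q cs g
  decoupling [] N G g l hyp = ℚP.≤-trans (sumTo-mono N (λ u → ≤-byDiff (≥0-² (G u 0ℚ - l)) (e (G u 0ℚ) l))) (hyp 0ℚ 0ℚ)
    where
    e : ∀ x l → x * x ≡ fromℕ 2 * l * x - l * l + (x - l) * (x - l)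
    e = solve-∀ ring
  decoupling (c ∷ cs) N G g l hyp = subst₂ _≤ℚ_ (sym lhs) (sym rhs)
    (ℚP.+-mono-≤ (*-monoʳ (≥0-sub 2q≤1) (decoupling cs N G g l hyp)) (*-monoʳ 2q≥0 (decoupling cs N Ḡ g̃ l hyp̃)))
    where
    c′ : ℚ
    c′ = ½ * c
    L₂ = Law (fromℕ 2 * q) (halve cs)
    Ḡ : ℕ → ℚ → ℚ
    Ḡ u y = ½ * G u (c′ + y) + ½ * G u (- c′ + y)
    ¼ : ℚ
    ¼ = (ℤ.+ 1) ℚ./ 4
    shifts : List (ℚ × (ℚ → ℚ))
    shifts = (½ , g) ∷ (¼ , (λ x → g (c + x))) ∷ (¼ , (λ x → g (- c + x))) ∷ []
    g̃ : ℚ → ℚ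
    g̃ = combination shifts
    lhs : sumTo N (λ u → fromℕ 2 * l * Law (fromℕ 2 * q) (halve (c ∷ cs)) (G u) - l * l)
      ≡ (1ℚ - fromℕ 2 * q) * sumTo N (λ u → fromℕ 2 * l * L₂ (G u) - l * l) + fromℕ 2 * q * sumTo N (λ u → fromℕ 2 * l * L₂ (Ḡ u) - l * l)
    lhs = trans (sumTo-cong N (λ u → trans (e q l (L₂ (G u)) (L₂ (λ y → G u (c′ + y))) (L₂ (λ y → G u (- c′ + y))))
        (cong (λ z → (1ℚ - fromℕ 2 * q) * (fromℕ 2 * l * L₂ (G u) - l * l) + fromℕ 2 * q * (fromℕ 2 * l * z - l * l)) (sym (average u)))))
      (sumTo-lin N (1ℚ - fromℕ 2 * q) (λ u → fromℕ 2 * l * L₂ (G u) - l * l) (fromℕ 2 * q) (λ u → fromℕ 2 * l * L₂ (Ḡ u) - l * l))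
      where
      e : ∀ q l x y z → fromℕ 2 * l * ((1ℚ - fromℕ 2 * q) * x + fromℕ 2 * q * ½ * (y + z)) - l * l
        ≡ (1ℚ - fromℕ 2 * q) * (fromℕ 2 * l * x - l * l) + fromℕ 2 * q * (fromℕ 2 * l * (½ * y + ½ * z) - l * l)
      e = solve-∀ ring
      average : ∀ u → L₂ (Ḡ u) ≡ ½ * L₂ (λ y → G u (c′ + y)) + ½ * L₂ (λ y → G u (- c′ + y))
      average u = trans (add (isL₂ (halve cs)) (λ y → ½ * G u (c′ + y)) (λ y → ½ * G u (- c′ + y)))
        (cong₂ _+_ (scale (isL₂ (halve cs)) ½ (λ y → G u (c′ + y))) (scale (isL₂ (halve cs)) ½ (λ y → G u (- c′ + y))))
    rhs : Law q (c ∷ cs) g ≡ (1ℚ - fromℕ 2 * q) * Law q cs g + fromℕ 2 * q * Law q cs g̃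
    rhs = trans (e q (Law q cs g) (Law q cs (λ x → g (c + x))) (Law q cs (λ x → g (- c + x))))
      (cong (λ z → (1ℚ - fromℕ 2 * q) * Law q cs g + fromℕ 2 * q * z) (sym (expect-linear (isL cs) shifts)))
      where
      e : ∀ q x y z → (1ℚ - q) * x + q * ½ * (y + z)
        ≡ (1ℚ - fromℕ 2 * q) * x + fromℕ 2 * q * (½ * x + ((ℤ.+ 1) ℚ./ 4 * y + ((ℤ.+ 1) ℚ./ 4 * z + 0ℚ)))
      e = solve-∀ ring
    hyp̃ : ∀ y y′ → sumTo N (λ u → Ḡ u y * Ḡ u y′) ≤ℚ g̃ (y - y′)
    hyp̃ y y′ = subst₂ _≤ℚ_ (sym split) regroup
      (ℚP.+-mono-≤ (*-monoʳ ½≥0 (ℚP.+-mono-≤ (*-monoʳ ½≥0 (hyp (c′ + y) (c′ + y′))) (*-monoʳ ½≥0 (hyp (c′ + y) (- c′ + y′)))))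
                   (*-monoʳ ½≥0 (ℚP.+-mono-≤ (*-monoʳ ½≥0 (hyp (- c′ + y) (c′ + y′))) (*-monoʳ ½≥0 (hyp (- c′ + y) (- c′ + y′))))))
      where
      ½≥0 : 0ℚ ≤ℚ ½
      ½≥0 = recip≥0 1
      Σ₂ : ℚ → ℚ → ℚ
      Σ₂ z z′ = sumTo N (λ u → G u z * G u z′)
      product : ∀ a b a′ b′ → (½ * a + ½ * b) * (½ * a′ + ½ * b′) ≡ ½ * (½ * (a * a′) + ½ * (a * b′)) + ½ * (½ * (b * a′) + ½ * (b * b′))
      product = solve-∀ ring
      split : sumTo N (λ u → Ḡ u y * Ḡ u y′) ≡ ½ * (½ * Σ₂ (c′ + y) (c′ + y′) + ½ * Σ₂ (c′ + y) (- c′ + y′)) + ½ * (½ * Σ₂ (- c′ + y) (c′ + y′) + ½ * Σ₂ (- c′ + y) (- c′ + y′))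
      split = trans (sumTo-cong N (λ u → product (G u (c′ + y)) (G u (- c′ + y)) (G u (c′ + y′)) (G u (- c′ + y′))))
        (trans (sumTo-lin N ½ (λ u → ½ * (G u (c′ + y) * G u (c′ + y′)) + ½ * (G u (c′ + y) * G u (- c′ + y′))) ½ (λ u → ½ * (G u (- c′ + y) * G u (c′ + y′)) + ½ * (G u (- c′ + y) * G u (- c′ + y′))))
          (cong₂ (λ x z → ½ * x + ½ * z) (sumTo-lin N ½ (λ u → G u (c′ + y) * G u (c′ + y′)) ½ (λ u → G u (c′ + y) * G u (- c′ + y′)))
                                         (sumTo-lin N ½ (λ u → G u (- c′ + y) * G u (c′ + y′)) ½ (λ u → G u (- c′ + y) * G u (- c′ + y′)))))
      d₁ : ∀ c y y′ → c + y - (c + y′) ≡ y - y′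
      d₁ = solve-∀ ring
      d₂ : ∀ c y y′ → ½ * c + y - (- (½ * c) + y′) ≡ c + (y - y′)
      d₂ = solve-∀ ring
      d₃ : ∀ c y y′ → - (½ * c) + y - (½ * c + y′) ≡ - c + (y - y′)
      d₃ = solve-∀ ring
      collect : ∀ x y z → ½ * (½ * x + ½ * y) + ½ * (½ * z + ½ * x) ≡ ½ * x + ((ℤ.+ 1) ℚ./ 4 * y + ((ℤ.+ 1) ℚ./ 4 * z + 0ℚ))
      collect = solve-∀ ring
      regroup : ½ * (½ * g (c′ + y - (c′ + y′)) + ½ * g (c′ + y - (- c′ + y′))) + ½ * (½ * g (- c′ + y - (c′ + y′)) + ½ * g (- c′ + y - (- c′ + y′))) ≡ g̃ (y - y′)
      regroup = trans (cong₂ (λ x z → ½ * x + ½ * z) (cong₂ (λ x z → ½ * g x + ½ * g z) (d₁ c′ y y′) (d₂ c y y′)) (cong₂ (λ x z → ½ * g x + ½ * g z) (d₃ c y y′) (d₁ (- c′) y y′)))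
        (collect (g (y - y′)) (g (c + (y - y′))) (g (- c + (y - y′))))

-- Concentration near zero by collisions in bins

near : ℚ → ℚ → ℚ
near t x = 1ℚ - gt t ∣ x ∣

near≥0 : ∀ t x → 0ℚ ≤ℚ near t x
near≥0 t x = ≥0-sub (gt≤1 t ∣ x ∣)

near≤1 : ∀ t x → near t x ≤ℚ 1ℚ
near≤1 t x = ≤-byDiff (gt≥0 t ∣ x ∣) (h (gt t ∣ x ∣))
  where
  h : ∀ g → 1ℚ ≡ 1ℚ - g + g
  h = solve-∀ ring

data NearView (t x : ℚ) : Set where
  close : x ≤ℚ t → - x ≤ℚ t → near t x ≡ 1ℚ → NearView t x
  far   : t < ∣ x ∣ → near t x ≡ 0ℚ → NearView t x

nearView : ∀ t x → NearView t x
nearView t x = case (gtView t ∣ x ∣)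
  where
  case : GtView t ∣ x ∣ → NearView t x
  case (above p e) = far p (cong (λ z → 1ℚ - z) e)
  case (below p e) = close (ℚP.≤-trans (x≤∣x∣ x) p) (ℚP.≤-trans (-x≤∣x∣ x) p) (cong (λ z → 1ℚ - z) e)

near-neg : ∀ t x → near t (- x) ≡ near t x
near-neg t x = cong (λ z → 1ℚ - gt t z) (ℚP.∣-p∣≡∣p∣ x)

module Bins (t ρ : ℚ) (t≥0 : 0ℚ ≤ℚ t) where

  edge : ℕ → ℚ
  edge u = fromℕ u * t - ρ

  bin : ℕ → ℚ → ℚ
  bin u y = gt (edge u) y - gt (edge (suc u)) y

  edge-suc : ∀ u → edge (suc u) ≡ edge u + t
  edge-suc u = trans (cong (λ z → z * t - ρ) (fromℕ-suc u)) (h (fromℕ u) t ρ)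
    where
    h : ∀ u t ρ → (1ℚ + u) * t - ρ ≡ u * t - ρ + t
    h = solve-∀ ring

  data BinView (u : ℕ) (y : ℚ) : Set where
    inside  : edge u ≤ℚ y → y ≤ℚ edge u + t → bin u y ≡ 1ℚ → BinView u y
    outside : bin u y ≡ 0ℚ → BinView u y

  binView : ∀ u y → BinView u y
  binView u y = case (gtView (edge u) y) (gtView (edge (suc u)) y)
    where
    case : GtView (edge u) y → GtView (edge (suc u)) y → BinView u y
    case (below _ e) (below _ e′)  = outside (trans (cong₂ _-_ e e′) refl)
    case (above _ e) (above _ e′)  = outside (trans (cong₂ _-_ e e′) refl)
    case (above p e) (below p′ e′) = inside (ℚP.<⇒≤ p) (subst (y ≤ℚ_) (edge-suc u) p′) (trans (cong₂ _-_ e e′) refl)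
    case (below p e) (above p′ e′) = ⊥-elim (ℚP.<-irrefl refl (ℚP.<-≤-trans p′ (ℚP.≤-trans p (subst (edge u ≤ℚ_) (sym (edge-suc u)) (≤-byDiff t≥0 refl)))))

  bin≥0 : ∀ u y → 0ℚ ≤ℚ bin u y
  bin≥0 u y = case (binView u y)
    where
    case : BinView u y → 0ℚ ≤ℚ bin u y
    case (inside _ _ e) = subst (0ℚ ≤ℚ_) (sym e) 0≤1
    case (outside e)    = ℚP.≤-reflexive (sym e)

  bin≤1 : ∀ u y → bin u y ≤ℚ 1ℚ
  bin≤1 u y = case (binView u y)
    where
    case : BinView u y → bin u y ≤ℚ 1ℚ
    case (inside _ _ e) = ℚP.≤-reflexive e
    case (outside e)    = subst (_≤ℚ 1ℚ) (sym e) 0≤1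

  sum-bins : ∀ N y → sumTo N (λ u → bin u y) ≡ gt (edge 0) y - gt (edge N) y
  sum-bins zero    y = sym (ℚP.+-inverseʳ (gt (edge 0) y))
  sum-bins (suc N) y = trans (cong (_+ bin N y) (sum-bins N y)) (h (gt (edge 0) y) (gt (edge N) y) (gt (edge (suc N)) y))
    where
    h : ∀ a b c → a - b + (b - c) ≡ a - c
    h = solve-∀ ring

  sum-bins≤1 : ∀ N y → sumTo N (λ u → bin u y) ≤ℚ 1ℚ
  sum-bins≤1 N y = subst (_≤ℚ 1ℚ) (sym (sum-bins N y)) (≤-byDiff (≥0-+ (≥0-sub (gt≤1 (edge 0) y)) (gt≥0 (edge N) y)) (h (gt (edge 0) y) (gt (edge N) y)))
    where
    h : ∀ a b → 1ℚ ≡ a - b + (1ℚ - a + b)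
    h = solve-∀ ring

  covers : ∀ N R y → R < ρ → ρ + R ≤ℚ fromℕ N * t → near R y ≤ℚ sumTo N (λ u → bin u y)
  covers N R y R<ρ ρ+R≤Nt = subst (near R y ≤ℚ_) (sym (sum-bins N y)) (case (nearView R y))
    where
    case : NearView R y → near R y ≤ℚ gt (edge 0) y - gt (edge N) y
    case (close y≤R -y≤R e) = ℚP.≤-reflexive (trans e (sym (trans (cong₂ _-_ (gt-yes lo) (gt-no hi)) refl)))
      where
      h₁ : ∀ t y ρ → 0ℚ * t - ρ ≡ y + (- y - ρ)
      h₁ = solve-∀ ring
      h₃ : ∀ ρ → ρ - ρ ≡ 0ℚ
      h₃ = solve-∀ ring
      lo : edge 0 < y
      lo = subst₂ _<_ (sym (h₁ t y ρ)) (ℚP.+-identityʳ y) (ℚP.+-monoʳ-< y (subst (- y - ρ <_) (h₃ ρ) (ℚP.+-monoˡ-< (- ρ) (ℚP.≤-<-trans -y≤R R<ρ))))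
      h₄ : ∀ nt ρ r y → nt - ρ ≡ y + (nt - (ρ + r) + (r - y))
      h₄ = solve-∀ ring
      hi : y ≤ℚ edge N
      hi = ≤-byDiff (≥0-+ (≥0-sub ρ+R≤Nt) (≥0-sub y≤R)) (h₄ (fromℕ N * t) ρ R y)
    case (far _ e) = subst₂ _≤ℚ_ (sym e) (sum-bins N y) (sumTo≥0 N)
      where
      sumTo≥0 : ∀ N → 0ℚ ≤ℚ sumTo N (λ u → bin u y)
      sumTo≥0 zero    = ℚP.≤-refl
      sumTo≥0 (suc N) = ≥0-+ (sumTo≥0 N) (bin≥0 N y)

  same-bin : ∀ u y y′ → t < ∣ y - y′ ∣ → bin u y * bin u y′ ≡ 0ℚ
  same-bin u y y′ t<dist = case (binView u y) (binView u y′)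
    where
    h₁ : ∀ e t y y′ → t ≡ y - y′ + (e + t - y + (y′ - e))
    h₁ = solve-∀ ring
    h₂ : ∀ e t y y′ → t ≡ - (y - y′) + (e + t - y′ + (y - e))
    h₂ = solve-∀ ring
    case : BinView u y → BinView u y′ → bin u y * bin u y′ ≡ 0ℚ
    case (outside e) _ = trans (cong (_* bin u y′) e) (ℚP.*-zeroˡ (bin u y′))
    case (inside _ _ _) (outside e) = trans (cong (bin u y *_) e) (ℚP.*-zeroʳ (bin u y))
    case (inside a b _) (inside a′ b′ _) = ⊥-elim (ℚP.<-irrefl refl (ℚP.<-≤-trans t<dist (abs-lub
      (≤-byDiff (≥0-+ (≥0-sub b) (≥0-sub a′)) (h₁ (edge u) t y y′))
      (≤-byDiff (≥0-+ (≥0-sub b′) (≥0-sub a)) (h₂ (edge u) t y y′)))))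

  -- Two points in a common bin are within t of each other, and y lies in at most one bin. This is
  -- the hypothesis of `decoupling` for bins of width t.
  kernel : ∀ N y y′ → sumTo N (λ u → bin u y * bin u y′) ≤ℚ near t (y - y′)
  kernel N y y′ = case (nearView t (y - y′))
    where
    case : NearView t (y - y′) → sumTo N (λ u → bin u y * bin u y′) ≤ℚ near t (y - y′)
    case (close _ _ e) = subst (sumTo N (λ u → bin u y * bin u y′) ≤ℚ_) (sym e)
      (ℚP.≤-trans (sumTo-mono N (λ u → subst (bin u y * bin u y′ ≤ℚ_) (ℚP.*-identityʳ (bin u y)) (*-monoʳ (bin≥0 u y) (bin≤1 u y′)))) (sum-bins≤1 N y))
    case (far p e) = ℚP.≤-reflexive (trans (sumTo-cong N (λ u → same-bin u y y′ p)) (trans (sumTo-const N 0ℚ) (trans (ℚP.*-zeroʳ (fromℕ N)) (sym e))))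

-- Cauchy-Schwarz in linearised form: a mass of at least 1/2 spread over N + 1 bins collides with
-- probability at least 1/(4(N+1)). The choice l = 1/(2(N+1)), the average mass of a bin, is where
-- the linearisation loses nothing.
Law-near-lower : ∀ {q} → 0ℚ ≤ℚ q → fromℕ 2 * q ≤ℚ 1ℚ → ∀ cs t R ρ → 0ℚ ≤ℚ t → R < ρ → ∀ N → ρ + R ≤ℚ fromℕ (suc N) * t →
  Law (fromℕ 2 * q) (halve cs) (λ y → gt R ∣ y ∣) ≤ℚ ½ → 1ℚ ≤ℚ fromℕ (4 *ℕ suc N) * Law q cs (near t)
Law-near-lower {q} q≥0 2q≤1 cs t R ρ t≥0 R<ρ N wide tail≤½ = subst (λ z → 1ℚ ≤ℚ z * Law q cs (near t)) (sym (fromℕ-* 4 (suc N)))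
  (ℚP.≤-trans ident (*-monoʳ {fromℕ 4 * n} (≥0-* (fromℕ≥0 4) (fromℕ≥0 (suc N))) bound))
  where
  open Bins t ρ t≥0
  L₂ = Law (fromℕ 2 * q) (halve cs)
  isL₂ = isExpect-Law (≥0-* (fromℕ≥0 2) q≥0) 2q≤1 (halve cs)
  n l T : ℚ
  n = fromℕ (suc N)
  l = ½ * ((ℤ.+ 1) ℚ./ suc N)
  l≥0 : 0ℚ ≤ℚ l
  l≥0 = ≥0-* (recip≥0 1) (recip≥0 N)
  T = L₂ (λ y → gt R ∣ y ∣)
  total : sumTo (suc N) (λ u → fromℕ 2 * l * L₂ (bin u) - l * l) ≤ℚ Law q cs (near t)
  total = decoupling q≥0 2q≤1 cs (suc N) bin (near t) l (kernel (suc N))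
  e₁ : ∀ l x → fromℕ 2 * l * x - l * l ≡ fromℕ 2 * l * x + - 1ℚ * (l * l)
  e₁ = solve-∀ ring
  expand : sumTo (suc N) (λ u → fromℕ 2 * l * L₂ (bin u) - l * l) ≡ fromℕ 2 * l * L₂ (λ y → sumTo (suc N) (λ u → bin u y)) + - 1ℚ * (n * (l * l))
  expand = trans (sumTo-cong (suc N) (λ u → e₁ l (L₂ (bin u)))) (trans (sumTo-lin (suc N) (fromℕ 2 * l) (λ u → L₂ (bin u)) (- 1ℚ) (λ _ → l * l))
    (cong₂ (λ x z → fromℕ 2 * l * x + - 1ℚ * z) (sym (expect-sumTo isL₂ (suc N) bin)) (sumTo-const (suc N) (l * l))))
  mass : 1ℚ - T ≤ℚ L₂ (λ y → sumTo (suc N) (λ u → bin u y))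
  mass = subst (_≤ℚ L₂ (λ y → sumTo (suc N) (λ u → bin u y))) (trans (ext isL₂ (λ y → e₂ (gt R ∣ y ∣))) (trans (expect-affine isL₂ 1ℚ ((- 1ℚ , (λ y → gt R ∣ y ∣)) ∷ [])) (sym (e₂ T))))
    (mono isL₂ (λ y → covers (suc N) R y R<ρ wide))
    where
    e₂ : ∀ x → 1ℚ - x ≡ 1ℚ + (- 1ℚ * x + 0ℚ)
    e₂ = solve-∀ ring
  bound : l - n * (l * l) ≤ℚ Law q cs (near t)
  bound = ℚP.≤-trans (≤-byDiff (≥0-* (≥0-* (fromℕ≥0 2) l≥0) (≥0-+ (≥0-sub mass) (≥0-sub tail≤½))) (trans expand (e₃ l n (L₂ (λ y → sumTo (suc N) (λ u → bin u y))) T))) total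
    where
    e₃ : ∀ l n s T → fromℕ 2 * l * s + - 1ℚ * (n * (l * l)) ≡ l - n * (l * l) + fromℕ 2 * l * (s - (1ℚ - T) + (½ - T))
    e₃ = solve-∀ ring
  ident : 1ℚ ≤ℚ fromℕ 4 * n * (l - n * (l * l))
  ident = ℚP.≤-reflexive (sym (trans (e₄ n ((ℤ.+ 1) ℚ./ suc N)) (cong (λ z → fromℕ 2 * z - z * z) (suc*recip N))))
    where
    e₄ : ∀ n r → fromℕ 4 * n * (½ * r - n * (½ * r * (½ * r))) ≡ fromℕ 2 * (n * r) - n * r * (n * r)
    e₄ = solve-∀ ring

-- Anticoncentration from the leading elements

data Prefix (P : ℚ → Set) : ℕ → List ℚ → Set where
  done : ∀ {cs} → Prefix P 0 cs
  _∷_  : ∀ {h c cs} → P c → Prefix P h cs → Prefix P (suc h) (c ∷ cs)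

module _ {q : ℚ} (q≥0 : 0ℚ ≤ℚ q) (q≤1 : q ≤ℚ 1ℚ) where

  private
    isL = isExpect-Law q≥0 q≤1

  -- Flipping the sign of the first colliding heavy element moves the sum by more than 2ε.
  Law-near-heavy : ∀ ε {h cs} → Prefix (ε <_) h cs → ∀ x → Law q cs (λ y → near ε (x + y)) ≤ℚ ½ + ½ * pow (1ℚ - q) h
  Law-near-heavy ε {cs = cs} done x = ≤1 (isL cs) (λ y → near≤1 ε (x + y))
  Law-near-heavy ε {suc h} {c ∷ cs} (ε<c ∷ heavy) x = ≤-byDiff
    (≥0-+ (≥0-* (≥0-sub q≤1) (≥0-sub (Law-near-heavy ε heavy x))) (≥0-* (≥0-* q≥0 (recip≥0 1)) (≥0-sub pair)))
    (e q (Law q cs (λ y → near ε (x + y))) (Law q cs (λ y → near ε (x + (c + y)))) (Law q cs (λ y → near ε (x + (- c + y)))) (pow (1ℚ - q) h))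
    where
    e : ∀ q a b c w → ½ + ½ * ((1ℚ - q) * w) ≡ (1ℚ - q) * a + q * ½ * (b + c) + ((1ℚ - q) * (½ + ½ * w - a) + q * ½ * (1ℚ - (b + c)))
    e = solve-∀ ring
    d₁ : ∀ c x y → fromℕ 2 * c ≡ x + (c + y) + - (x + (- c + y))
    d₁ = solve-∀ ring
    d₂ : ∀ ε → ε + ε ≡ fromℕ 2 * ε
    d₂ = solve-∀ ring
    pointwise : ∀ y → near ε (x + (c + y)) + near ε (x + (- c + y)) ≤ℚ 1ℚ
    pointwise y = case (nearView ε (x + (c + y))) (nearView ε (x + (- c + y)))
      where
      case : NearView ε (x + (c + y)) → NearView ε (x + (- c + y)) → near ε (x + (c + y)) + near ε (x + (- c + y)) ≤ℚ 1ℚ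
      case (far _ e) _ = subst (_≤ℚ 1ℚ) (sym (trans (cong (_+ near ε (x + (- c + y))) e) (ℚP.+-identityˡ (near ε (x + (- c + y)))))) (near≤1 ε (x + (- c + y)))
      case (close _ _ _) (far _ e) = subst (_≤ℚ 1ℚ) (sym (trans (cong (near ε (x + (c + y)) +_) e) (ℚP.+-identityʳ (near ε (x + (c + y)))))) (near≤1 ε (x + (c + y)))
      case (close p _ _) (close _ p′ _) = ⊥-elim (ℚP.<-irrefl refl (ℚP.<-≤-trans (ℚP.*-monoʳ-<-pos (fromℕ 2) ε<c)
        (subst₂ _≤ℚ_ (sym (d₁ c x y)) (d₂ ε) (ℚP.+-mono-≤ p p′))))
    pair : Law q cs (λ y → near ε (x + (c + y))) + Law q cs (λ y → near ε (x + (- c + y))) ≤ℚ 1ℚ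
    pair = subst (_≤ℚ 1ℚ) (add (isL cs) (λ y → near ε (x + (c + y))) (λ y → near ε (x + (- c + y)))) (≤1 (isL cs) pointwise)

-- Each of the first h weights is added once, with a random sign. `Law-anticoncentration` arrives at
-- this sum when it counts the colliding elements.
shiftSum : ℕ → List ℚ → (ℚ → ℚ) → ℚ → ℚ
shiftSum zero    cs       g x = 0ℚ
shiftSum (suc h) []       g x = 0ℚ
shiftSum (suc h) (c ∷ cs) g x = ½ * (g (c + x) + g (- c + x)) + shiftSum h cs g x

shiftSum-shift : ∀ h cs g d x → shiftSum h cs g (d + x) ≡ shiftSum h cs (λ y → g (d + y)) x
shiftSum-shift zero    cs       g d x = refl
shiftSum-shift (suc h) []       g d x = refl
shiftSum-shift (suc h) (c ∷ cs) g d x = cong₂ _+_ (cong₂ (λ a b → ½ * (g a + g b)) (e c d x) (e (- c) d x)) (shiftSum-shift h cs g d x)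
  where
  e : ∀ c d x → c + (d + x) ≡ d + (c + x)
  e = solve-∀ ring

two^ : ℕ → ℚ
two^ = pow (fromℕ 2)

pow≥0 : ∀ {x} → 0ℚ ≤ℚ x → ∀ n → 0ℚ ≤ℚ pow x n
pow≥0 x≥0 zero    = 0≤1
pow≥0 x≥0 (suc n) = ≥0-* x≥0 (pow≥0 x≥0 n)

m≤two^m : ∀ m → fromℕ m ≤ℚ two^ m
m≤two^m m = ℚP.≤-trans (≤-byDiff 0≤1 (ℚP.+-comm 1ℚ (fromℕ m))) (go m)
  where
  e : ∀ m w → fromℕ 2 * w ≡ 1ℚ + (1ℚ + m) + ((w - (1ℚ + m)) + (w - (1ℚ + m)) + m)
  e = solve-∀ ring
  go : ∀ m → 1ℚ + fromℕ m ≤ℚ two^ m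
  go zero    = ℚP.≤-refl
  go (suc m) = subst (λ z → 1ℚ + z ≤ℚ two^ (suc m)) (sym (fromℕ-suc m))
    (≤-byDiff (≥0-+ (≥0-+ (≥0-sub (go m)) (≥0-sub (go m))) (fromℕ≥0 m)) (e (fromℕ m) (two^ m)))

-- With N the number of collisions among the first h elements, ℓ ≤ 2^(ℓ−N) + N pointwise.
-- The first term has expectation 2^ℓ(1−q/2)^h; in the second, a collision at j is traded for
-- a shift of the sum by ±c_j, at the price of the odds q/(1−q).
Law-anticoncentration : ∀ {q κ} → 0ℚ ≤ℚ q → q ≤ℚ 1ℚ → 0ℚ ≤ℚ κ → κ * (1ℚ - q) ≡ q →
  ∀ ℓ h cs → h ≤ List.length cs → ∀ (g : ℚ → ℚ) → (∀ x → 0ℚ ≤ℚ g x) → (∀ x → g x ≤ℚ 1ℚ) →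
  fromℕ ℓ * Law q cs g ≤ℚ two^ ℓ * pow (1ℚ - q * ½) h + κ * Law q cs (shiftSum h cs g)
Law-anticoncentration {q} {κ} q≥0 q≤1 κ≥0 κ≡ = go
  where
  isL = isExpect-Law q≥0 q≤1
  y : ℚ
  y = 1ℚ - q * ½
  y≥0 : 0ℚ ≤ℚ y
  y≥0 = subst (0ℚ ≤ℚ_) (e q) (≥0-+ (≥0-sub q≤1) (≥0-* (recip≥0 1) q≥0))
    where
    e : ∀ q → 1ℚ - q + ½ * q ≡ 1ℚ - q * ½
    e = solve-∀ ring
  q½≥0 : 0ℚ ≤ℚ q * ½
  q½≥0 = ≥0-* q≥0 (recip≥0 1)
  shiftSum≥0 : ∀ h cs g → (∀ x → 0ℚ ≤ℚ g x) → ∀ x → 0ℚ ≤ℚ shiftSum h cs g x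
  shiftSum≥0 zero    cs       g g≥0 x = ℚP.≤-refl
  shiftSum≥0 (suc h) []       g g≥0 x = ℚP.≤-refl
  shiftSum≥0 (suc h) (c ∷ cs) g g≥0 x = ≥0-+ (≥0-* (recip≥0 1) (≥0-+ (g≥0 (c + x)) (g≥0 (- c + x)))) (shiftSum≥0 h cs g g≥0 x)
  go : ∀ ℓ h cs → h ≤ List.length cs → ∀ (g : ℚ → ℚ) → (∀ x → 0ℚ ≤ℚ g x) → (∀ x → g x ≤ℚ 1ℚ) →
    fromℕ ℓ * Law q cs g ≤ℚ two^ ℓ * pow y h + κ * Law q cs (shiftSum h cs g)
  go zero h cs h≤ g g≥0 g≤1 = subst (_≤ℚ 1ℚ * pow y h + κ * Law q cs (shiftSum h cs g)) (sym (ℚP.*-zeroˡ (Law q cs g)))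
    (≥0-+ (≥0-* 0≤1 (pow≥0 y≥0 h)) (≥0-* κ≥0 (nonneg (isL cs) (shiftSum≥0 h cs g g≥0))))
  go (suc ℓ) zero cs h≤ g g≥0 g≤1 = ≤-byDiff (≥0-+ (≥0-+ (≥0-* (fromℕ≥0 (suc ℓ)) (≥0-sub (≤1 (isL cs) g≤1))) (≥0-sub (m≤two^m (suc ℓ))))
      (≥0-* κ≥0 (nonneg (isL cs) (λ _ → ℚP.≤-refl)))) (e (fromℕ (suc ℓ)) (Law q cs g) (two^ (suc ℓ)) (κ * Law q cs (λ _ → 0ℚ)))
    where
    e : ∀ l p w z → w * 1ℚ + z ≡ l * p + (l * (1ℚ - p) + (w - l) + z)
    e = solve-∀ ring
  -- An absent head keeps the level and a colliding head lowers it by one, and (1-q) 2^(ℓ+1) + q 2^ℓ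
  -- = 2^(ℓ+1)(1 - q/2). The unit given up on collision is paid by the head's own shift, restricted
  -- to the event that the head is absent; this is `trade`.
  go (suc ℓ) (suc h) (c ∷ cs) (s≤s h≤) g g≥0 g≤1 = subst₂ (λ lhs r → lhs * Law q (c ∷ cs) g ≤ℚ two^ (suc ℓ) * (y * pow y h) + κ * r) (sym (fromℕ-suc ℓ)) (sym total)
    (≤-byDiff (≥0-+ (≥0-+ (≥0-+ (≥0-* (≥0-sub q≤1) (≥0-sub ih₀)) (≥0-* q½≥0 (≥0-+ (≥0-sub (ih g₊ (λ x → g≥0 (c + x)) (λ x → g≤1 (c + x)))) (≥0-sub (ih g₋ (λ x → g≥0 (- c + x)) (λ x → g≤1 (- c + x)))))))
      (≥0-* (≥0-* κ≥0 q½≥0) (≥0-+ (nonneg (isL cs) (λ x → A≥0 (c + x))) (nonneg (isL cs) (λ x → A≥0 (- c + x)))))) (≥0-sub (ℚP.≤-reflexive trade)))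
      (cert q κ (fromℕ ℓ) (two^ ℓ) (pow y h) (L g) (L g₊) (L g₋) (L (shiftSum h cs g)) (L (shiftSum h cs g₊)) (L (shiftSum h cs g₋)) (L A) (L (λ x → A (c + x))) (L (λ x → A (- c + x)))))
    where
    L = Law q cs
    g₊ g₋ A : ℚ → ℚ
    g₊ x = g (c + x)
    g₋ x = g (- c + x)
    A x = ½ * (g₊ x + g₋ x)
    A≥0 : ∀ x → 0ℚ ≤ℚ A x
    A≥0 x = ≥0-* (recip≥0 1) (≥0-+ (g≥0 (c + x)) (g≥0 (- c + x)))
    ih₀ : (1ℚ + fromℕ ℓ) * L g ≤ℚ two^ (suc ℓ) * pow y h + κ * L (shiftSum h cs g)
    ih₀ = subst (λ z → z * L g ≤ℚ two^ (suc ℓ) * pow y h + κ * L (shiftSum h cs g)) (fromℕ-suc ℓ) (go (suc ℓ) h cs h≤ g g≥0 g≤1)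
    ih : ∀ g → (∀ x → 0ℚ ≤ℚ g x) → (∀ x → g x ≤ℚ 1ℚ) → fromℕ ℓ * L g ≤ℚ two^ ℓ * pow y h + κ * L (shiftSum h cs g)
    ih = go ℓ h cs h≤
    LA : L A ≡ ½ * (L g₊ + L g₋)
    LA = trans (scale (isL cs) ½ (λ x → g₊ x + g₋ x)) (cong (½ *_) (add (isL cs) g₊ g₋))
    trade : q * ½ * (L g₊ + L g₋) ≡ κ * (1ℚ - q) * L A
    trade = trans (ℚP.*-assoc q ½ (L g₊ + L g₋)) (cong₂ _*_ (sym κ≡) (sym LA))
    total : Law q (c ∷ cs) (shiftSum (suc h) (c ∷ cs) g) ≡
      (1ℚ - q) * (L A + L (shiftSum h cs g)) + q * ½ * ((L (λ x → A (c + x)) + L (shiftSum h cs g₊)) + (L (λ x → A (- c + x)) + L (shiftSum h cs g₋)))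
    total = cong₂ (λ a b → (1ℚ - q) * a + q * ½ * b) (add (isL cs) A (shiftSum h cs g))
      (cong₂ _+_ (branch c) (branch (- c)))
      where
      branch : ∀ d → L (λ x → A (d + x) + shiftSum h cs g (d + x)) ≡ L (λ x → A (d + x)) + L (shiftSum h cs (λ x → g (d + x)))
      branch d = trans (add (isL cs) (λ x → A (d + x)) (λ x → shiftSum h cs g (d + x))) (cong (L (λ x → A (d + x)) +_) (ext (isL cs) (shiftSum-shift h cs g d)))
    cert : ∀ q κ ℓ w p a b c S S₊ S₋ A A₊ A₋ → fromℕ 2 * w * ((1ℚ - q * ½) * p) + κ * ((1ℚ - q) * (A + S) + q * ½ * (A₊ + S₊ + (A₋ + S₋)))
      ≡ (1ℚ + ℓ) * ((1ℚ - q) * a + q * ½ * (b + c)) + ((1ℚ - q) * (fromℕ 2 * w * p + κ * S - (1ℚ + ℓ) * a)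
        + q * ½ * (w * p + κ * S₊ - ℓ * b + (w * p + κ * S₋ - ℓ * c)) + κ * (q * ½) * (A₊ + A₋) + (κ * (1ℚ - q) * A - q * ½ * (b + c)))
    cert = solve-∀ ring

-- The first h entries lie below v and decrease by steps of at least d.
data Spaced (d : ℚ) : ℕ → ℚ → List ℚ → Set where
  done : ∀ {v cs} → Spaced d 0 v cs
  _∷_  : ∀ {h v c cs} → c ≤ℚ v → Spaced d h (c - d) cs → Spaced d (suc h) v (c ∷ cs)

nearCount : ℚ → ℚ → ℕ → List ℚ → ℚ
nearCount ε z zero    cs       = 0ℚ
nearCount ε z (suc h) []       = 0ℚ
nearCount ε z (suc h) (c ∷ cs) = near ε (c - z) + nearCount ε z h cs

module _ {d ε : ℚ} (d≥0 : 0ℚ ≤ℚ d) (ε≥0 : 0ℚ ≤ℚ ε) (z : ℚ) where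

  private
    miss : ∀ h c cs → near ε (c - z) ≡ 0ℚ → d * nearCount ε z h cs ≡ d * nearCount ε z (suc h) (c ∷ cs)
    miss h c cs e = cong (d *_) (trans (sym (ℚP.+-identityˡ (nearCount ε z h cs))) (cong (_+ nearCount ε z h cs) (sym e)))

    hit : ∀ h c cs → near ε (c - z) ≡ 1ℚ → d + d * nearCount ε z h cs ≡ d * nearCount ε z (suc h) (c ∷ cs)
    hit h c cs e = trans (r d (nearCount ε z h cs)) (cong (λ x → d * (x + nearCount ε z h cs)) (sym e))
      where
      r : ∀ d n → d + d * n ≡ d * (1ℚ + n)
      r = solve-∀ ring

  -- The entries near z lie between z - ε and v, so at most (v - z + ε)/d + 1 of them exist. R is a
  -- free nonnegative bound because v - z + ε + d becomes negative once the entries have passed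
  -- below z - ε.
  spaced-below : ∀ {h v cs} → Spaced d h v cs → ∀ R → 0ℚ ≤ℚ R → v - z + ε + d ≤ℚ R → d * nearCount ε z h cs ≤ℚ R
  spaced-below done R R≥0 _ = subst (_≤ℚ R) (sym (ℚP.*-zeroʳ d)) R≥0
  spaced-below {suc h} {v} {c ∷ cs} (c≤v ∷ sp) R R≥0 v≤R = case (nearView ε (c - z))
    where
    r₁ : ∀ R c v z ε d → R ≡ c - d - z + ε + d + ((R - (v - z + ε + d)) + (v - c) + d)
    r₁ = solve-∀ ring
    r₂ : ∀ R c v z ε d → R - d ≡ c - d - z + ε + d + ((R - (v - z + ε + d)) + (v - c))
    r₂ = solve-∀ ring
    r₃ : ∀ R c v z ε d → R - d ≡ 0ℚ + ((R - (v - z + ε + d)) + (v - c) + (ε - - (c - z)))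
    r₃ = solve-∀ ring
    r₄ : ∀ R d → d + (R - d) ≡ R
    r₄ = solve-∀ ring
    case : NearView ε (c - z) → d * nearCount ε z (suc h) (c ∷ cs) ≤ℚ R
    case (far _ e) = subst (_≤ℚ R) (miss h c cs e) (spaced-below sp R R≥0
      (≤-byDiff (≥0-+ (≥0-+ (≥0-sub v≤R) (≥0-sub c≤v)) d≥0) (r₁ R c v z ε d)))
    case (close _ -c≤ e) = subst₂ _≤ℚ_ (hit h c cs e) (r₄ R d) (ℚP.+-monoʳ-≤ d (spaced-below sp (R - d)
      (≤-byDiff (≥0-+ (≥0-+ (≥0-sub v≤R) (≥0-sub c≤v)) (≥0-sub -c≤)) (r₃ R c v z ε d))
      (≤-byDiff (≥0-+ (≥0-sub v≤R) (≥0-sub c≤v)) (r₂ R c v z ε d))))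

  -- An interval of length 2ε holds at most 2ε/d + 1 points of spacing d. Entries above z + ε are
  -- skipped; the first hit contributes d, and `spaced-below` bounds the rest by 2ε.
  spaced-nearCount : ∀ {h v cs} → Spaced d h v cs → d * nearCount ε z h cs ≤ℚ fromℕ 2 * ε + d
  spaced-nearCount done = subst (_≤ℚ fromℕ 2 * ε + d) (sym (ℚP.*-zeroʳ d)) (≥0-+ (≥0-* (fromℕ≥0 2) ε≥0) d≥0)
  spaced-nearCount {suc h} {v} {c ∷ cs} (c≤v ∷ sp) = case (nearView ε (c - z))
    where
    r₁ : ∀ c z ε d → fromℕ 2 * ε ≡ c - d - z + ε + d + (ε - (c - z))
    r₁ = solve-∀ ring
    case : NearView ε (c - z) → d * nearCount ε z (suc h) (c ∷ cs) ≤ℚ fromℕ 2 * ε + d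
    case (far _ e) = subst (_≤ℚ fromℕ 2 * ε + d) (miss h c cs e) (spaced-nearCount sp)
    case (close c≤ _ e) = subst₂ _≤ℚ_ (hit h c cs e) (ℚP.+-comm d (fromℕ 2 * ε)) (ℚP.+-monoʳ-≤ d (spaced-below sp (fromℕ 2 * ε) (≥0-* (fromℕ≥0 2) ε≥0)
      (≤-byDiff (≥0-sub c≤) (r₁ c z ε d))))

shiftSum-nearCount : ∀ ε h cs x → shiftSum h cs (near ε) x ≡ ½ * (nearCount ε (- x) h cs + nearCount ε x h cs)
shiftSum-nearCount ε zero    cs       x = refl
shiftSum-nearCount ε (suc h) []       x = refl
shiftSum-nearCount ε (suc h) (c ∷ cs) x = trans
  (cong₂ (λ a b → ½ * a + b) (cong₂ _+_ (cong (near ε) (e₁ c x)) (trans (cong (near ε) (e₂ c x)) (near-neg ε (c - x)))) (shiftSum-nearCount ε h cs x))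
  (e₃ (near ε (c - - x)) (near ε (c - x)) (nearCount ε (- x) h cs) (nearCount ε x h cs))
  where
  e₁ : ∀ c x → c + x ≡ c - - x
  e₁ = solve-∀ ring
  e₂ : ∀ c x → - c + x ≡ - (c - x)
  e₂ = solve-∀ ring
  e₃ : ∀ a b n m → ½ * (a + b) + ½ * (n + m) ≡ ½ * (a + n + (b + m))
  e₃ = solve-∀ ring

spaced-shiftSum : ∀ {d ε h v cs} → 0ℚ ≤ℚ d → 0ℚ ≤ℚ ε → Spaced d h v cs → ∀ x → d * shiftSum h cs (near ε) x ≤ℚ fromℕ 2 * ε + d
spaced-shiftSum {d} {ε} {h} {v} {cs} d≥0 ε≥0 sp x = ≤-byDiff
  (≥0-* (recip≥0 1) (≥0-+ (≥0-sub (spaced-nearCount d≥0 ε≥0 (- x) sp)) (≥0-sub (spaced-nearCount d≥0 ε≥0 x sp))))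
  (trans (e d ε (nearCount ε (- x) h cs) (nearCount ε x h cs)) (cong (λ s → d * s + ½ * (fromℕ 2 * ε + d - d * nearCount ε (- x) h cs + (fromℕ 2 * ε + d - d * nearCount ε x h cs))) (sym (shiftSum-nearCount ε h cs x))))
  where
  e : ∀ d ε n m → fromℕ 2 * ε + d ≡ d * (½ * (n + m)) + ½ * (fromℕ 2 * ε + d - d * n + (fromℕ 2 * ε + d - d * m))
  e = solve-∀ ring

-- Zipfian weights and numerical bounds

recip : ℕ → ℚ
recip m = (ℤ.+ 1) ℚ./ suc m

recip>0 : ∀ m → 0ℚ < recip m
recip>0 m = ℚP.≰⇒> λ r≤0 → ℚP.<-irrefl refl (ℚP.<-≤-trans (ℚP.positive⁻¹ 1ℚ)
  (subst₂ _≤ℚ_ (suc*recip m) (ℚP.*-zeroʳ (fromℕ (suc m))) (*-monoʳ (fromℕ≥0 (suc m)) r≤0)))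

recip-antitone : ∀ {m n} → m ≤ n → recip n ≤ℚ recip m
recip-antitone {m} {n} m≤n = *-cancel-≤ (fromℕ>0 m) (subst₂ _≤ℚ_ refl (trans (suc*recip n) (sym (suc*recip m)))
  (*-monoˡ (recip≥0 n) (fromℕ-mono (s≤s m≤n))))

harmonic : ℕ → ℕ → List ℚ
harmonic a zero    = []
harmonic a (suc n) = recip a ∷ harmonic (suc a) n

harmonicOmit : ℕ → ℕ → ℕ → List ℚ
harmonicOmit a zero    i       = []
harmonicOmit a (suc n) zero    = harmonic (suc a) n
harmonicOmit a (suc n) (suc i) = recip a ∷ harmonicOmit (suc a) n i

tabulate-harmonic : ∀ a n (f : Fin n → ℚ) → (∀ j → f j ≡ recip (a ℕ.+ toℕ j)) → List.tabulate f ≡ harmonic a n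
tabulate-harmonic a zero    f h = refl
tabulate-harmonic a (suc n) f h = cong₂ _∷_ (trans (h Fin.zero) (cong recip (ℕP.+-identityʳ a)))
  (tabulate-harmonic (suc a) n (λ j → f (Fin.suc j)) (λ j → trans (h (Fin.suc j)) (cong recip (ℕP.+-suc a (toℕ j)))))

omit-harmonic : ∀ a n (f : Fin n → ℚ) i → (∀ j → f j ≡ recip (a ℕ.+ toℕ j)) → omit f i ≡ harmonicOmit a n (toℕ i)
omit-harmonic a (suc n) f Fin.zero    h = tabulate-harmonic (suc a) n (λ j → f (Fin.suc j)) (λ j → trans (h (Fin.suc j)) (cong recip (ℕP.+-suc a (toℕ j))))
omit-harmonic a (suc n) f (Fin.suc i) h = cong₂ _∷_ (trans (h Fin.zero) (cong recip (ℕP.+-identityʳ a)))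
  (omit-harmonic (suc a) n (λ j → f (Fin.suc j)) i (λ j → trans (h (Fin.suc j)) (cong recip (ℕP.+-suc a (toℕ j)))))

omit-zipf : ∀ n (i : Fin n) → omit zipf i ≡ harmonicOmit 0 n (toℕ i)
omit-zipf n i = omit-harmonic 0 n zipf i (λ j → refl)

harmonic-length : ∀ a n → List.length (harmonic a n) ≡ n
harmonic-length a zero    = refl
harmonic-length a (suc n) = cong suc (harmonic-length (suc a) n)

harmonicOmit-length : ∀ a {h n} i → h ℕ.< n → h ≤ List.length (harmonicOmit a n i)
harmonicOmit-length a {h} {suc n} zero (s≤s h≤n) = subst (h ≤_) (sym (harmonic-length (suc a) n)) h≤n
harmonicOmit-length a {zero}  {suc n} (suc i) _ = z≤n
harmonicOmit-length a {suc h} {suc n} (suc i) (s≤s h<n) = s≤s (harmonicOmit-length (suc a) i h<n)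

recip-dominated : ∀ {b a} → b ≤ a → fromℕ (suc b) * fromℕ (suc b) * (recip a * recip a) ≤ℚ 1ℚ
recip-dominated {b} {a} b≤a = subst (_≤ℚ 1ℚ) (e (fromℕ (suc b)) (recip a)) (*-mono r≥0 r≥0 r≤1 r≤1)
  where
  e : ∀ x y → x * y * (x * y) ≡ x * x * (y * y)
  e = solve-∀ ring
  r≥0 : 0ℚ ≤ℚ fromℕ (suc b) * recip a
  r≥0 = ≥0-* (fromℕ≥0 (suc b)) (recip≥0 a)
  r≤1 : fromℕ (suc b) * recip a ≤ℚ 1ℚ
  r≤1 = subst (fromℕ (suc b) * recip a ≤ℚ_) (suc*recip a) (*-monoˡ (recip≥0 a) (fromℕ-mono (s≤s b≤a)))

harmonic-dominated : ∀ {b} a n → b ≤ a → Dominated b (harmonic a n)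
harmonic-dominated a zero    b≤a = []
harmonic-dominated {b} a (suc n) b≤a = recip-dominated {b} {a} b≤a ∷ harmonic-dominated (suc a) n (s≤s b≤a)

-- Removing an entry only moves later, smaller entries forward, so each position keeps its bound.
harmonicOmit-dominated : ∀ a n i → Dominated a (harmonicOmit a n i)
harmonicOmit-dominated a zero    i       = []
harmonicOmit-dominated a (suc n) zero    = harmonic-dominated (suc a) n (ℕP.n≤1+n a)
harmonicOmit-dominated a (suc n) (suc i) = recip-dominated {a} {a} ℕP.≤-refl ∷ harmonicOmit-dominated (suc a) n i

module _ {ε : ℚ} {D : ℕ} (ε<D : ε < recip D) where

  private
    heavy : ∀ {a} → a ≤ D → ε < recip a
    heavy a≤D = ℚP.<-≤-trans ε<D (recip-antitone a≤D)

  harmonic-prefix : ∀ a {h n} → h ≤ n → a ℕ.+ h ≤ suc D → Prefix (ε <_) h (harmonic a n)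
  harmonic-prefix a z≤n       _ = done
  harmonic-prefix a {suc h} (s≤s h≤n) le = heavy (ℕP.≤-trans (ℕP.m≤m+n a h) (ℕP.≤-pred (subst (_≤ suc D) (ℕP.+-suc a h) le)))
    ∷ harmonic-prefix (suc a) h≤n (subst (_≤ suc D) (ℕP.+-suc a h) le)

  -- The hypotheses are one unit stricter than in `harmonic-prefix`: the omitted entry takes up one
  -- place.
  harmonicOmit-prefix : ∀ a {h n} i → h ℕ.< n → a ℕ.+ h ≤ D → Prefix (ε <_) h (harmonicOmit a n i)
  harmonicOmit-prefix a {h} {suc n} zero (s≤s h≤n) le = harmonic-prefix (suc a) h≤n (s≤s le)
  harmonicOmit-prefix a {zero}  {suc n} (suc i) _ le = done
  harmonicOmit-prefix a {suc h} {suc n} (suc i) (s≤s h<n) le = heavy (ℕP.≤-trans (ℕP.m≤m+n a (suc h)) le)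
    ∷ harmonicOmit-prefix (suc a) i h<n (subst (_≤ D) (ℕP.+-suc a h) le)

module _ (D : ℕ) where

  private
    d : ℚ
    d = recip D * recip D

    -- The gap 1/(a+1) - 1/(a+2) equals 1/((a+1)(a+2)), which is at least 1/(D+1)² in this range.
    step : ∀ a → suc a ≤ D → recip (suc a) ≤ℚ recip a - d
    step a le = ≤-byDiff (≥0-sub (*-mono (recip≥0 D) (recip≥0 D) (recip-antitone (ℕP.≤-trans (ℕP.n≤1+n a) le)) (recip-antitone le)))
      (trans (cong (_- d) gap) (e (recip (suc a)) (recip a * recip (suc a)) d))
      where
      e : ∀ x y d → x + y - d ≡ x + (y - d)
      e = solve-∀ ring
      gap : recip a ≡ recip (suc a) + recip a * recip (suc a)
      gap = begin
        recip a                                           ≡⟨ sym (ℚP.*-identityʳ (recip a)) ⟩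
        recip a * 1ℚ                                      ≡⟨ cong (recip a *_) (sym (suc*recip (suc a))) ⟩
        recip a * (fromℕ (suc (suc a)) * recip (suc a))   ≡⟨ cong (λ z → recip a * (z * recip (suc a))) (fromℕ-suc (suc a)) ⟩
        recip a * ((1ℚ + A) * recip (suc a))              ≡⟨ r (recip a) A (recip (suc a)) ⟩
        A * recip a * recip (suc a) + recip a * recip (suc a) ≡⟨ cong (λ z → z * recip (suc a) + recip a * recip (suc a)) (suc*recip a) ⟩
        1ℚ * recip (suc a) + recip a * recip (suc a)      ≡⟨ cong (_+ recip a * recip (suc a)) (ℚP.*-identityˡ (recip (suc a))) ⟩
        recip (suc a) + recip a * recip (suc a)           ∎
        where
        open ≡-Reasoning
        A = fromℕ (suc a)
        r : ∀ x A y → x * ((1ℚ + A) * y) ≡ A * x * y + x * y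
        r = solve-∀ ring

  harmonic-spaced : ∀ a {h n v} → h ≤ n → a ℕ.+ h ≤ suc D → (1 ≤ h → recip a ≤ℚ v) → Spaced d h v (harmonic a n)
  harmonic-spaced a z≤n               le v = done
  harmonic-spaced a {suc h} (s≤s h≤n) le v = v (s≤s z≤n)
    ∷ harmonic-spaced (suc a) h≤n le′ (λ 1≤h → step a (ℕP.≤-trans (ℕP.≤-trans (ℕP.≤-reflexive (ℕP.+-comm 1 a)) (ℕP.+-monoʳ-≤ a 1≤h)) (ℕP.≤-pred le′)))
    where
    le′ : suc (a ℕ.+ h) ≤ suc D
    le′ = subst (_≤ suc D) (ℕP.+-suc a h) le

  harmonicOmit-spaced : ∀ a {h n v} i → h ℕ.< n → a ℕ.+ h ≤ D → (1 ≤ h → recip a ≤ℚ v) → Spaced d h v (harmonicOmit a n i)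
  harmonicOmit-spaced a {h} {suc n} zero (s≤s h≤n) le v = harmonic-spaced (suc a) h≤n (s≤s le) (λ 1≤h → ℚP.≤-trans (recip-antitone (ℕP.n≤1+n a)) (v 1≤h))
  harmonicOmit-spaced a {zero}  {suc n} (suc i) _ le v = done
  harmonicOmit-spaced a {suc h} {suc n} (suc i) (s≤s h<n) le v = v (s≤s z≤n)
    ∷ harmonicOmit-spaced (suc a) i h<n le′ (λ _ → step a (ℕP.≤-trans (s≤s (ℕP.m≤m+n a h)) le′))
    where
    le′ : suc a ℕ.+ h ≤ D
    le′ = subst (_≤ D) (ℕP.+-suc a h) le

-- Powers, integer square roots and binary logarithms

pow-mono : ∀ {x y} → 0ℚ ≤ℚ x → x ≤ℚ y → ∀ n → pow x n ≤ℚ pow y n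
pow-mono x≥0 x≤y zero    = ℚP.≤-refl
pow-mono x≥0 x≤y (suc n) = *-mono x≥0 (pow≥0 x≥0 n) x≤y (pow-mono x≥0 x≤y n)

pow-+ : ∀ x m n → pow x (m ℕ.+ n) ≡ pow x m * pow x n
pow-+ x zero    n = sym (ℚP.*-identityˡ (pow x n))
pow-+ x (suc m) n = trans (cong (x *_) (pow-+ x m n)) (sym (ℚP.*-assoc x (pow x m) (pow x n)))

pow-pow : ∀ x m n → pow x (m *ℕ n) ≡ pow (pow x n) m
pow-pow x zero    n = refl
pow-pow x (suc m) n = trans (pow-+ x n (m *ℕ n)) (cong (pow x n *_) (pow-pow x m n))

pow-* : ∀ x y n → pow (x * y) n ≡ pow x n * pow y n
pow-* x y zero    = refl
pow-* x y (suc n) = trans (cong (x * y *_) (pow-* x y n)) (h x y (pow x n) (pow y n))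
  where
  h : ∀ x y a b → x * y * (a * b) ≡ x * a * (y * b)
  h = solve-∀ ring

pow-1 : ∀ n → pow 1ℚ n ≡ 1ℚ
pow-1 zero    = refl
pow-1 (suc n) = trans (ℚP.*-identityˡ (pow 1ℚ n)) (pow-1 n)

pow-antitone : ∀ {x m n} → 0ℚ ≤ℚ x → x ≤ℚ 1ℚ → m ≤ n → pow x n ≤ℚ pow x m
pow-antitone {x} {m} {n} x≥0 x≤1 m≤n = subst₂ _≤ℚ_ (trans (sym (pow-+ x m (n ℕ.∸ m))) (cong (pow x) (ℕP.m+[n∸m]≡n m≤n))) (ℚP.*-identityʳ (pow x m))
  (*-monoʳ (pow≥0 x≥0 m) (subst (pow x (n ℕ.∸ m) ≤ℚ_) (pow-1 (n ℕ.∸ m)) (pow-mono x≥0 x≤1 (n ℕ.∸ m))))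

-- By induction from (1-a)(1 + (n+1)a) ≤ 1 + na. It is the rational substitute for (1-a)^n ≤
-- exp(-na).
bernoulli : ∀ {a} → 0ℚ ≤ℚ a → a ≤ℚ 1ℚ → ∀ n → pow (1ℚ - a) n * (1ℚ + fromℕ n * a) ≤ℚ 1ℚ
bernoulli {a} a≥0 a≤1 zero    = ℚP.≤-reflexive (h a)
  where
  h : ∀ a → 1ℚ * (1ℚ + 0ℚ * a) ≡ 1ℚ
  h = solve-∀ ring
bernoulli {a} a≥0 a≤1 (suc n) = subst (λ z → (1ℚ - a) * w * (1ℚ + z * a) ≤ℚ 1ℚ) (sym (fromℕ-suc n))
  (≤-byDiff (≥0-+ (≥0-sub (bernoulli a≥0 a≤1 n)) (≥0-* (pow≥0 (≥0-sub a≤1) n) (≥0-* (≥0-+ 0≤1 (fromℕ≥0 n)) (≥0-² a)))) (e a (fromℕ n) w))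
  where
  w = pow (1ℚ - a) n
  e : ∀ a n w → 1ℚ ≡ (1ℚ - a) * w * (1ℚ + (1ℚ + n) * a) + (1ℚ - w * (1ℚ + n * a) + w * ((1ℚ + n) * (a * a)))
  e = solve-∀ ring

two^-ℕ : ∀ n → two^ n ≡ fromℕ (2 ℕ.^ n)
two^-ℕ zero    = refl
two^-ℕ (suc n) = trans (cong (fromℕ 2 *_) (two^-ℕ n)) (sym (fromℕ-* 2 (2 ℕ.^ n)))

sqrt-floor : ∀ k → Σ ℕ λ s → s *ℕ s ≤ k × k ℕ.< suc s *ℕ suc s
sqrt-floor zero    = 0 , z≤n , s≤s z≤n
sqrt-floor (suc k) with sqrt-floor k
... | s , s²≤k , k<[1+s]² with suc s *ℕ suc s ℕP.≤? suc k
...   | yes le = suc s , le , ℕP.<-≤-trans (s≤s k<[1+s]²) (ℕP.*-mono-< (ℕP.n<1+n (suc s)) (ℕP.n<1+n (suc s)))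
...   | no ¬le = s , ℕP.≤-trans s²≤k (ℕP.n≤1+n k) , ℕP.≰⇒> ¬le

-- A positive integer within a factor 2 of √k: with s + 1 the integer root, k < (s+2)² ≤ 4(s+1)².
-- The successor form keeps its reciprocal available as `recip s`.
sqrt-bounds : ∀ {k} → 1 ≤ k → Σ ℕ λ s → suc s *ℕ suc s ≤ k × k ≤ 4 *ℕ (suc s *ℕ suc s)
sqrt-bounds {k} 1≤k with sqrt-floor k
... | zero  , _ , k<1 = ⊥-elim (ℕP.<-irrefl refl (ℕP.≤-trans k<1 1≤k))
... | suc s , s²≤k , k<[2+s]² = s , s²≤k , ℕP.≤-trans (ℕP.<⇒≤ k<[2+s]²)
        (ℕP.≤-trans (ℕP.*-mono-≤ 2+s≤ 2+s≤) (ℕP.≤-reflexive (e (suc s))))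
  where
  e : ∀ s → 2 *ℕ s *ℕ (2 *ℕ s) ≡ 4 *ℕ (s *ℕ s)
  e s = trans (ℕP.*-assoc 2 s (2 *ℕ s)) (trans (cong (2 *ℕ_) (trans (sym (ℕP.*-assoc s 2 s)) (trans (cong (_*ℕ s) (ℕP.*-comm s 2)) (ℕP.*-assoc 2 s s)))) (sym (ℕP.*-assoc 2 2 (s *ℕ s))))
  2+s≤ : suc (suc s) ≤ 2 *ℕ suc s
  2+s≤ = subst (suc (suc s) ≤_) (cong suc (sym (trans (cong (s ℕ.+_) (ℕP.+-identityʳ (suc s))) (ℕP.+-suc s s)))) (s≤s (s≤s (ℕP.m≤m+n s s)))

≤2^⌈log₂⌉ : ∀ n → n ≤ 2 ℕ.^ ⌈log₂ n ⌉
≤2^⌈log₂⌉ = <-rec (λ n → n ≤ 2 ℕ.^ ⌈log₂ n ⌉) step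
  where
  step : ∀ n → (∀ {m} → m ℕ.< n → m ≤ 2 ℕ.^ ⌈log₂ m ⌉) → n ≤ 2 ℕ.^ ⌈log₂ n ⌉
  step zero          ih = z≤n
  step (suc zero)    ih = s≤s z≤n
  step n@(suc (suc p)) ih = ℕP.≤-trans double (subst (λ l → 2 *ℕ ℕ.⌈ n /2⌉ ≤ 2 ℕ.^ l) L≡ (ℕP.*-monoʳ-≤ 2 ih′))
    where
    L = ⌈log₂ n ⌉
    1≤L : 1 ≤ L
    1≤L = subst (_≤ L) (⌈log₂2^n⌉≡n 1) (⌈log₂⌉-mono-≤ {2} {n} (s≤s (s≤s z≤n)))
    L≡ : suc (L ℕ.∸ 1) ≡ L
    L≡ = ℕP.m+[n∸m]≡n 1≤L
    ih′ : ℕ.⌈ n /2⌉ ≤ 2 ℕ.^ (L ℕ.∸ 1)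
    ih′ = subst (λ l → ℕ.⌈ n /2⌉ ≤ 2 ℕ.^ l) (⌈log₂⌈n/2⌉⌉≡⌈log₂n⌉∸1 n) (ih (ℕP.⌈n/2⌉<n p))
    double : n ≤ 2 *ℕ ℕ.⌈ n /2⌉
    double = ℕP.≤-trans (ℕP.≤-reflexive (sym (ℕP.⌊n/2⌋+⌈n/2⌉≡n n)))
      (ℕP.≤-trans (ℕP.+-monoˡ-≤ ℕ.⌈ n /2⌉ (ℕP.⌊n/2⌋≤⌈n/2⌉ n)) (ℕP.≤-reflexive (cong (ℕ.⌈ n /2⌉ ℕ.+_) (sym (ℕP.+-identityʳ ℕ.⌈ n /2⌉)))))

1≤⌈log₂⌉ : ∀ {k} → 2 ≤ k → 1 ≤ ⌈log₂ k ⌉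
1≤⌈log₂⌉ {k} 2≤k = subst (_≤ ⌈log₂ k ⌉) (⌈log₂2^n⌉≡n 1) (⌈log₂⌉-mono-≤ 2≤k)

-- From 4j + 4 ≤ 2^j for j ≥ 5 the logarithm is at most j. Remainders run from 1 to 4 instead of 0
-- to 3 so that 4j is strictly below the number.
4*⌈log₂⌉< : ∀ j r → 5 ≤ j → 1 ≤ r → r ≤ 4 → 4 *ℕ ⌈log₂ 4 *ℕ j ℕ.+ r ⌉ ℕ.< 4 *ℕ j ℕ.+ r
4*⌈log₂⌉< j r 5≤j 1≤r r≤4 = ℕP.≤-<-trans (ℕP.*-monoʳ-≤ 4 L≤j) (subst (ℕ._≤ 4 *ℕ j ℕ.+ r) (ℕP.+-comm (4 *ℕ j) 1) (ℕP.+-monoʳ-≤ (4 *ℕ j) 1≤r))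
  where
  go : ∀ i → 4 *ℕ (5 ℕ.+ i) ℕ.+ 4 ≤ 2 ℕ.^ (5 ℕ.+ i)
  go zero    = ℕP.m≤m+n 24 8
  go (suc i) = ℕP.≤-trans (ℕP.≤-trans (ℕP.≤-reflexive (e i)) (ℕP.+-mono-≤ (go i) (ℕP.≤-trans (ℕP.≤-trans (ℕP.m≤m+n 4 20) (ℕP.+-monoˡ-≤ 4 (ℕP.*-monoʳ-≤ 4 (ℕP.m≤m+n 5 i)))) (go i))))
    (ℕP.≤-reflexive (cong (2 ℕ.^ (5 ℕ.+ i) ℕ.+_) (sym (ℕP.+-identityʳ (2 ℕ.^ (5 ℕ.+ i))))))
    where
    e : ∀ i → 4 *ℕ (5 ℕ.+ suc i) ℕ.+ 4 ≡ 4 *ℕ (5 ℕ.+ i) ℕ.+ 4 ℕ.+ 4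
    e i = cong (ℕ._+ 4) (trans (cong (4 *ℕ_) (ℕP.+-comm 1 (5 ℕ.+ i))) (ℕP.*-distribˡ-+ 4 (5 ℕ.+ i) 1))
  L≤j : ⌈log₂ 4 *ℕ j ℕ.+ r ⌉ ≤ j
  L≤j = subst (⌈log₂ 4 *ℕ j ℕ.+ r ⌉ ≤_) (⌈log₂2^n⌉≡n j) (⌈log₂⌉-mono-≤ (ℕP.≤-trans (ℕP.+-monoʳ-≤ (4 *ℕ j) r≤4)
    (subst (λ j → 4 *ℕ j ℕ.+ 4 ≤ 2 ℕ.^ j) (ℕP.m+[n∸m]≡n 5≤j) (go (j ℕ.∸ 5)))))

4*⌈log₂⌉<k : ∀ {k} → 24 ≤ k → 4 *ℕ ⌈log₂ k ⌉ ℕ.< k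
4*⌈log₂⌉<k {suc k} (s≤s 23≤k) = subst (λ z → 4 *ℕ ⌈log₂ z ⌉ ℕ.< z) (sym k≡)
  (4*⌈log₂⌉< (k ℕ./ 4) (suc (k % 4)) (/-monoˡ-≤ 4 (ℕP.≤-trans (ℕP.m≤m+n 20 3) 23≤k)) (s≤s z≤n) (m%n<n k 4))
  where
  k≡ : suc k ≡ 4 *ℕ (k ℕ./ 4) ℕ.+ suc (k % 4)
  k≡ = trans (cong suc (trans (m≡m%n+[m/n]*n k 4) (trans (ℕP.+-comm (k % 4) (k ℕ./ 4 *ℕ 4)) (cong (ℕ._+ k % 4) (ℕP.*-comm (k ℕ./ 4) 4)))))
    (sym (ℕP.+-suc (4 *ℕ (k ℕ./ 4)) (k % 4)))

-- The upper bound

div-bounds : ∀ a c → 0 ℕ.< c → Σ ℕ λ J → J *ℕ c ≤ a × a ≤ suc J *ℕ c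
div-bounds a c 0<c = a ℕ./ c , m/n*n≤m a c , ℕP.≤-trans (ℕP.≤-reflexive (m≡m%n+[m/n]*n a c)) (ℕP.+-monoˡ-≤ (a ℕ./ c *ℕ c) (ℕP.<⇒≤ (m%n<n a c)))
  where instance _ = ℕ.>-nonZero 0<c

sumFin-abs≤ : ∀ n (f : Fin n → ℚ) → (∀ j → ∣ f j ∣ ≤ℚ 1ℚ) → ∣ sumFin n f ∣ ≤ℚ fromℕ n
sumFin-abs≤ zero    f h = ℚP.≤-refl
sumFin-abs≤ (suc n) f h = ℚP.≤-trans (ℚP.∣p+q∣≤∣p∣+∣q∣ (f Fin.zero) (sumFin n (λ j → f (Fin.suc j))))
  (subst (∣ f Fin.zero ∣ + ∣ sumFin n (λ j → f (Fin.suc j)) ∣ ≤ℚ_) (sym (fromℕ-suc n)) (ℚP.+-mono-≤ (h Fin.zero) (sumFin-abs≤ n (λ j → f (Fin.suc j)) (λ j → h (Fin.suc j)))))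

abs-*≤1 : ∀ {x y} → ∣ x ∣ ≤ℚ 1ℚ → ∣ y ∣ ≤ℚ 1ℚ → ∣ x * y ∣ ≤ℚ 1ℚ
abs-*≤1 {x} {y} hx hy = subst (_≤ℚ 1ℚ) (sym (ℚP.∣p*q∣≡∣p∣*∣q∣ x y)) (*-mono (ℚP.0≤∣p∣ x) (ℚP.0≤∣p∣ y) hx hy)

abs-sgn : ∀ σ → ∣ sgn σ ∣ ≤ℚ 1ℚ
abs-sgn true  = ℚP.≤-refl
abs-sgn false = ℚP.≤-refl

abs-iv : ∀ {B} (a b : Fin B) → ∣ iv a b ∣ ≤ℚ 1ℚ
abs-iv a b with does (a ≟ᶠ b)
... | true  = ℚP.≤-refl
... | false = 0≤1

abs-recip : ∀ m → ∣ recip m ∣ ≤ℚ 1ℚ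
abs-recip m = subst (_≤ℚ 1ℚ) (sym (ℚP.0≤p⇒∣p∣≡p (recip≥0 m))) (recip≤1 m)

sumV-zero : ∀ {A : Set} {k} (φ : A → ℚ) → (∀ a → φ a ≡ 0ℚ) → (T : Vec A k) → sumV φ T ≡ 0ℚ
sumV-zero φ h []      = refl
sumV-zero φ h (a ∷ T) = trans (cong₂ _+_ (h a) (sumV-zero φ h T)) refl

module ZipfRows (m n : ℕ) (i : Fin n) {k : ℕ} (odd : k % 2 ≡ 1) (3≤k : 3 ≤ k) where

  b β : ℚ
  b = fromℕ (suc m)
  β = recip m

  β≥0 : 0ℚ ≤ℚ β
  β≥0 = recip≥0 m

  cs : List ℚ
  cs = omit zipf i

  isL = isExpect-Law β≥0 (recip≤1 m) cs

  symmetric : ∀ (g : ℚ → ℚ) → ERow m n (λ a → g (- (rowValue m i a - zipf i))) ≡ ERow m n (λ a → g (rowValue m i a - zipf i))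
  symmetric g = trans (row-law m n i (λ x → g (- x))) (trans (Law-sym β≥0 (recip≤1 m) cs g) (sym (row-law m n i g)))

  open Rows (isExpect-ERow m n) (rowValue m i) (zipf i) symmetric odd 3≤k public

  expErr≡meanError : expErr k n (suc m) i ≡ meanError
  expErr≡meanError = expErr-iid m k n i

  tail-law : ∀ t → tail t ≡ Law β cs (gt t)
  tail-law t = row-law m n i (gt t)

  two-tails : ∀ t → 0ℚ ≤ℚ t → Law β cs (λ x → gt t ∣ x ∣) ≡ fromℕ 2 * tail t
  two-tails t t≥0 = trans (two-sided β≥0 (recip≤1 m) t t≥0 cs) (cong (fromℕ 2 *_) (sym (tail-law t)))

  near-law : ∀ t → 0ℚ ≤ℚ t → Law β cs (near t) ≡ 1ℚ - fromℕ 2 * tail t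
  near-law t t≥0 = trans (ext isL (λ x → e (gt t ∣ x ∣))) (trans (expect-affine isL 1ℚ ((- 1ℚ , (λ x → gt t ∣ x ∣)) ∷ []))
    (trans (sym (e (Law β cs (λ x → gt t ∣ x ∣)))) (cong (λ z → 1ℚ - z) (two-tails t t≥0))))
    where
    e : ∀ x → 1ℚ - x ≡ 1ℚ + (- 1ℚ * x + 0ℚ)
    e = solve-∀ ring

  tail≥0 : ∀ t → 0ℚ ≤ℚ tail t
  tail≥0 t = nonneg (isExpect-ERow m n) (λ a → gt≥0 t (rowValue m i a - zipf i))

  errorTail≥0 : ∀ t → 0ℚ ≤ℚ errorTail t
  errorTail≥0 t = nonneg (isExpect-iid (isExpect-ERow m n) k) (λ T → gt≥0 t ∣ Z T ∣)

  2tail≤1 : ∀ t → 0ℚ ≤ℚ t → fromℕ 2 * tail t ≤ℚ 1ℚ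
  2tail≤1 t t≥0 = subst (_≤ℚ 1ℚ) (two-tails t t≥0) (≤1 isL (λ x → gt≤1 t ∣ x ∣))

  dominated : Dominated 0 cs
  dominated = subst (Dominated 0) (sym (omit-zipf n i)) (harmonicOmit-dominated 0 n (toℕ i))

  -- No row errs by more than n + 1, so no majority does. The crude bound serves only to make the
  -- number of layers finite.
  error-bounded : ∀ T → ∣ Z T ∣ ≤ℚ fromℕ (suc n)
  error-bounded T = ℚP.≮⇒≥ λ far → ℚP.<-irrefl refl (ℚP.<-≤-trans (ℚP.<-≤-trans (ℚP.positive⁻¹ 1ℚ) (ℚP.≤-reflexive (sym (gt-yes far))))
    (subst (gt bd ∣ Z T ∣ ≤ℚ_) (trans (cong₂ _+_ (trivial (λ a → gt bd (rowValue m i a - zipf i)) (λ a → gt-no (ℚP.≤-trans (x≤∣x∣ (rowValue m i a - zipf i)) (value-bounded a))))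
                                              (trivial (λ a → gt bd (- (rowValue m i a - zipf i))) (λ a → gt-no (ℚP.≤-trans (-x≤∣x∣ (rowValue m i a - zipf i)) (value-bounded a))))) refl)
      (error-split bd T)))
    where
    bd : ℚ
    bd = fromℕ (suc n)
    trivial : ∀ φ → (∀ a → φ a ≡ 0ℚ) → gt (fromℕ k) (fromℕ 2 * sumV φ T) ≡ 0ℚ
    trivial φ h = gt-no (subst (_≤ℚ fromℕ k) (sym (trans (cong (fromℕ 2 *_) (sumV-zero φ h T)) (ℚP.*-zeroʳ (fromℕ 2)))) (fromℕ≥0 k))
    value-bounded : ∀ a → ∣ rowValue m i a - zipf i ∣ ≤ℚ bd
    value-bounded (h , s) = ℚP.≤-trans (ℚP.∣p-q∣≤∣p∣+∣q∣ (rowValue m i (h , s)) (zipf i))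
      (subst (∣ rowValue m i (h , s) ∣ + ∣ zipf i ∣ ≤ℚ_) (trans (ℚP.+-comm (fromℕ n) 1ℚ) (sym (fromℕ-suc n)))
        (ℚP.+-mono-≤ row (abs-recip (toℕ i))))
      where
      total = sumFin n (λ j → iv (h j) (h i) * (sgn (s j) * zipf j))
      row : ∣ rowValue m i (h , s) ∣ ≤ℚ fromℕ n
      row = subst₂ _≤ℚ_ (sym (ℚP.∣p*q∣≡∣p∣*∣q∣ (sgn (s i)) total)) (ℚP.*-identityˡ (fromℕ n))
        (*-mono (ℚP.0≤∣p∣ (sgn (s i))) (ℚP.0≤∣p∣ total) (abs-sgn (s i))
          (sumFin-abs≤ n (λ j → iv (h j) (h i) * (sgn (s j) * zipf j)) (λ j → abs-*≤1 (abs-iv (h j) (h i)) (abs-*≤1 (abs-sgn (s j)) (abs-recip (toℕ j))))))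

module ZipfUpper (m n : ℕ) (i : Fin n) {k : ℕ} (odd : k % 2 ≡ 1) (3≤k : 3 ≤ k) (1≤m : 1 ≤ m)
  (s : ℕ) (s²≤k : suc s *ℕ suc s ≤ k) (k≤4s² : k ≤ 4 *ℕ (suc s *ℕ suc s)) where

  open ZipfRows m n i odd 3≤k

  -- `S` stands for √k, and `τ` = 1/(SB) is the target order of the error; thresholds are measured
  -- in units of `τ`.
  S σ τ K : ℚ
  S = fromℕ (suc s)
  σ = recip s
  τ = σ * β
  K = fromℕ k

  S>0 : 0ℚ < S
  S>0 = fromℕ>0 s

  S²≤K : S * S ≤ℚ K
  S²≤K = subst (_≤ℚ K) (fromℕ-* (suc s) (suc s)) (fromℕ-mono s²≤k)

  K≤4S² : K ≤ℚ fromℕ 4 * (S * S)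
  K≤4S² = subst (K ≤ℚ_) (trans (fromℕ-* 4 (suc s *ℕ suc s)) (cong (fromℕ 4 *_) (fromℕ-* (suc s) (suc s)))) (fromℕ-mono k≤4s²)

  τ>0 : 0ℚ < τ
  τ>0 = >0-* (recip>0 s) (recip>0 m)

  Sbτ : S * b * τ ≡ 1ℚ
  Sbτ = trans (e S b σ β) (trans (cong₂ _*_ (suc*recip s) (suc*recip m)) refl)
    where
    e : ∀ S b σ β → S * b * (σ * β) ≡ S * σ * (b * β)
    e = solve-∀ ring

  Sτ : S * τ ≡ β
  Sτ = trans (sym (ℚP.*-assoc S σ β)) (trans (cong (_* β) (suc*recip s)) (ℚP.*-identityˡ β))

  2β≤1 : fromℕ 2 * β ≤ℚ 1ℚ
  2β≤1 = subst (fromℕ 2 * β ≤ℚ_) (suc*recip m) (*-monoˡ β≥0 (fromℕ-mono (s≤s 1≤m)))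

  -- The factor 12 makes the bound 3·(2β)/t of `Law-tail` equal to 1/2 at t = 12β.
  halved-tail : Law (fromℕ 2 * β) (halve cs) (λ y → gt (fromℕ 12 * β) ∣ y ∣) ≤ℚ ½
  halved-tail = *-cancel-≤ (>0-* (fromℕ>0 11) (recip>0 m)) (subst (fromℕ 12 * β * Law (fromℕ 2 * β) (halve cs) (λ y → gt (fromℕ 12 * β) ∣ y ∣) ≤ℚ_) (e₁ β)
        (Law-tail (≥0-* (fromℕ≥0 2) β≥0) 2β≤1 (fromℕ 12 * β) (>0-* (fromℕ>0 11) (recip>0 m)) J (dominated-halve dominated)
          (subst₂ _≤ℚ_ (e₂ J) (suc*recip m) (*-monoˡ β≥0 (fromℕ-mono lo)))
          (subst₂ _≤ℚ_ (suc*recip m) (e₂ (suc J)) (*-monoˡ β≥0 (fromℕ-mono hi)))))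
    where
    D = div-bounds (suc m) 12 (s≤s z≤n)
    J = proj₁ D
    lo = proj₁ (proj₂ D)
    hi = proj₂ (proj₂ D)
    e₁ : ∀ β → fromℕ 3 * (fromℕ 2 * β) ≡ fromℕ 12 * β * ½
    e₁ = solve-∀ ring
    e₂ : ∀ J → fromℕ (J *ℕ 12) * β ≡ fromℕ J * (fromℕ 12 * β)
    e₂ J = trans (cong (_* β) (fromℕ-* J 12)) (ℚP.*-assoc (fromℕ J) (fromℕ 12) β)

  -- At the threshold cτ three bounds on P are available: order 1/c² for c ≤ S, order 1/(Sc) for c ≥
  -- S, and order S²/c² from pairs. The last two cross at c = S³, where both have order c^(-4/3).
  -- Hence cubes c = X³ and the uniform decay X^(-4), which leaves X³·X^(-4) = 1/X per layer.
  module Threshold (e c : ℕ) (c≡ : c ≡ suc e *ℕ suc e *ℕ suc e) where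

    X cX t q P δ : ℚ
    X = fromℕ (suc e)
    cX = fromℕ c
    t = cX * τ
    q = tail t
    P = errorTail t
    δ = ½ - q

    private
      cX≡ : cX ≡ X * X * X
      cX≡ = trans (cong fromℕ c≡) (trans (fromℕ-* (suc e *ℕ suc e) (suc e)) (cong (_* X) (fromℕ-* (suc e) (suc e))))

      0<c : 0 ℕ.< c
      0<c = subst (0 ℕ.<_) (sym c≡) (s≤s z≤n)

      cX>0 : 0ℚ < cX
      cX>0 = fromℕ-mono-< {0} {c} 0<c

      cX≥0 : 0ℚ ≤ℚ cX
      cX≥0 = ℚP.<⇒≤ cX>0

      X≥1 : 1ℚ ≤ℚ X
      X≥1 = fromℕ-mono {1} {suc e} (s≤s z≤n)

      t>0 : 0ℚ < t
      t>0 = >0-* cX>0 τ>0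

      t≥0 : 0ℚ ≤ℚ t
      t≥0 = ℚP.<⇒≤ t>0

      P≥0 : 0ℚ ≤ℚ P
      P≥0 = errorTail≥0 t

      δ≥0 : 0ℚ ≤ℚ δ
      δ≥0 = subst (0ℚ ≤ℚ_) (h q) (≥0-* (recip≥0 1) (≥0-sub (2tail≤1 t t≥0)))
        where
        h : ∀ q → ½ * (1ℚ - fromℕ 2 * q) ≡ ½ - q
        h = solve-∀ ring

      tail-bound : cX * (fromℕ 2 * q) ≤ℚ fromℕ 3 * S
      tail-bound = *-cancel-≤ τ>0 (subst₂ _≤ℚ_ (h₁ cX τ q) (trans (cong (fromℕ 3 *_) (sym Sτ)) (h₂ S τ))
            (subst (λ z → t * z ≤ℚ fromℕ 3 * β) (two-tails t t≥0)
              (Law-tail β≥0 (recip≤1 m) t t>0 J dominated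
                (subst₂ _≤ℚ_ (h₃ J) h₄ (*-monoˡ (ℚP.<⇒≤ τ>0) (fromℕ-mono lo)))
                (subst₂ _≤ℚ_ h₄ (h₃ (suc J)) (*-monoˡ (ℚP.<⇒≤ τ>0) (fromℕ-mono hi))))))
        where
        D = div-bounds (suc s *ℕ suc m) c 0<c
        J = proj₁ D
        lo = proj₁ (proj₂ D)
        hi = proj₂ (proj₂ D)
        h₁ : ∀ c t q → c * t * (fromℕ 2 * q) ≡ t * (c * (fromℕ 2 * q))
        h₁ = solve-∀ ring
        h₂ : ∀ S τ → fromℕ 3 * (S * τ) ≡ τ * (fromℕ 3 * S)
        h₂ = solve-∀ ring
        h₃ : ∀ J → fromℕ (J *ℕ c) * τ ≡ fromℕ J * (cX * τ)
        h₃ J = trans (cong (_* τ) (fromℕ-* J c)) (ℚP.*-assoc (fromℕ J) cX τ)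
        h₄ : fromℕ (suc s *ℕ suc m) * τ ≡ 1ℚ
        h₄ = trans (cong (_* τ) (fromℕ-* (suc s) (suc m))) Sbτ

      -- Bins of width t must cover [-12β, 12β] starting from -13β, any number beyond 12 being
      -- possible for the strict inequality in `covers`. The total width is 25β = 25Sτ.
      near-bound : ∀ N → 25 *ℕ suc s ≤ suc N *ℕ c → 1ℚ ≤ℚ fromℕ 8 * (fromℕ (suc N) * δ)
      near-bound N wide = subst (1ℚ ≤ℚ_) (trans (cong₂ _*_ (fromℕ-* 4 (suc N)) (near-law t t≥0)) (h (fromℕ (suc N)) q))
        (Law-near-lower β≥0 2β≤1 cs t (fromℕ 12 * β) (fromℕ 13 * β) t≥0
          (ℚP.*-monoˡ-<-pos β {{ℚ.positive (recip>0 m)}} (fromℕ-mono-< {12} {13} ℕP.≤-refl)) N width halved-tail)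
        where
        h : ∀ n q → fromℕ 4 * n * (1ℚ - fromℕ 2 * q) ≡ fromℕ 8 * (n * (½ - q))
        h = solve-∀ ring
        h₁ : ∀ S τ → fromℕ 25 * S * τ ≡ fromℕ 13 * (S * τ) + fromℕ 12 * (S * τ)
        h₁ = solve-∀ ring
        width : fromℕ 13 * β + fromℕ 12 * β ≤ℚ fromℕ (suc N) * t
        width = subst₂ _≤ℚ_
          (trans (cong (_* τ) (fromℕ-* 25 (suc s))) (trans (h₁ S τ) (cong₂ (λ x y → fromℕ 13 * x + fromℕ 12 * y) Sτ Sτ)))
          (trans (cong (_* τ) (fromℕ-* (suc N) c)) (ℚP.*-assoc (fromℕ (suc N)) cX τ))
          (*-monoˡ (ℚP.<⇒≤ τ>0) (fromℕ-mono wide))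

      chebyshev : K * (δ * δ) * P ≤ℚ fromℕ 2 * q
      chebyshev = errorTail-chebyshev t δ≥0

      X⁴≤cX² : X * X * X * X * P ≤ℚ cX * cX * P
      X⁴≤cX² = *-monoˡ P≥0 (subst (X * X * X * X ≤ℚ_) (cong₂ _*_ (sym cX≡) (sym cX≡))
        (≤-byDiff (≥0-* (≥0-* (≥0-² X) (≥0-² X)) (≥0-+ (≥0-* (fromℕ≥0 (suc e)) (≥0-sub X≥1)) (≥0-sub X≥1))) (h X)))
        where
        h : ∀ x → x * x * x * (x * x * x) ≡ x * x * x * x + x * x * (x * x) * (x * (x - 1ℚ) + (x - 1ℚ))
        h = solve-∀ ring

      -- At most 26S/c bins suffice, so c ≤ 208 Sδ with 208 = 8·26. Chebyshev then gives c²P ≤ 208²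
      -- Kδ²P ≤ 208²·2q, and 208² = 43264.
      small : c ≤ suc s → X * X * X * X * P ≤ℚ fromℕ 43264
      small c≤s = ℚP.≤-trans X⁴≤cX² (ℚP.≤-trans (*-monoˡ P≥0 (*-mono cX≥0 cX≥0 cX≤ cX≤))
            (≤-byDiff (≥0-+ (≥0-+ (≥0-* (≥0-* (fromℕ≥0 43264) (≥0-sub S²≤K)) (≥0-* (≥0-² δ) P≥0)) (≥0-* (fromℕ≥0 43264) (≥0-sub chebyshev)))
              (≥0-* (fromℕ≥0 43264) (≥0-sub (2tail≤1 t t≥0)))) (h S δ P K q)))
        where
        D = div-bounds (25 *ℕ suc s) c 0<c
        N = proj₁ D
        lo = proj₁ (proj₂ D)
        hi = proj₂ (proj₂ D)
        h : ∀ S δ P K q → fromℕ 43264 ≡ fromℕ 208 * (S * δ) * (fromℕ 208 * (S * δ)) * P + (fromℕ 43264 * (K - S * S) * (δ * δ * P) + fromℕ 43264 * (fromℕ 2 * q - K * (δ * δ) * P) + fromℕ 43264 * (1ℚ - fromℕ 2 * q))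
        h = solve-∀ ring
        h₁ : ∀ c n δ → c * (fromℕ 8 * (n * δ)) ≡ fromℕ 8 * (n * c * δ)
        h₁ = solve-∀ ring
        h₂ : ∀ S δ → fromℕ 8 * (fromℕ 26 * S * δ) ≡ fromℕ 208 * (S * δ)
        h₂ = solve-∀ ring
        width : suc N *ℕ c ≤ 26 *ℕ suc s
        width = ℕP.+-mono-≤ c≤s lo
        cX≤ : cX ≤ℚ fromℕ 208 * (S * δ)
        cX≤ = ℚP.≤-trans (subst₂ _≤ℚ_ (ℚP.*-identityʳ cX) (h₁ cX (fromℕ (suc N)) δ) (*-monoʳ cX≥0 (near-bound N hi)))
          (subst (fromℕ 8 * (fromℕ (suc N) * cX * δ) ≤ℚ_) (h₂ S δ) (*-monoʳ (fromℕ≥0 8) (*-monoˡ δ≥0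
            (subst₂ _≤ℚ_ (fromℕ-* (suc N) c) (fromℕ-* 26 (suc s)) (fromℕ-mono width)))))

      -- Here 26 bins suffice, so δ ≥ 1/208, and Chebyshev reads KP ≤ 208²·2q. Since q is of order
      -- S/c, the constant becomes 3·208² = 129792.
      large : suc s ≤ c → S * P * cX ≤ℚ fromℕ 129792
      large s≤c = *-cancel-≤ S>0 (≤-byDiff
            (≥0-+ (≥0-+ (≥0-* (≥0-sub S²≤K) (≥0-* P≥0 cX≥0)) (≥0-* (≥0-* (fromℕ≥0 k) (≥0-* P≥0 cX≥0)) (≥0-sub unit)))
              (≥0-* (fromℕ≥0 43264) (≥0-+ (≥0-* cX≥0 (≥0-sub chebyshev)) (≥0-sub tail-bound))))
            (h S P cX K δ q))
        where
        D = div-bounds (25 *ℕ suc s) c 0<c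
        N = proj₁ D
        lo = proj₁ (proj₂ D)
        hi = proj₂ (proj₂ D)
        h : ∀ S P c K δ q → S * fromℕ 129792 ≡ S * (S * P * c) + ((K - S * S) * (P * c) + K * (P * c) * (fromℕ 208 * δ * (fromℕ 208 * δ) - 1ℚ * 1ℚ)
          + fromℕ 43264 * (c * (fromℕ 2 * q - K * (δ * δ) * P) + (fromℕ 3 * S - c * (fromℕ 2 * q))))
        h = solve-∀ ring
        h₁ : ∀ δ → fromℕ 8 * (fromℕ 26 * δ) ≡ fromℕ 208 * δ
        h₁ = solve-∀ ring
        N≤25 : N ≤ 25
        N≤25 = ℕP.*-cancelʳ-≤ N 25 c {{ℕ.>-nonZero 0<c}} (ℕP.≤-trans lo (ℕP.*-monoʳ-≤ 25 s≤c))
        1≤208δ : 1ℚ ≤ℚ fromℕ 208 * δ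
        1≤208δ = ℚP.≤-trans (near-bound N hi) (subst (fromℕ 8 * (fromℕ (suc N) * δ) ≤ℚ_) (h₁ δ)
          (*-monoʳ (fromℕ≥0 8) (*-monoˡ δ≥0 (fromℕ-mono (s≤s N≤25)))))
        unit : 1ℚ * 1ℚ ≤ℚ fromℕ 208 * δ * (fromℕ 208 * δ)
        unit = *-mono 0≤1 0≤1 1≤208δ 1≤208δ

      middle : suc e ≤ suc s → suc s ≤ c → X * X * X * X * P ≤ℚ fromℕ 129792
      middle e≤s s≤c = ℚP.≤-trans (subst₂ _≤ℚ_ (h₁ X P) (h₂ S P (X * X * X)) (*-monoʳ (≥0-* P≥0 cX≥0′) (fromℕ-mono e≤s)))
        (subst (λ z → S * P * z ≤ℚ fromℕ 129792) cX≡ (large s≤c))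
        where
        cX≥0′ : 0ℚ ≤ℚ X * X * X
        cX≥0′ = subst (0ℚ ≤ℚ_) cX≡ cX≥0
        h₁ : ∀ x p → p * (x * x * x) * x ≡ x * x * x * x * p
        h₁ = solve-∀ ring
        h₂ : ∀ s p c → p * c * s ≡ s * p * c
        h₂ = solve-∀ ring

      -- The pair count gives c²P ≤ 4(2cq)² ≤ 36S² ≤ 36X², and c² = X⁶.
      far-out : suc s ≤ suc e → X * X * X * X * P ≤ℚ fromℕ 36
      far-out s≤e = *-cancel-≤ {X * X} (>0-* (fromℕ>0 e) (fromℕ>0 e)) (ℚP.≤-trans
        (subst (_≤ℚ fromℕ 36 * (S * S)) (trans (cong (λ z → z * z * P) cX≡) (h₁ X P)) (ℚP.≤-trans
          (*-monoʳ (≥0-² cX) (errorTail-pairs t))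
          (subst₂ _≤ℚ_ (h₂ cX q) (h₃ S) (*-monoʳ (fromℕ≥0 4) (*-mono q′≥0 q′≥0 tail-bound tail-bound)))))
        (subst (fromℕ 36 * (S * S) ≤ℚ_) (ℚP.*-comm (fromℕ 36) (X * X)) (*-monoʳ (fromℕ≥0 36) (*-mono (fromℕ≥0 (suc s)) (fromℕ≥0 (suc s)) (fromℕ-mono s≤e) (fromℕ-mono s≤e)))))
        where
        q′≥0 : 0ℚ ≤ℚ cX * (fromℕ 2 * q)
        q′≥0 = ≥0-* cX≥0 (≥0-* (fromℕ≥0 2) (tail≥0 t))
        h₁ : ∀ x p → x * x * x * (x * x * x) * p ≡ x * x * (x * x * x * x * p)
        h₁ = solve-∀ ring
        h₂ : ∀ c q → fromℕ 4 * (c * (fromℕ 2 * q) * (c * (fromℕ 2 * q))) ≡ c * c * (fromℕ 16 * (q * q))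
        h₂ = solve-∀ ring
        h₃ : ∀ s → fromℕ 4 * (fromℕ 3 * s * (fromℕ 3 * s)) ≡ fromℕ 36 * (s * s)
        h₃ = solve-∀ ring

    threshold-bound : X * X * X * X * P ≤ℚ fromℕ 129792
    threshold-bound = case (ℕP.≤-total c (suc s)) (ℕP.≤-total (suc e) (suc s))
      where
      case : c ≤ suc s ⊎ suc s ≤ c → suc e ≤ suc s ⊎ suc s ≤ suc e → X * X * X * X * P ≤ℚ fromℕ 129792
      case (inj₁ c≤s) _          = ℚP.≤-trans (small c≤s) (fromℕ-mono (ℕP.m≤m+n 43264 86528))
      case (inj₂ s≤c) (inj₁ e≤s) = middle e≤s s≤c
      case (inj₂ s≤c) (inj₂ s≤e) = ℚP.≤-trans (far-out s≤e) (fromℕ-mono (ℕP.m≤m+n 36 129756))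

  private
    pred2^ : ℕ → ℕ
    pred2^ j = ℕ.pred (2 ℕ.^ j)

    suc-pred2^ : ∀ j → suc (pred2^ j) ≡ 2 ℕ.^ j
    suc-pred2^ j = ℕP.suc-pred (2 ℕ.^ j) {{ℕP.m^n≢0 2 j}}

    level : ℕ → ℚ
    level j = two^ j * two^ j * two^ j * τ

    two≥0 : ∀ j → 0ℚ ≤ℚ two^ j
    two≥0 = pow≥0 (fromℕ≥0 2)

    level≥0 : ∀ j → 0ℚ ≤ℚ level j
    level≥0 j = ≥0-* (≥0-* (≥0-* (two≥0 j) (two≥0 j)) (two≥0 j)) (ℚP.<⇒≤ τ>0)

    C : ℚ
    C = fromℕ 129792

    level-bound : ∀ j → two^ j * two^ j * two^ j * two^ j * errorTail (level j) ≤ℚ C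
    level-bound j = subst₂ (λ x c → x * x * x * x * errorTail (c * τ) ≤ℚ C) X≡ c≡
      (Threshold.threshold-bound (pred2^ j) (suc (pred2^ j) *ℕ suc (pred2^ j) *ℕ suc (pred2^ j)) refl)
      where
      X≡ : fromℕ (suc (pred2^ j)) ≡ two^ j
      X≡ = trans (cong fromℕ (suc-pred2^ j)) (sym (two^-ℕ j))
      c≡ : fromℕ (suc (pred2^ j) *ℕ suc (pred2^ j) *ℕ suc (pred2^ j)) ≡ two^ j * two^ j * two^ j
      c≡ = trans (fromℕ-* (suc (pred2^ j) *ℕ suc (pred2^ j)) (suc (pred2^ j))) (cong₂ _*_ (trans (fromℕ-* (suc (pred2^ j)) (suc (pred2^ j))) (cong₂ _*_ X≡ X≡)) X≡)

    -- The j-th layer contributes O(2^(−j)) τ: the invariant is the partial geometric sum, cleared of denominators.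
    layers-bound : ∀ M → two^ M * layers level M (λ j → errorTail (level j)) ≤ℚ τ * ((1ℚ + fromℕ 16 * C) * two^ M - fromℕ 16 * C)
    layers-bound zero    = ℚP.≤-reflexive (h τ C)
      where
      h : ∀ τ C → 1ℚ * (1ℚ * 1ℚ * 1ℚ * τ) ≡ τ * ((1ℚ + fromℕ 16 * C) * 1ℚ - fromℕ 16 * C)
      h = solve-∀ ring
    layers-bound (suc M) = ≤-byDiff (≥0-+ (≥0-* (fromℕ≥0 2) (≥0-sub (layers-bound M))) (≥0-* (≥0-* (fromℕ≥0 16) (ℚP.<⇒≤ τ>0)) (≥0-sub (level-bound M))))
      (h τ C (two^ M) (layers level M (λ j → errorTail (level j))) (errorTail (level M)))
      where
      h : ∀ τ C x l p → τ * ((1ℚ + fromℕ 16 * C) * (fromℕ 2 * x) - fromℕ 16 * C)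
        ≡ fromℕ 2 * x * (l + fromℕ 2 * x * (fromℕ 2 * x) * (fromℕ 2 * x) * τ * p) + (fromℕ 2 * (τ * ((1ℚ + fromℕ 16 * C) * x - fromℕ 16 * C) - x * l) + fromℕ 16 * τ * (C - x * x * x * x * p))
      h = solve-∀ ring

    -- Since τ = 1/(SB), already 2^M₀ τ exceeds the deterministic bound n + 1. The number of layers
    -- does not enter the final constant.
    M₀ : ℕ
    M₀ = suc n *ℕ (suc s *ℕ suc m)

    reaches : fromℕ (suc n) ≤ℚ level M₀
    reaches = subst (_≤ℚ level M₀) cancel (*-monoˡ (ℚP.<⇒≤ τ>0) (ℚP.≤-trans (m≤two^m M₀)
      (≤-byDiff (≥0-* (two≥0 M₀) (≥0-+ (≥0-* (two≥0 M₀) (≥0-sub two≥1)) (≥0-sub two≥1))) (h (two^ M₀)))))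
      where
      h : ∀ x → x * x * x ≡ x + x * (x * (x - 1ℚ) + (x - 1ℚ))
      h = solve-∀ ring
      two≥1 : 1ℚ ≤ℚ two^ M₀
      two≥1 = ℚP.≤-trans (fromℕ-mono {1} {M₀} (s≤s z≤n)) (m≤two^m M₀)
      cancel : fromℕ M₀ * τ ≡ fromℕ (suc n)
      cancel = trans (cong (_* τ) (trans (fromℕ-* (suc n) (suc s *ℕ suc m)) (cong (fromℕ (suc n) *_) (fromℕ-* (suc s) (suc m)))))
        (trans (ℚP.*-assoc (fromℕ (suc n)) (S * b) τ) (trans (cong (fromℕ (suc n) *_) Sbτ) (ℚP.*-identityʳ (fromℕ (suc n)))))

    -- The summand 1 is the lowest threshold. Layer j costs at most 8^(j+1) τ C/16^j = 8Cτ/2^j, and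
    -- these costs sum to at most 16Cτ.
    meanError≤ : meanError ≤ℚ τ * (1ℚ + fromℕ 16 * C)
    meanError≤ = ℚP.≤-trans (meanError-layers level level≥0 M₀ (λ T → ℚP.≤-trans (error-bounded T) reaches))
      (*-cancel-≤ {two^ M₀} two>0 (ℚP.≤-trans (layers-bound M₀) (≤-byDiff (≥0-* (ℚP.<⇒≤ τ>0) (≥0-* (fromℕ≥0 16) (fromℕ≥0 129792))) (h τ C (two^ M₀)))))
      where
      h : ∀ τ C x → x * (τ * (1ℚ + fromℕ 16 * C)) ≡ τ * ((1ℚ + fromℕ 16 * C) * x - fromℕ 16 * C) + τ * (fromℕ 16 * C)
      h = solve-∀ ring
      two>0 : 0ℚ < two^ M₀
      two>0 = ℚP.<-≤-trans (fromℕ-mono-< {0} {M₀} (s≤s z≤n)) (m≤two^m M₀)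

    meanError≥0 : 0ℚ ≤ℚ meanError
    meanError≥0 = nonneg (isExpect-iid (isExpect-ERow m n) k) (λ T → ℚP.0≤∣p∣ (Z T))

  -- The constant is 2(1 + 16·129792); the factor 2 comes from K ≤ 4S².
  upper : (expErr k n (suc m) i * b) * (expErr k n (suc m) i * b) * K ≤ℚ fromℕ 4153346 * fromℕ 4153346
  upper = subst (λ E → E * b * (E * b) * K ≤ℚ fromℕ 4153346 * fromℕ 4153346) (sym expErr≡meanError)
    (ℚP.≤-trans (*-monoʳ (≥0-² (E * b)) K≤4S²) (subst₂ _≤ℚ_ (h₁ E b S) h₂ (*-mono EbS≥0 EbS≥0 EbS≤ EbS≤)))
    where
    E : ℚ
    E = meanError
    h₁ : ∀ E b S → fromℕ 2 * (E * b * S) * (fromℕ 2 * (E * b * S)) ≡ E * b * (E * b) * (fromℕ 4 * (S * S))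
    h₁ = solve-∀ ring
    h₂ : fromℕ 2 * (1ℚ + fromℕ 16 * C) * (fromℕ 2 * (1ℚ + fromℕ 16 * C)) ≡ fromℕ 4153346 * fromℕ 4153346
    h₂ = refl
    h₃ : ∀ S b τ D → S * b * τ * D ≡ τ * D * b * S
    h₃ = solve-∀ ring
    EbS≥0 : 0ℚ ≤ℚ fromℕ 2 * (E * b * S)
    EbS≥0 = ≥0-* (fromℕ≥0 2) (≥0-* (≥0-* meanError≥0 (fromℕ≥0 (suc m))) (fromℕ≥0 (suc s)))
    EbS≤ : fromℕ 2 * (E * b * S) ≤ℚ fromℕ 2 * (1ℚ + fromℕ 16 * C)
    EbS≤ = *-monoʳ (fromℕ≥0 2) (subst (E * b * S ≤ℚ_) (trans (sym (h₃ S b τ (1ℚ + fromℕ 16 * C))) (trans (cong (_* (1ℚ + fromℕ 16 * C)) Sbτ) (ℚP.*-identityˡ (1ℚ + fromℕ 16 * C))))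
      (*-monoˡ (fromℕ≥0 (suc s)) (*-monoˡ (fromℕ≥0 (suc m)) meanError≤)))

-- The lower bound

module ZipfLower (m n : ℕ) (i : Fin n) {k : ℕ} (odd : k % 2 ≡ 1) (3≤k : 3 ≤ k) (k≤B : k ≤ suc m) (wide : k *ℕ suc m ≤ n) where

  open ZipfRows m n i odd 3≤k

  private
    K E : ℚ
    K = fromℕ k
    E = meanError

    bβ : b * β ≡ 1ℚ
    bβ = suc*recip m

    K≥1 : 1ℚ ≤ℚ K
    K≥1 = fromℕ-mono {1} {k} (ℕP.≤-trans (s≤s z≤n) 3≤k)

  -- With ε = 1/(2B), the first B - 1 weights other than that of i exceed ε. Since β ≤ 1/3,
  -- `bernoulli` gives (1-β)^(B-1) ≤ 1/(2-β) ≤ 3/5. Hence P(|X| ≤ ε) ≤ 4/5, and each row exceeds ε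
  -- upwards with probability at least 1/10.
  few-rows : ∀ ρ → ρ ≤ℚ pow (recip 9) k → ½ * ρ ≤ℚ E * b
  few-rows ρ ρ≤ = ℚP.≤-trans (*-monoʳ (recip≥0 1) (ℚP.≤-trans ρ≤ (ℚP.≤-trans (pow-mono (recip≥0 9) q≥ k) product)))
    (subst (_≤ℚ E * b) (trans (h₁ β (errorTail ε) b) (trans (cong (λ z → ½ * errorTail ε * z) bβ) (ℚP.*-identityʳ (½ * errorTail ε))))
      (*-monoˡ (fromℕ≥0 (suc m)) (meanError-markov ε ε≥0)))
    where
    ε q w : ℚ
    ε = ½ * β
    q = tail ε
    w = pow (1ℚ - β) m
    ε≥0 : 0ℚ ≤ℚ ε
    ε≥0 = ≥0-* (recip≥0 1) β≥0
    h₁ : ∀ β p b → ½ * β * p * b ≡ ½ * p * (b * β)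
    h₁ = solve-∀ ring
    product : pow q k ≤ℚ errorTail ε
    product = errorTail-product (isExpect-ERow m n) (rowValue m i) (zipf i) symmetric odd 3≤k ε ε≥0
    ε<β : ε < recip m
    ε<β = subst (ε <_) (ℚP.*-identityˡ β) (ℚP.*-monoˡ-<-pos β {{ℚ.positive (recip>0 m)}} (ℚP.*-cancelˡ-<-nonNeg (fromℕ 2) (fromℕ-mono-< {1} {2} ℕP.≤-refl)))
    m<n : m ℕ.< n
    m<n = ℕP.≤-trans (ℕP.m≤n*m (suc m) k {{ℕ.>-nonZero (ℕP.≤-trans (s≤s z≤n) 3≤k)}}) wide
    heavy : Law β cs (near ε) ≤ℚ ½ + ½ * w
    heavy = subst (_≤ℚ ½ + ½ * w) (ext isL (λ y → cong (near ε) (ℚP.+-identityˡ y)))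
      (Law-near-heavy β≥0 (recip≤1 m) ε (subst (Prefix (ε <_) m) (sym (omit-zipf n i)) (harmonicOmit-prefix ε<β 0 (toℕ i) m<n ℕP.≤-refl)) 0ℚ)
    3β≤1 : fromℕ 3 * β ≤ℚ 1ℚ
    3β≤1 = subst (fromℕ 3 * β ≤ℚ_) bβ (*-monoˡ β≥0 (fromℕ-mono (ℕP.≤-trans 3≤k k≤B)))
    w-bound : w * (fromℕ 2 - β) ≤ℚ 1ℚ
    w-bound = subst (λ z → w * z ≤ℚ 1ℚ) (trans (h (fromℕ m) β) (trans (cong (λ z → 1ℚ + (z * β - β)) (sym (fromℕ-suc m)))
      (trans (cong (λ z → 1ℚ + (z - β)) bβ) (h′ β)))) (bernoulli β≥0 (recip≤1 m) m)
      where
      h : ∀ M β → 1ℚ + M * β ≡ 1ℚ + ((1ℚ + M) * β - β)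
      h = solve-∀ ring
      h′ : ∀ β → 1ℚ + (1ℚ - β) ≡ fromℕ 2 - β
      h′ = solve-∀ ring
    w≥0 : 0ℚ ≤ℚ w
    w≥0 = pow≥0 (≥0-sub (recip≤1 m)) m
    q≥ : recip 9 ≤ℚ q
    q≥ = ≤-byDiff (≥0-* (recip≥0 1) (≥0-+ (≥0-sub near≤) (≥0-* (recip≥0 1) (≥0-* (≥0-* (fromℕ≥0 3) (recip≥0 4)) (≥0-+ (≥0-sub w-bound) (≥0-* (≥0-* w≥0 (recip≥0 2)) (≥0-sub 3β≤1))))))) (h q w β)
      where
      near≤ : 1ℚ - fromℕ 2 * q ≤ℚ ½ + ½ * w
      near≤ = subst (_≤ℚ ½ + ½ * w) (near-law ε ε≥0) heavy
      h : ∀ q w β → q ≡ recip 9 + ½ * (½ + ½ * w - (1ℚ - fromℕ 2 * q) + ½ * (fromℕ 3 * recip 4 * (1ℚ - w * (fromℕ 2 - β) + w * recip 2 * (1ℚ - fromℕ 3 * β))))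
      h = solve-∀ ring

  module ManyRows (l : ℕ) (4L<k : 4 *ℕ suc l ℕ.< k) (k≤2^L : k ≤ 2 ℕ.^ suc l)
    (s : ℕ) (s²≤k : suc s *ℕ suc s ≤ k) (k≤4s² : k ≤ 4 *ℕ (suc s *ℕ suc s)) (48≤s : 48 ≤ suc s) (m′ : ℕ) (m≡ : m ≡ suc m′) where

    private
      h : ℕ
      h = suc l *ℕ (4 *ℕ suc m)
      Λ λ′ S σ H d ε κ y p q M : ℚ
      Λ = fromℕ (suc l)
      λ′ = recip l
      S = fromℕ (suc s)
      σ = recip s
      H = fromℕ (suc h)
      d = recip h * recip h
      ε = recip 4095 * (σ * λ′ * β)
      κ = recip m′
      y = 1ℚ - β * ½
      p = Law β cs (near ε)
      q = tail ε
      M = fromℕ m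

      S²≤K : S * S ≤ℚ K
      S²≤K = subst (_≤ℚ K) (fromℕ-* (suc s) (suc s)) (fromℕ-mono s²≤k)
      K≤4S² : K ≤ℚ fromℕ 4 * (S * S)
      K≤4S² = subst (K ≤ℚ_) (trans (fromℕ-* 4 (suc s *ℕ suc s)) (cong (fromℕ 4 *_) (fromℕ-* (suc s) (suc s)))) (fromℕ-mono k≤4s²)
      S≥48 : fromℕ 48 ≤ℚ S
      S≥48 = fromℕ-mono 48≤s
      S≥0 : 0ℚ ≤ℚ S
      S≥0 = fromℕ≥0 (suc s)
      Λ≥1 : 1ℚ ≤ℚ Λ
      Λ≥1 = fromℕ-mono {1} {suc l} (s≤s z≤n)

      ε≥0 : 0ℚ ≤ℚ ε
      ε≥0 = ≥0-* (recip≥0 4095) (≥0-* (≥0-* (recip≥0 s) (recip≥0 l)) β≥0)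

      κ≥0 : 0ℚ ≤ℚ κ
      κ≥0 = recip≥0 m′

      b≡ : b ≡ 1ℚ + M
      b≡ = fromℕ-suc m

      κM : M * κ ≡ 1ℚ
      κM = trans (cong (λ z → fromℕ z * κ) m≡) (suc*recip m′)

      odds : κ * (1ℚ - β) ≡ β
      odds = begin
        κ * (1ℚ - β)           ≡⟨ cong (λ z → κ * (z - β)) (sym bβ) ⟩
        κ * (b * β - β)        ≡⟨ cong (λ z → κ * (z * β - β)) b≡ ⟩
        κ * ((1ℚ + M) * β - β) ≡⟨ r κ M β ⟩
        M * κ * β              ≡⟨ cong (_* β) κM ⟩
        1ℚ * β                 ≡⟨ ℚP.*-identityˡ β ⟩
        β                      ∎
        where
        open ≡-Reasoning
        r : ∀ κ M β → κ * ((1ℚ + M) * β - β) ≡ M * κ * β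
        r = solve-∀ ring

      κ≤2β : κ ≤ℚ fromℕ 2 * β
      κ≤2β = ≤-byDiff (≥0-+ (≥0-* β≥0 (≥0-sub (recip≤1 m′))) (≥0-sub (ℚP.≤-reflexive odds))) (r κ β)
        where
        r : ∀ κ β → fromℕ 2 * β ≡ κ + (β * (1ℚ - κ) + (β - κ * (1ℚ - β)))
        r = solve-∀ ring

      h<n : h ℕ.< n
      h<n = ℕP.<-≤-trans (subst (ℕ._< k *ℕ suc m) (trans (cong (_*ℕ suc m) (ℕP.*-comm 4 (suc l))) (ℕP.*-assoc (suc l) 4 (suc m))) (ℕP.*-monoˡ-< (suc m) 4L<k)) wide

      cs≡ : cs ≡ harmonicOmit 0 n (toℕ i)
      cs≡ = omit-zipf n i

      long : h ≤ List.length cs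
      long = subst (λ xs → h ≤ List.length xs) (sym cs≡) (harmonicOmit-length 0 (toℕ i) h<n)

      spaced : Spaced d h (recip 0) cs
      spaced = subst (Spaced d h (recip 0)) (sym cs≡) (harmonicOmit-spaced h 0 (toℕ i) h<n ℕP.≤-refl (λ _ → ℚP.≤-refl))

      d≥0 : 0ℚ ≤ℚ d
      d≥0 = ≥0-² (recip h)

      shifts : ℚ
      shifts = Law β cs (shiftSum h cs (near ε))

      d*shifts : d * shifts ≤ℚ fromℕ 2 * ε + d
      d*shifts = subst₂ _≤ℚ_ (scale isL d (shiftSum h cs (near ε))) (const isL (fromℕ 2 * ε + d))
        (mono isL (spaced-shiftSum d≥0 ε≥0 spaced))

      H²d : H * H * d ≡ 1ℚ
      H²d = trans (r H (recip h)) (trans (cong₂ _*_ (suc*recip h) (suc*recip h)) refl)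
        where
        r : ∀ H x → H * H * (x * x) ≡ H * x * (H * x)
        r = solve-∀ ring

      H≤ : H ≤ℚ fromℕ 8 * (Λ * b)
      H≤ = subst (H ≤ℚ_) (trans (fromℕ-* 2 h) (trans (cong (fromℕ 2 *_) (trans (fromℕ-* (suc l) (4 *ℕ suc m)) (cong (Λ *_) (fromℕ-* 4 (suc m))))) (r Λ b)))
        (fromℕ-mono {suc h} {2 *ℕ h} (ℕP.≤-trans (ℕP.+-monoˡ-≤ h 1≤h) (ℕP.≤-reflexive (cong (h ℕ.+_) (sym (ℕP.+-identityʳ h))))))
        where
        1≤h : 1 ≤ h
        1≤h = s≤s z≤n
        r : ∀ Λ b → fromℕ 2 * (Λ * (fromℕ 4 * b)) ≡ fromℕ 8 * (Λ * b)
        r = solve-∀ ring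

      -- At most 1 + 2εH² weights hit a given window, and H ≤ 8ΛB. The factor 1/4096 in ε turns
      -- 2·64·Λ²B²ε into ΛB/(32S).
      shifts≤ : shifts ≤ℚ 1ℚ + recip 31 * (σ * Λ * b)
      shifts≤ = ℚP.≤-trans (subst₂ _≤ℚ_ (trans (sym (ℚP.*-assoc (H * H) d shifts)) (trans (cong (_* shifts) H²d) (ℚP.*-identityˡ shifts)))
          (trans (ℚP.*-distribˡ-+ (H * H) (fromℕ 2 * ε) d) (cong (H * H * (fromℕ 2 * ε) +_) H²d)) (*-monoʳ (≥0-² H) d*shifts))
        (subst₂ _≤ℚ_ (ℚP.+-comm 1ℚ (H * H * (fromℕ 2 * ε))) (cong (1ℚ +_) cancel)
          (ℚP.+-monoʳ-≤ 1ℚ (*-monoˡ (≥0-* (fromℕ≥0 2) ε≥0) (*-mono (fromℕ≥0 (suc h)) (fromℕ≥0 (suc h)) H≤ H≤))))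
        where
        r : ∀ Λ b σ λ′ β → fromℕ 8 * (Λ * b) * (fromℕ 8 * (Λ * b)) * (fromℕ 2 * (recip 4095 * (σ * λ′ * β))) ≡ recip 31 * (σ * Λ * b) * (Λ * λ′ * (b * β))
        r = solve-∀ ring
        cancel : fromℕ 8 * (Λ * b) * (fromℕ 8 * (Λ * b)) * (fromℕ 2 * ε) ≡ recip 31 * (σ * Λ * b)
        cancel = trans (r Λ b σ λ′ β) (trans (cong₂ (λ x z → recip 31 * (σ * Λ * b) * (x * z)) (suc*recip l) bβ) (ℚP.*-identityʳ (recip 31 * (σ * Λ * b))))

      y≥0 : 0ℚ ≤ℚ y
      y≥0 = subst (0ℚ ≤ℚ_) (r β) (≥0-+ (≥0-sub (recip≤1 m)) (≥0-* (recip≥0 1) β≥0))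
        where
        r : ∀ β → 1ℚ - β + ½ * β ≡ 1ℚ - β * ½
        r = solve-∀ ring

      yB : pow y (suc m) ≤ℚ fromℕ 2 * recip 2
      yB = ≤-byDiff (≥0-* (≥0-* (fromℕ≥0 2) (recip≥0 2)) (≥0-sub bern)) (r (pow y (suc m)))
        where
        e : ∀ b β → 1ℚ + b * (β * ½) ≡ 1ℚ + ½ * (b * β)
        e = solve-∀ ring
        r : ∀ w → fromℕ 2 * recip 2 ≡ w + fromℕ 2 * recip 2 * (1ℚ - w * (1ℚ + ½ * 1ℚ))
        r = solve-∀ ring
        bern : pow y (suc m) * (1ℚ + ½ * 1ℚ) ≤ℚ 1ℚ
        bern = subst (λ z → pow y (suc m) * z ≤ℚ 1ℚ) (trans (e b β) (cong (λ z → 1ℚ + ½ * z) bβ))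
          (bernoulli (≥0-* β≥0 (recip≥0 1)) (ℚP.≤-trans (subst (β * ½ ≤ℚ_) (ℚP.*-identityʳ β) (*-monoʳ β≥0 (≥½))) (recip≤1 m)) (suc m))
          where
          ≥½ : ½ ≤ℚ 1ℚ
          ≥½ = recip≤1 1

      -- This fixes the factor 4 in `h`: (1-β/2)^B ≤ 2/3 by Bernoulli and 2(2/3)⁴ = 32/81 ≤ 1/2, so
      -- the product is at most 2^(-L) with L = l + 1, while k ≤ 2^L.
      few-collisions : K * (two^ (suc l) * pow y h) ≤ℚ 1ℚ
      few-collisions = ℚP.≤-trans (*-mono (fromℕ≥0 k) (≥0-* (pow≥0 (fromℕ≥0 2) (suc l)) (pow≥0 y≥0 h))
          (subst (K ≤ℚ_) (sym (two^-ℕ (suc l))) (fromℕ-mono k≤2^L)) halves)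
        (ℚP.≤-reflexive (trans (sym (pow-* (fromℕ 2) ½ (suc l))) (pow-1 (suc l))))
        where
        y4B : fromℕ 2 * pow y (4 *ℕ suc m) ≤ℚ ½
        y4B = ℚP.≤-trans (*-monoʳ (fromℕ≥0 2) (subst (_≤ℚ pow (fromℕ 2 * recip 2) 4) (sym (pow-pow y 4 (suc m))) (pow-mono (pow≥0 y≥0 (suc m)) yB 4)))
          (ℚP.≤ᵇ⇒≤ _)
        halves : two^ (suc l) * pow y h ≤ℚ pow ½ (suc l)
        halves = subst (_≤ℚ pow ½ (suc l)) (trans (pow-* (fromℕ 2) (pow y (4 *ℕ suc m)) (suc l)) (cong (two^ (suc l) *_) (sym (pow-pow y (suc l) (4 *ℕ suc m)))))
          (pow-mono (≥0-* (fromℕ≥0 2) (pow≥0 y≥0 (4 *ℕ suc m))) y4B (suc l))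

      anti : Λ * p ≤ℚ two^ (suc l) * pow y h + κ * shifts
      anti = Law-anticoncentration β≥0 (recip≤1 m) κ≥0 odds (suc l) h cs long (near ε) (near≥0 ε) (near≤1 ε)

      Kβ≤1 : K * β ≤ℚ 1ℚ
      Kβ≤1 = subst (K * β ≤ℚ_) bβ (*-monoˡ β≥0 (fromℕ-mono k≤B))

      -- The 3 collects 1 from `few-collisions` and 2 from 2Kβ ≤ 2, the latter because k ≤ B; both
      -- are absorbed by Λ ≥ 1.
      ΛpK : Λ * (p * K) ≤ℚ Λ * (fromℕ 3 + recip 15 * (K * σ))
      ΛpK = ≤-byDiff (≥0-+ (≥0-+ (≥0-+ (≥0-+ (≥0-+ (≥0-* (fromℕ≥0 k) (≥0-sub anti)) (≥0-sub few-collisions))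
          (≥0-* (fromℕ≥0 k) (≥0-* κ≥0 (≥0-sub shifts≤))))
          (≥0-* (≥0-* (fromℕ≥0 k) (≥0-+ 0≤1 (≥0-* (recip≥0 31) (≥0-* (≥0-* (recip≥0 s) (fromℕ≥0 (suc l))) (fromℕ≥0 (suc m)))))) (≥0-sub κ≤2β)))
          (≥0-* (fromℕ≥0 2) (≥0-sub Kβ≤1)))
          (≥0-+ (≥0-* (fromℕ≥0 3) (≥0-sub Λ≥1)) (≥0-sub (ℚP.≤-reflexive (cong (λ z → recip 15 * (K * σ * Λ) * z) bβ)))))
        (r Λ p K (two^ (suc l) * pow y h) κ shifts σ b β)
        where
        r : ∀ Λ p K W κ L σ b β → Λ * (fromℕ 3 + recip 15 * (K * σ)) ≡ Λ * (p * K) + (K * (W + κ * L - Λ * p) + (1ℚ - K * W)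
          + K * (κ * (1ℚ + recip 31 * (σ * Λ * b) - L)) + K * (1ℚ + recip 31 * (σ * Λ * b)) * (fromℕ 2 * β - κ) + fromℕ 2 * (1ℚ - K * β)
          + (fromℕ 3 * (Λ - 1ℚ) + (recip 15 * (K * σ * Λ) * 1ℚ - recip 15 * (K * σ * Λ) * (b * β))))
        r = solve-∀ ring

      -- From p ≤ 3/K + 1/(16S) and K ≥ S², 8Sp ≤ 24/S + 1/2. This is where S ≥ 48 comes from.
      8Sp≤1 : fromℕ 8 * (S * p) ≤ℚ 1ℚ
      8Sp≤1 = *-cancel-≤ {K} (ℚP.<-≤-trans (ℚP.positive⁻¹ 1ℚ) K≥1) (≤-byDiff
        (≥0-+ (≥0-+ (≥0-+ (≥0-* (≥0-* (fromℕ≥0 8) S≥0) (≥0-sub pK)) (≥0-* (recip≥0 1) (≥0-sub S²≤K)))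
          (≥0-* (≥0-* (recip≥0 1) S≥0) (≥0-sub S≥48))) (≥0-sub (ℚP.≤-reflexive (cong (λ z → ½ * K * z) (suc*recip s)))))
        (r K S p σ))
        where
        pK : p * K ≤ℚ fromℕ 3 + recip 15 * (K * σ)
        pK = *-cancel-≤ (fromℕ>0 l) ΛpK
        r : ∀ K S p σ → K * 1ℚ ≡ K * (fromℕ 8 * (S * p)) + (fromℕ 8 * S * (fromℕ 3 + recip 15 * (K * σ) - p * K) + ½ * (K - S * S) + ½ * S * (S - fromℕ 48) + (½ * K * 1ℚ - ½ * K * (S * σ)))
        r = solve-∀ ring

      p≥0 : 0ℚ ≤ℚ p
      p≥0 = nonneg isL (near≥0 ε)

      -- Kp² ≤ 4S²p² ≤ 1/16 and 2p ≤ 1/(4S) ≤ 1/192; the slack to 1/4 is 35/192.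
      condition : fromℕ 2 * p + K * (p * p) ≤ℚ (ℤ.+ 1) ℚ./ 4
      condition = ≤-byDiff (≥0-+ (≥0-+ (≥0-+ (≥0-* (≥0-sub K≤4S²) (≥0-² p)) (≥0-* (recip≥0 15) (≥0-sub (*-mono 8Sp≥0 8Sp≥0 8Sp≤1 8Sp≤1))))
          (≥0-* (recip≥0 191) (≥0-+ (≥0-sub 8Sp≤1) (≥0-* (≥0-* (fromℕ≥0 8) p≥0) (≥0-sub S≥48))))) (≥0-* (fromℕ≥0 35) (recip≥0 191)))
        (r K S p)
        where
        8Sp≥0 : 0ℚ ≤ℚ fromℕ 8 * (S * p)
        8Sp≥0 = ≥0-* (fromℕ≥0 8) (≥0-* S≥0 p≥0)
        r : ∀ K S p → (ℤ.+ 1) ℚ./ 4 ≡ fromℕ 2 * p + K * (p * p) + ((fromℕ 4 * (S * S) - K) * (p * p) + recip 15 * (1ℚ * 1ℚ - fromℕ 8 * (S * p) * (fromℕ 8 * (S * p)))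
          + recip 191 * (1ℚ - fromℕ 8 * (S * p) + fromℕ 8 * p * (S - fromℕ 48)) + fromℕ 35 * recip 191)
        r = solve-∀ ring

      likely : 1ℚ ≤ℚ fromℕ 6 * errorTail ε
      likely = errorTail-lower (isExpect-ERow m n) (rowValue m i) (zipf i) symmetric odd 3≤k ε ε≥0
        (subst (λ z → fromℕ 2 * z + K * (z * z) ≤ℚ (ℤ.+ 1) ℚ./ 4) (near-law ε ε≥0) condition)

    -- Markov with P(|Z| > ε) ≥ 1/6 gives E ≥ ε/6, and 24576 = 6·4096.
    many-rows : 1ℚ ≤ℚ fromℕ 24576 * (E * b * Λ * S)
    many-rows = subst₂ _≤ℚ_ cancel (r₂ S Λ b E) (*-monoʳ (≥0-* (fromℕ≥0 4096) (≥0-* (≥0-* S≥0 (fromℕ≥0 (suc l))) (fromℕ≥0 (suc m))))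
      (≤-byDiff (≥0-+ (≥0-* ε≥0 (≥0-sub likely)) (≥0-* (fromℕ≥0 6) (≥0-sub (meanError-markov ε ε≥0)))) (r₁ ε E (errorTail ε))))
      where
      r₁ : ∀ ε E P → fromℕ 6 * E ≡ ε + (ε * (fromℕ 6 * P - 1ℚ) + fromℕ 6 * (E - ε * P))
      r₁ = solve-∀ ring
      r₂ : ∀ S Λ b E → fromℕ 4096 * (S * Λ * b) * (fromℕ 6 * E) ≡ fromℕ 24576 * (E * b * Λ * S)
      r₂ = solve-∀ ring
      r₃ : ∀ S Λ b σ λ′ β → fromℕ 4096 * (S * Λ * b) * (recip 4095 * (σ * λ′ * β)) ≡ S * σ * (Λ * λ′) * (b * β)
      r₃ = solve-∀ ring
      cancel : fromℕ 4096 * (S * Λ * b) * ε ≡ 1ℚ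
      cancel = trans (r₃ S Λ b σ λ′ β) (trans (cong₂ _*_ (cong₂ _*_ (suc*recip s) (suc*recip l)) bβ) refl)

small-constant : ∀ N → 5 ≤ N → Σ ℚ λ c → 0ℚ < c × fromℕ 24576 * c ≤ℚ 1ℚ × (∀ k → k ≤ N → fromℕ 2 * c ≤ℚ pow (recip 9) k)
small-constant N 5≤N = c , >0-* (recip>0 1) (pow>0 N) , c≤ , few
  where
  pow>0 : ∀ n → 0ℚ < pow (recip 9) n
  pow>0 zero    = ℚP.positive⁻¹ 1ℚ
  pow>0 (suc n) = >0-* (recip>0 9) (pow>0 n)
  c : ℚ
  c = ½ * pow (recip 9) N
  c≤ : fromℕ 24576 * c ≤ℚ 1ℚ
  c≤ = ℚP.≤-trans (*-monoʳ (fromℕ≥0 24576) (*-monoʳ (recip≥0 1) (pow-antitone (recip≥0 9) (recip≤1 9) 5≤N))) (ℚP.≤ᵇ⇒≤ _)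
  double : ∀ x → x ≡ fromℕ 2 * (½ * x)
  double = solve-∀ ring
  few : ∀ k → k ≤ N → fromℕ 2 * c ≤ℚ pow (recip 9) k
  few k k≤N = subst (_≤ℚ pow (recip 9) k) (double (pow (recip 9) N)) (pow-antitone (recip≥0 9) (recip≤1 9) k≤N)

-- 9216 = 4·48² separates the two lower-bound arguments; abstract keeps the power 10⁻⁹²¹⁶ unevaluated.
abstract
  lowerConstant : Σ ℚ λ c → 0ℚ < c × fromℕ 24576 * c ≤ℚ 1ℚ × (∀ k → k ≤ 9216 → fromℕ 2 * c ≤ℚ pow (recip 9) k)
  lowerConstant = small-constant 9216 (ℕP.m≤m+n 5 9211)

-- Both bounds for a positive number of buckets

module _ (k n m : ℕ) (3≤k : 3 ≤ k) (odd : k % 2 ≡ 1) (wide : k *ℕ suc m ≤ n) (k≤B : k ≤ suc m) (i : Fin n) where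

  private
    E b Λ K : ℚ
    E = expErr k n (suc m) i
    b = fromℕ (suc m)
    Λ = fromℕ ⌈log₂ k ⌉
    K = fromℕ k

    1≤k : 1 ≤ k
    1≤k = ℕP.≤-trans (s≤s z≤n) 3≤k
    1≤L : 1 ≤ ⌈log₂ k ⌉
    1≤L = 1≤⌈log₂⌉ (ℕP.≤-trans (s≤s (s≤s z≤n)) 3≤k)
    root = sqrt-bounds 1≤k
    s : ℕ
    s = proj₁ root
    s²≤k = proj₁ (proj₂ root)
    k≤4s² = proj₂ (proj₂ root)
    S : ℚ
    S = fromℕ (suc s)
    1≤m : 1 ≤ m
    1≤m = ℕP.≤-pred (ℕP.≤-trans (s≤s (s≤s z≤n)) (ℕP.≤-trans 3≤k k≤B))
    S²≤K : S * S ≤ℚ K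
    S²≤K = subst (_≤ℚ K) (fromℕ-* (suc s) (suc s)) (fromℕ-mono s²≤k)

    module R = ZipfRows m n i odd 3≤k

  upper-bound : (E * b) * (E * b) * K ≤ℚ fromℕ 4153346 * fromℕ 4153346
  upper-bound = ZipfUpper.upper m n i odd 3≤k 1≤m s s²≤k k≤4s²

  lower-bound : ∀ c → 0ℚ < c → fromℕ 24576 * c ≤ℚ 1ℚ → (∀ k → k ≤ 9216 → fromℕ 2 * c ≤ℚ pow (recip 9) k) →
    c * c ≤ℚ (E * b * Λ) * (E * b * Λ) * K
  lower-bound c c>0 c≤ few = case (ℕP.≤-total k 9216)
    where
    c≥0 : 0ℚ ≤ℚ c
    c≥0 = ℚP.<⇒≤ c>0
    square : ∀ {x r} → c ≤ℚ x * r → r * r ≤ℚ K → c * c ≤ℚ x * x * K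
    square {x} {r} c≤xr r²≤K = ℚP.≤-trans (*-mono c≥0 c≥0 c≤xr c≤xr) (subst (_≤ℚ x * x * K) (e x r) (*-monoʳ (≥0-² x) r²≤K))
      where
      e : ∀ x r → x * x * (r * r) ≡ x * r * (x * r)
      e = solve-∀ ring
    half : ∀ c → ½ * (fromℕ 2 * c) ≡ c
    half = solve-∀ ring
    case : k ≤ 9216 ⊎ 9216 ≤ k → c * c ≤ℚ (E * b * Λ) * (E * b * Λ) * K
    -- For bounded k nothing is gained from √k and log k: both are merely bounded below by 1.
    case (inj₁ k≤) = square {E * b * Λ} {1ℚ} (subst (c ≤ℚ_) (sym (ℚP.*-identityʳ (E * b * Λ))) (ℚP.≤-trans c≤Eb
        (subst (_≤ℚ E * b * Λ) (ℚP.*-identityʳ (E * b)) (*-monoʳ (ℚP.≤-trans c≥0 c≤Eb) (fromℕ-mono {1} 1≤L))))) (fromℕ-mono {1} 1≤k)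
      where
      c≤Eb : c ≤ℚ E * b
      c≤Eb = subst₂ (λ x y → x ≤ℚ y * b) (half c) (sym R.expErr≡meanError) (ZipfLower.few-rows m n i odd 3≤k k≤B wide (fromℕ 2 * c) (few k k≤))
    case (inj₂ k≥) = square {E * b * Λ} {S} (≤-byDiff (≥0-+ (≥0-* c≥0 (≥0-sub many)) (≥0-* EbΛS≥0 (≥0-sub c≤))) (r c (E * b * Λ * S))) S²≤K
      where
      l m′ : ℕ
      l = ℕ.pred ⌈log₂ k ⌉
      m′ = ℕ.pred m
      L≡ : suc l ≡ ⌈log₂ k ⌉
      L≡ = ℕP.suc-pred ⌈log₂ k ⌉ {{ℕ.>-nonZero 1≤L}}
      m≡ : m ≡ suc m′
      m≡ = sym (ℕP.suc-pred m {{ℕ.>-nonZero 1≤m}})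
      48≤s : 48 ≤ suc s
      -- If suc s were at most 47, then k ≤ 4·47² = 8836 < 9216.
      48≤s = ℕP.≮⇒≥ λ s<48 → ℕP.<-irrefl refl (ℕP.≤-trans (s≤s (ℕP.≤-trans (ℕP.≤-trans k≥ k≤4s²)
        (ℕP.*-monoʳ-≤ 4 (ℕP.*-mono-≤ (ℕP.≤-pred s<48) (ℕP.≤-pred s<48))))) (ℕP.m≤m+n 8837 379))
      many : 1ℚ ≤ℚ fromℕ 24576 * (E * b * Λ * S)
      many = subst₂ (λ x y → 1ℚ ≤ℚ fromℕ 24576 * (x * b * y * S)) (sym R.expErr≡meanError) (cong fromℕ L≡)
        (ZipfLower.ManyRows.many-rows m n i odd 3≤k k≤B wide l
          (subst (λ L → 4 *ℕ L ℕ.< k) (sym L≡) (4*⌈log₂⌉<k (ℕP.≤-trans (ℕP.m≤m+n 24 9192) k≥)))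
          (subst (λ L → k ≤ 2 ℕ.^ L) (sym L≡) (≤2^⌈log₂⌉ k)) s s²≤k k≤4s² 48≤s m′ m≡)
      EbΛS≥0 : 0ℚ ≤ℚ E * b * Λ * S
      EbΛS≥0 = *-cancel-≤ (fromℕ>0 24575) (subst (_≤ℚ fromℕ 24576 * (E * b * Λ * S)) (sym (ℚP.*-zeroʳ (fromℕ 24576))) (ℚP.≤-trans 0≤1 many))
      r : ∀ c x → x ≡ c + (c * (fromℕ 24576 * x - 1ℚ) + x * (1ℚ - fromℕ 24576 * c))
      r = solve-∀ ring

theorem4p4 : Σ ℚ λ c₁ → Σ ℚ λ c₂ → (0ℚ < c₁) × (0ℚ < c₂) ×
    ((k n B : ℕ) → 3 ≤ k → k % 2 ≡ 1 → k *ℕ B ≤ n → k ≤ B → (i : Fin n) →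
    (c₁ * c₁ ≤ℚ (expErr k n B i * fromℕ B * fromℕ ⌈log₂ k ⌉) * (expErr k n B i * fromℕ B * fromℕ ⌈log₂ k ⌉) * fromℕ k)
    × ((expErr k n B i * fromℕ B) * (expErr k n B i * fromℕ B) * fromℕ k ≤ℚ c₂ * c₂))
theorem4p4 = proj₁ lowerConstant , fromℕ 4153346 , proj₁ (proj₂ lowerConstant) , fromℕ>0 4153345 , bounds
  where
  bounds : (k n B : ℕ) → 3 ≤ k → k % 2 ≡ 1 → k *ℕ B ≤ n → k ≤ B → (i : Fin n) →
    (proj₁ lowerConstant * proj₁ lowerConstant ≤ℚ (expErr k n B i * fromℕ B * fromℕ ⌈log₂ k ⌉) * (expErr k n B i * fromℕ B * fromℕ ⌈log₂ k ⌉) * fromℕ k)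
    × ((expErr k n B i * fromℕ B) * (expErr k n B i * fromℕ B) * fromℕ k ≤ℚ fromℕ 4153346 * fromℕ 4153346)
  -- Without buckets `EFin` takes a junk value; 3 ≤ k ≤ B excludes this case.
  bounds k n zero 3≤k odd wide k≤0 i = ⊥-elim (ℕP.n≮0 (ℕP.≤-trans 3≤k k≤0))
  bounds k n (suc m) 3≤k odd wide k≤B i =
    lower-bound k n m 3≤k odd wide k≤B i (proj₁ lowerConstant) (proj₁ (proj₂ lowerConstant)) (proj₁ (proj₂ (proj₂ lowerConstant))) (proj₂ (proj₂ (proj₂ lowerConstant))) ,
    upper-bound k n m 3≤k odd wide k≤B i
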